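{- Let $p\ge 5$ be a prime. (a) $\#\,\mathrm{Ell}^+(p)=2$ if $p\equiv 1 \pmod{12}$; $\#\,\mathrm{Ell}^+(p)=1$ if $p\equiv 5,7\pmod{12}$; $\#\,\mathrm{Ell}^+(p)=0$ if $p\equiv 11\pmod{12}$. (b) There is a one-to-one correspondence between $\mathrm{Ell}^-(p)$ and the set of all reduced (not necessarily primitive) positive definite integral binary quadratic forms of discriminant $-4p$.
   Context: For a positive integer $N$ let $R(N)^+=\left\{\begin{pmatrix} a & b\sqrt N\\ c\sqrt N & d\end{pmatrix}\in \mathrm{SL}_2(\mathbb R): a,b,c,d\in\mathbb Z\right\}$, $R(N)^-=\left\{\begin{pmatrix} a\sqrt N & b\\ c & d\sqrt N\end{pmatrix}\in \mathrm{SL}_2(\mathbb R): a,b,c,d\in\mathbb Z\right\}$, and $R(N)=R(N)^+\cup R(N)^-$, a discrete subgroup of $\mathrm{SL}_2(\mathbb R)$ acting on the upper half plane $\mathbb H$ by linear fractional transformations. A point $z\in\mathbb H$ is an elliptic point for $R(N)$ if its stabilizer $R(N)_z$ contains an element other than $\pm I$ (such an element is called elliptic). $\mathrm{Ell}^-(N)$ is the set of $R(N)$-equivalence classes of points of $\mathbb H$ that are stabilized by some elliptic element lying in $R(N)^-$. $\mathrm{Ell}^+(N)$ is the complement of $\mathrm{Ell}^-(N)$ in the set of all $R(N)$-equivalence classes of elliptic points for $R(N)$. A positive definite form $AX^2+BXY+CY^2$ with $A,B,C\in\mathbb Z$ and discriminant $B^2-4AC$ is reduced if $|B|\le A\le C$,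 and $B\ge 0$ whenever $|B|=A$ or $A=C$. -}

module Defs where

open import Algebra.Bundles using (CommutativeRing; RawRing)
open import Algebra.Consequences.Setoid using (comm∧idˡ⇒id; comm∧invˡ⇒inv; comm∧distrʳ⇒distr)
import Algebra.Solver.Ring as RingSolver
open import Algebra.Solver.Ring.AlmostCommutativeRing using (fromCommutativeRing; _-Raw-AlmostCommutative⟶_)
open import Data.Fin.Base using (Fin)
open import Data.Integer.Base as ℤ using (ℤ; +_; -[1+_])
import Data.Integer.Properties as ℤ
open import Data.Maybe.Base using (Maybe; just; nothing)
open import Data.Nat.Base as ℕ using (ℕ; zero; suc; z≤n; s≤s)
import Data.Nat.Properties as ℕ
open import Data.Product.Base using (Σ; ∃-syntax; _×_; _,_; proj₁; proj₂)
open import Data.Rational.Base as ℚ using (ℚ; 0ℚ; 1ℚ; ½; ∣_∣)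
import Data.Rational.Properties as ℚ
open import Data.Rational.Solver using (module +-*-Solver)
import Data.Rational.Unnormalised.Base as ℚᵘ
import Data.Rational.Unnormalised.Properties as ℚᵘ
open import Data.Sum.Base using (_⊎_; inj₁; inj₂)
open import Function.Bundles using (Bijection)
open import Level using (0ℓ)
open import Relation.Binary.Bundles using (Setoid)
import Relation.Binary.Construct.On as On
open import Relation.Binary.PropositionalEquality as ≡ using (_≡_; refl; cong; cong₂; subst; subst₂)
import Relation.Binary.Reasoning.Setoid as SetoidReasoning
open import Relation.Nullary using (¬_; yes; no; contradiction)

open +-*-Solver using (solve; _:+_; _:*_; _:-_; :-_; _:=_; con)

half-pos : ∀ {ε} → 0ℚ ℚ.< ε → 0ℚ ℚ.< ½ ℚ.* ε
half-pos {ε} ε>0 = subst (ℚ._< ½ ℚ.* ε) (ℚ.*-zeroʳ ½) (ℚ.*-monoʳ-<-pos ½ ε>0)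

half+half : ∀ ε → ½ ℚ.* ε ℚ.+ ½ ℚ.* ε ≡ ε
half+half = solve 1 (λ e → con ½ :* e :+ con ½ :* e := e) refl

_/ᵖ_ : ℚ → Σ ℚ (0ℚ ℚ.<_) → ℚ
ε /ᵖ (K , K>0) = ε ℚ.* (ℚ.1/ K) {{ℚ.>-nonZero K>0}}

/ᵖ-pos : ∀ {ε} K → 0ℚ ℚ.< ε → 0ℚ ℚ.< ε /ᵖ K
/ᵖ-pos {ε} (K , K>0) ε>0 = ℚ.positive⁻¹ _ {{ℚ.pos*pos⇒pos ε {{ℚ.positive ε>0}} _ {{ℚ.1/pos⇒pos K {{ℚ.positive K>0}}}}}}

K*/ᵖK : ∀ ε K → proj₁ K ℚ.* (ε /ᵖ K) ≡ ε
K*/ᵖK ε (K , K>0) = begin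
  K ℚ.* (ε ℚ.* i) ≡⟨ solve 3 (λ k e i → k :* (e :* i) := e :* (k :* i)) refl K ε i ⟩
  ε ℚ.* (K ℚ.* i) ≡⟨ cong (ε ℚ.*_) (ℚ.*-inverseʳ K {{ℚ.>-nonZero K>0}}) ⟩
  ε ℚ.* 1ℚ        ≡⟨ ℚ.*-identityʳ ε ⟩
  ε ∎
  where
  open ≡.≡-Reasoning
  i = (ℚ.1/ K) {{ℚ.>-nonZero K>0}}

∣-∣-sum : ∀ {ε} u v → ∣ u ∣ ℚ.< ½ ℚ.* ε → ∣ v ∣ ℚ.< ½ ℚ.* ε → ∣ u ℚ.+ v ∣ ℚ.< ε
∣-∣-sum {ε} u v p q = subst (∣ u ℚ.+ v ∣ ℚ.<_) (half+half ε)
  (ℚ.≤-<-trans (ℚ.∣p+q∣≤∣p∣+∣q∣ u v) (ℚ.+-mono-< p q))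

∣-∣-product : ∀ {ε} K u v → ∣ u ∣ ℚ.< proj₁ K → ∣ v ∣ ℚ.< ε /ᵖ K → ∣ u ℚ.* v ∣ ℚ.< ε
∣-∣-product {ε} K@(k , k>0) u v p q = begin-strict
  ∣ u ℚ.* v ∣       ≡⟨ ℚ.∣p*q∣≡∣p∣*∣q∣ u v ⟩
  ∣ u ∣ ℚ.* ∣ v ∣   ≤⟨ ℚ.*-monoʳ-≤-nonNeg ∣ v ∣ {{ℚ.∣-∣-nonNeg v}} (ℚ.<⇒≤ p) ⟩
  k ℚ.* ∣ v ∣       <⟨ ℚ.*-monoʳ-<-pos k {{ℚ.positive k>0}} q ⟩
  k ℚ.* (ε /ᵖ K)    ≡⟨ K*/ᵖK ε K ⟩
  ε ∎
  where open ℚ.≤-Reasoning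

∣-∣-swap : ∀ p q → ∣ p ℚ.- q ∣ ≡ ∣ q ℚ.- p ∣
∣-∣-swap p q = ≡.trans (≡.sym (ℚ.∣-p∣≡∣p∣ (p ℚ.- q)))
  (cong ∣_∣ (solve 2 (λ p q → :- (p :- q) := q :- p) refl p q))

∣-∣-bound : ∀ {ε} p → p ℚ.< ε → ℚ.- p ℚ.< ε → ∣ p ∣ ℚ.< ε
∣-∣-bound {ε} p a b with ℚ.∣p∣≡p∨∣p∣≡-p p
... | inj₁ e = subst (ℚ._< ε) (≡.sym e) a
... | inj₂ e = subst (ℚ._< ε) (≡.sym e) b

∣-∣-sums : ∀ {ε} p p′ q q′ → ∣ p ℚ.- p′ ∣ ℚ.< ½ ℚ.* ε → ∣ q ℚ.- q′ ∣ ℚ.< ½ ℚ.* ε →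
           ∣ (p ℚ.+ q) ℚ.- (p′ ℚ.+ q′) ∣ ℚ.< ε
∣-∣-sums {ε} p p′ q q′ a b = subst (λ r → ∣ r ∣ ℚ.< ε)
  (solve 4 (λ p p′ q q′ → (p :- p′) :+ (q :- q′) := (p :+ q) :- (p′ :+ q′)) refl p p′ q q′)
  (∣-∣-sum _ _ a b)

∣-∣-products : ∀ {ε} K L p p′ q q′ → ∣ p ∣ ℚ.< proj₁ K → ∣ q′ ∣ ℚ.< proj₁ L →
               ∣ p ℚ.- p′ ∣ ℚ.< (½ ℚ.* ε) /ᵖ L → ∣ q ℚ.- q′ ∣ ℚ.< (½ ℚ.* ε) /ᵖ K →
               ∣ p ℚ.* q ℚ.- p′ ℚ.* q′ ∣ ℚ.< ε
∣-∣-products {ε} K L p p′ q q′ a b c d = subst (λ r → ∣ r ∣ ℚ.< ε)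
  (solve 4 (λ p p′ q q′ → p :* (q :- q′) :+ q′ :* (p :- p′) := p :* q :- p′ :* q′) refl p p′ q q′)
  (∣-∣-sum _ _ (∣-∣-product K p _ a d) (∣-∣-product L q′ _ b c))

-- Cauchy reals: the modulus is part of the data, and equality is _≈_ below.
-- Without η, and with copattern definitions of the operations, the closure
-- proofs stay folded during conversion checking.
record ℝ : Set where
  no-eta-equality
  field
    seq    : ℕ → ℚ
    cauchy : ∀ ε → 0ℚ ℚ.< ε → ∃[ k ] ∀ m n → k ℕ.≤ m → k ℕ.≤ n → ∣ seq m ℚ.- seq n ∣ ℚ.< ε

open ℝ public

infix 4 _≈_ _<_

record _≈_ (x y : ℝ) : Set where
  constructor mk≈
  field
    close : ∀ ε → 0ℚ ℚ.< ε → ∃[ k ] ∀ n → k ℕ.≤ n → ∣ seq x n ℚ.- seq y n ∣ ℚ.< ε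

open _≈_ public

-- Constructively positive difference: a fixed rational gap holds eventually.
record _<_ (x y : ℝ) : Set where
  constructor mk<
  field
    gap : ∃[ ε ] 0ℚ ℚ.< ε × ∃[ k ] ∀ n → k ℕ.≤ n → seq x n ℚ.+ ε ℚ.< seq y n

bounded : ∀ x → Σ (Σ ℚ (0ℚ ℚ.<_)) λ K → ∃[ k ] ∀ n → k ℕ.≤ n → ∣ seq x n ∣ ℚ.< proj₁ K
bounded x with cauchy x 1ℚ (ℚ.positive⁻¹ 1ℚ)
... | k , p = (∣ seq x k ∣ ℚ.+ 1ℚ , ℚ.+-mono-≤-< (ℚ.0≤∣p∣ (seq x k)) (ℚ.positive⁻¹ 1ℚ)) , k , λ n k≤n →
  ℚ.≤-<-trans
    (subst (λ r → ∣ r ∣ ℚ.≤ ∣ seq x k ∣ ℚ.+ ∣ seq x n ℚ.- seq x k ∣)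
      (solve 2 (λ a b → a :+ (b :- a) := b) refl (seq x k) (seq x n))
      (ℚ.∣p+q∣≤∣p∣+∣q∣ (seq x k) (seq x n ℚ.- seq x k)))
    (ℚ.+-monoʳ-< ∣ seq x k ∣ (p n k k≤n ℕ.≤-refl))

≤⊔₁ : ∀ {a n} b → a ℕ.⊔ b ℕ.≤ n → a ℕ.≤ n
≤⊔₁ b p = ℕ.≤-trans (ℕ.m≤m⊔n _ b) p

≤⊔₂ : ∀ a {b n} → a ℕ.⊔ b ℕ.≤ n → b ℕ.≤ n
≤⊔₂ a p = ℕ.≤-trans (ℕ.m≤n⊔m a _) p

infixl 6 _+_ _-_
infixl 7 _*_
infix  8 -_

_+_ : ℝ → ℝ → ℝ
seq    (x + y) n = seq x n ℚ.+ seq y n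
cauchy (x + y) ε ε>0 =
  let k , p = cauchy x (½ ℚ.* ε) (half-pos ε>0)
      l , q = cauchy y (½ ℚ.* ε) (half-pos ε>0)
  in k ℕ.⊔ l , λ m n a b → ∣-∣-sums (seq x m) (seq x n) (seq y m) (seq y n)
       (p m n (≤⊔₁ l a) (≤⊔₁ l b)) (q m n (≤⊔₂ k a) (≤⊔₂ k b))

_*_ : ℝ → ℝ → ℝ
seq    (x * y) n = seq x n ℚ.* seq y n
cauchy (x * y) ε ε>0 =
  let K , k₁ , x<K = bounded x
      L , l₁ , y<L = bounded y
      k₂ , p = cauchy x ((½ ℚ.* ε) /ᵖ L) (/ᵖ-pos L (half-pos ε>0))
      l₂ , q = cauchy y ((½ ℚ.* ε) /ᵖ K) (/ᵖ-pos K (half-pos ε>0))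
      k = k₁ ℕ.⊔ k₂
      l = l₁ ℕ.⊔ l₂
  in k ℕ.⊔ l , λ m n a b → ∣-∣-products K L (seq x m) (seq x n) (seq y m) (seq y n)
       (x<K m (≤⊔₁ k₂ (≤⊔₁ l a))) (y<L n (≤⊔₁ l₂ (≤⊔₂ k b)))
       (p m n (≤⊔₂ k₁ (≤⊔₁ l a)) (≤⊔₂ k₁ (≤⊔₁ l b)))
       (q m n (≤⊔₂ l₁ (≤⊔₂ k a)) (≤⊔₂ l₁ (≤⊔₂ k b)))

-_ : ℝ → ℝ
seq    (- x) n = ℚ.- seq x n
cauchy (- x) ε ε>0 =
  let k , p = cauchy x ε ε>0
  in k , λ m n a b → subst (ℚ._< ε)
       (≡.trans (≡.sym (ℚ.∣-p∣≡∣p∣ (seq x m ℚ.- seq x n)))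
         (cong ∣_∣ (solve 2 (λ p q → :- (p :- q) := :- p :- :- q) refl (seq x m) (seq x n))))
       (p m n a b)

_-_ : ℝ → ℝ → ℝ
x - y = x + - y

fromℚ : ℚ → ℝ
seq    (fromℚ q) _ = q
cauchy (fromℚ q) ε ε>0 = 0 , λ _ _ _ _ →
  subst (ℚ._< ε) (cong ∣_∣ (≡.sym (ℚ.+-inverseʳ q))) ε>0

fromℤ : ℤ → ℝ
seq    (fromℤ i) = seq    (fromℚ (i ℚ./ 1))
cauchy (fromℤ i) = cauchy (fromℚ (i ℚ./ 1))

0ᴿ 1ᴿ : ℝ
0ᴿ = fromℤ (+ 0)
1ᴿ = fromℤ (+ 1)

pointwise : ∀ {x y} → (∀ n → seq x n ≡ seq y n) → x ≈ y
pointwise {x} {y} e = mk≈ λ ε ε>0 → 0 , λ n _ → subst (ℚ._< ε)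
  (cong ∣_∣ (≡.trans (≡.sym (ℚ.+-inverseʳ (seq y n))) (cong (ℚ._- seq y n) (≡.sym (e n))))) ε>0

≈-refl : ∀ {x} → x ≈ x
≈-refl = pointwise λ _ → refl

≈-sym : ∀ {x y} → x ≈ y → y ≈ x
≈-sym {x} {y} (mk≈ f) = mk≈ λ ε ε>0 → let k , p = f ε ε>0 in
  k , λ n k≤n → subst (ℚ._< ε) (∣-∣-swap (seq x n) (seq y n)) (p n k≤n)

≈-trans : ∀ {x y z} → x ≈ y → y ≈ z → x ≈ z
≈-trans {x} {y} {z} (mk≈ f) (mk≈ g) = mk≈ λ ε ε>0 →
  let k , p = f (½ ℚ.* ε) (half-pos ε>0)
      l , q = g (½ ℚ.* ε) (half-pos ε>0)
  in k ℕ.⊔ l , λ n a → subst (λ r → ∣ r ∣ ℚ.< ε)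
       (solve 3 (λ x y z → (x :- y) :+ (y :- z) := x :- z) refl (seq x n) (seq y n) (seq z n))
       (∣-∣-sum _ _ (p n (≤⊔₁ l a)) (q n (≤⊔₂ k a)))

+-cong : ∀ {x x′ y y′} → x ≈ x′ → y ≈ y′ → x + y ≈ x′ + y′
+-cong {x} {x′} {y} {y′} (mk≈ f) (mk≈ g) = mk≈ λ ε ε>0 →
  let k , p = f (½ ℚ.* ε) (half-pos ε>0)
      l , q = g (½ ℚ.* ε) (half-pos ε>0)
  in k ℕ.⊔ l , λ n a → ∣-∣-sums (seq x n) (seq x′ n) (seq y n) (seq y′ n)
       (p n (≤⊔₁ l a)) (q n (≤⊔₂ k a))

*-cong : ∀ {x x′ y y′} → x ≈ x′ → y ≈ y′ → x * y ≈ x′ * y′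
*-cong {x} {x′} {y} {y′} (mk≈ f) (mk≈ g) = mk≈ λ ε ε>0 →
  let K , k₁ , x<K = bounded x
      L , l₁ , y′<L = bounded y′
      k₂ , p = f ((½ ℚ.* ε) /ᵖ L) (/ᵖ-pos L (half-pos ε>0))
      l₂ , q = g ((½ ℚ.* ε) /ᵖ K) (/ᵖ-pos K (half-pos ε>0))
      k = k₁ ℕ.⊔ k₂
      l = l₁ ℕ.⊔ l₂
  in k ℕ.⊔ l , λ n a → ∣-∣-products K L (seq x n) (seq x′ n) (seq y n) (seq y′ n)
       (x<K n (≤⊔₁ k₂ (≤⊔₁ l a))) (y′<L n (≤⊔₁ l₂ (≤⊔₂ k a)))
       (p n (≤⊔₂ k₁ (≤⊔₁ l a))) (q n (≤⊔₂ l₁ (≤⊔₂ k a)))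

-‿cong : ∀ {x y} → x ≈ y → - x ≈ - y
-‿cong {x} {y} (mk≈ f) = mk≈ λ ε ε>0 → let k , p = f ε ε>0 in
  k , λ n a → subst (ℚ._< ε)
       (≡.trans (≡.sym (ℚ.∣-p∣≡∣p∣ (seq x n ℚ.- seq y n)))
         (cong ∣_∣ (solve 2 (λ p q → :- (p :- q) := :- p :- :- q) refl (seq x n) (seq y n))))
       (p n a)

+-assoc : ∀ x y z → (x + y) + z ≈ x + (y + z)
+-assoc x y z = pointwise λ n → ℚ.+-assoc (seq x n) (seq y n) (seq z n)

+-comm : ∀ x y → x + y ≈ y + x
+-comm x y = pointwise λ n → ℚ.+-comm (seq x n) (seq y n)

+-identityˡ : ∀ x → 0ᴿ + x ≈ x
+-identityˡ x = pointwise λ n → ℚ.+-identityˡ (seq x n)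

+-inverseˡ : ∀ x → - x + x ≈ 0ᴿ
+-inverseˡ x = pointwise λ n → ℚ.+-inverseˡ (seq x n)

*-assoc : ∀ x y z → (x * y) * z ≈ x * (y * z)
*-assoc x y z = pointwise λ n → ℚ.*-assoc (seq x n) (seq y n) (seq z n)

*-comm : ∀ x y → x * y ≈ y * x
*-comm x y = pointwise λ n → ℚ.*-comm (seq x n) (seq y n)

*-identityˡ : ∀ x → 1ᴿ * x ≈ x
*-identityˡ x = pointwise λ n → ℚ.*-identityˡ (seq x n)

*-distribʳ-+ : ∀ x y z → (y + z) * x ≈ y * x + z * x
*-distribʳ-+ x y z = pointwise λ n → ℚ.*-distribʳ-+ (seq x n) (seq y n) (seq z n)

ℝ-setoid : Setoid 0ℓ 0ℓ
ℝ-setoid = record { Carrier = ℝ ; _≈_ = _≈_ ; isEquivalence = record { refl = ≈-refl ; sym = ≈-sym ; trans = ≈-trans } }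

ℝ-commutativeRing : CommutativeRing 0ℓ 0ℓ
ℝ-commutativeRing = record
  { Carrier = ℝ ; _≈_ = _≈_ ; _+_ = _+_ ; _*_ = _*_ ; -_ = -_ ; 0# = 0ᴿ ; 1# = 1ᴿ
  ; isCommutativeRing = record
    { isRing = record
      { +-isAbelianGroup = record
        { isGroup = record
          { isMonoid = record
            { isSemigroup = record
              { isMagma = record { isEquivalence = Setoid.isEquivalence ℝ-setoid ; ∙-cong = +-cong }
              ; assoc = +-assoc }
            ; identity = comm∧idˡ⇒id ℝ-setoid +-comm +-identityˡ }
          ; inverse = comm∧invˡ⇒inv ℝ-setoid +-comm +-inverseˡ
          ; ⁻¹-cong = -‿cong }
        ; comm = +-comm }
      ; *-cong = *-cong
      ; *-assoc = *-assoc
      ; *-identity = comm∧idˡ⇒id ℝ-setoid *-comm *-identityˡ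
      ; distrib = comm∧distrʳ⇒distr ℝ-setoid +-cong *-comm *-distribʳ-+ }
    ; *-comm = *-comm } }

/1-+ : ∀ i j → (i ℤ.+ j) ℚ./ 1 ≡ i ℚ./ 1 ℚ.+ j ℚ./ 1
/1-+ i j = ℚ.toℚᵘ-injective (begin
  ℚ.toℚᵘ ((i ℤ.+ j) ℚ./ 1)                  ≈⟨ ℚ.toℚᵘ-fromℚᵘ (ℚᵘ.mkℚᵘ (i ℤ.+ j) 0) ⟩
  ℚᵘ.mkℚᵘ (i ℤ.+ j) 0                       ≈⟨ ℚᵘ.*≡* (cong (ℤ._* + 1) (cong₂ ℤ._+_ (≡.sym (ℤ.*-identityʳ i)) (≡.sym (ℤ.*-identityʳ j)))) ⟩
  ℚᵘ.mkℚᵘ i 0 ℚᵘ.+ ℚᵘ.mkℚᵘ j 0              ≈⟨ ℚᵘ.+-cong (ℚ.toℚᵘ-fromℚᵘ (ℚᵘ.mkℚᵘ i 0)) (ℚ.toℚᵘ-fromℚᵘ (ℚᵘ.mkℚᵘ j 0)) ⟨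
  ℚ.toℚᵘ (i ℚ./ 1) ℚᵘ.+ ℚ.toℚᵘ (j ℚ./ 1)    ≈⟨ ℚ.toℚᵘ-homo-+ (i ℚ./ 1) (j ℚ./ 1) ⟨
  ℚ.toℚᵘ (i ℚ./ 1 ℚ.+ j ℚ./ 1)              ∎)
  where open ℚᵘ.≃-Reasoning

/1-* : ∀ i j → (i ℤ.* j) ℚ./ 1 ≡ i ℚ./ 1 ℚ.* (j ℚ./ 1)
/1-* i j = ℚ.toℚᵘ-injective (begin
  ℚ.toℚᵘ ((i ℤ.* j) ℚ./ 1)                  ≈⟨ ℚ.toℚᵘ-fromℚᵘ (ℚᵘ.mkℚᵘ (i ℤ.* j) 0) ⟩
  ℚᵘ.mkℚᵘ i 0 ℚᵘ.* ℚᵘ.mkℚᵘ j 0              ≈⟨ ℚᵘ.*-cong (ℚ.toℚᵘ-fromℚᵘ (ℚᵘ.mkℚᵘ i 0)) (ℚ.toℚᵘ-fromℚᵘ (ℚᵘ.mkℚᵘ j 0)) ⟨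
  ℚ.toℚᵘ (i ℚ./ 1) ℚᵘ.* ℚ.toℚᵘ (j ℚ./ 1)    ≈⟨ ℚ.toℚᵘ-homo-* (i ℚ./ 1) (j ℚ./ 1) ⟨
  ℚ.toℚᵘ (i ℚ./ 1 ℚ.* (j ℚ./ 1))            ∎)
  where open ℚᵘ.≃-Reasoning

/1-neg : ∀ i → (ℤ.- i) ℚ./ 1 ≡ ℚ.- (i ℚ./ 1)
/1-neg i = ℚ.toℚᵘ-injective (begin
  ℚ.toℚᵘ ((ℤ.- i) ℚ./ 1)   ≈⟨ ℚ.toℚᵘ-fromℚᵘ (ℚᵘ.mkℚᵘ (ℤ.- i) 0) ⟩
  ℚᵘ.- ℚᵘ.mkℚᵘ i 0         ≈⟨ ℚᵘ.-‿cong (ℚ.toℚᵘ-fromℚᵘ (ℚᵘ.mkℚᵘ i 0)) ⟨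
  ℚᵘ.- ℚ.toℚᵘ (i ℚ./ 1)    ≈⟨ ℚ.toℚᵘ-homo‿- (i ℚ./ 1) ⟨
  ℚ.toℚᵘ (ℚ.- (i ℚ./ 1))   ∎)
  where open ℚᵘ.≃-Reasoning

/1-mono-≤ : ∀ {i j} → i ℤ.≤ j → i ℚ./ 1 ℚ.≤ j ℚ./ 1
/1-mono-≤ {i} {j} i≤j = ℚ.toℚᵘ-cancel-≤ (begin
  ℚ.toℚᵘ (i ℚ./ 1) ≃⟨ ℚ.toℚᵘ-fromℚᵘ (ℚᵘ.mkℚᵘ i 0) ⟩
  ℚᵘ.mkℚᵘ i 0      ≤⟨ ℚᵘ.*≤* (ℤ.*-monoʳ-≤-nonNeg (+ 1) i≤j) ⟩
  ℚᵘ.mkℚᵘ j 0      ≃⟨ ℚ.toℚᵘ-fromℚᵘ (ℚᵘ.mkℚᵘ j 0) ⟨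
  ℚ.toℚᵘ (j ℚ./ 1) ∎)
  where open ℚᵘ.≤-Reasoning

/1-mono-< : ∀ {i j} → i ℤ.< j → i ℚ./ 1 ℚ.< j ℚ./ 1
/1-mono-< {i} {j} i<j = ℚ.toℚᵘ-cancel-< (begin-strict
  ℚ.toℚᵘ (i ℚ./ 1) ≃⟨ ℚ.toℚᵘ-fromℚᵘ (ℚᵘ.mkℚᵘ i 0) ⟩
  ℚᵘ.mkℚᵘ i 0      <⟨ ℚᵘ.*<* (ℤ.*-monoʳ-<-pos (+ 1) i<j) ⟩
  ℚᵘ.mkℚᵘ j 0      ≃⟨ ℚ.toℚᵘ-fromℚᵘ (ℚᵘ.mkℚᵘ j 0) ⟨
  ℚ.toℚᵘ (j ℚ./ 1) ∎)
  where open ℚᵘ.≤-Reasoning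

fromℤ-+ : ∀ i j → fromℤ (i ℤ.+ j) ≈ fromℤ i + fromℤ j
fromℤ-+ i j = pointwise λ _ → /1-+ i j

fromℤ-* : ∀ i j → fromℤ (i ℤ.* j) ≈ fromℤ i * fromℤ j
fromℤ-* i j = pointwise λ _ → /1-* i j

fromℤ-neg : ∀ i → fromℤ (ℤ.- i) ≈ - fromℤ i
fromℤ-neg i = pointwise λ _ → /1-neg i

⌊√_⌋ : ℕ → ℕ
⌊√ zero ⌋  = 0
⌊√ suc n ⌋ with suc ⌊√ n ⌋ ℕ.* suc ⌊√ n ⌋ ℕ.≤? suc n
... | yes _ = suc ⌊√ n ⌋
... | no  _ = ⌊√ n ⌋

⌊√⌋-lower : ∀ n → ⌊√ n ⌋ ℕ.* ⌊√ n ⌋ ℕ.≤ n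
⌊√⌋-lower zero    = z≤n
⌊√⌋-lower (suc n) with suc ⌊√ n ⌋ ℕ.* suc ⌊√ n ⌋ ℕ.≤? suc n
... | yes p = p
... | no  _ = ℕ.m≤n⇒m≤1+n (⌊√⌋-lower n)

⌊√⌋-upper : ∀ n → n ℕ.< suc ⌊√ n ⌋ ℕ.* suc ⌊√ n ⌋
⌊√⌋-upper zero    = s≤s z≤n
⌊√⌋-upper (suc n) with suc ⌊√ n ⌋ ℕ.* suc ⌊√ n ⌋ ℕ.≤? suc n
... | yes p = ℕ.≤-<-trans (⌊√⌋-upper n) (ℕ.*-mono-< (ℕ.n<1+n (suc ⌊√ n ⌋)) (ℕ.n<1+n (suc ⌊√ n ⌋)))
... | no ¬p = ℕ.≰⇒> ¬p

step : ℕ → ℚ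
step n = (+ 1) ℚ./ suc n

step≡ : ∀ n → step n ℚ.* (+ suc n ℚ./ 1) ≡ 1ℚ
step≡ n = ℚ.toℚᵘ-injective (begin
  ℚ.toℚᵘ (step n ℚ.* (+ suc n ℚ./ 1))             ≈⟨ ℚ.toℚᵘ-homo-* (step n) (+ suc n ℚ./ 1) ⟩
  ℚ.toℚᵘ (step n) ℚᵘ.* ℚ.toℚᵘ (+ suc n ℚ./ 1)     ≈⟨ ℚᵘ.*-cong (ℚ.toℚᵘ-fromℚᵘ (ℚᵘ.mkℚᵘ (+ 1) n)) (ℚ.toℚᵘ-fromℚᵘ (ℚᵘ.mkℚᵘ (+ suc n) 0)) ⟩
  ℚᵘ.mkℚᵘ (+ 1) n ℚᵘ.* ℚᵘ.mkℚᵘ (+ suc n) 0        ≈⟨ ℚᵘ.*-inverseˡ (ℚᵘ.mkℚᵘ (+ suc n) 0) ⟩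
  ℚᵘ.1ℚᵘ ∎)
  where open ℚᵘ.≃-Reasoning

step-pos : ∀ n → 0ℚ ℚ.< step n
step-pos n = ℚ.positive⁻¹ (step n) {{ℚ.normalize-pos 1 (suc n)}}

step-antimono : ∀ {m n} → m ℕ.≤ n → step n ℚ.≤ step m
step-antimono {m} {n} m≤n = ℚ.toℚᵘ-cancel-≤ (begin
  ℚ.toℚᵘ (step n)   ≃⟨ ℚ.toℚᵘ-fromℚᵘ (ℚᵘ.mkℚᵘ (+ 1) n) ⟩
  ℚᵘ.mkℚᵘ (+ 1) n   ≤⟨ ℚᵘ.*≤* (ℤ.*-monoˡ-≤-nonNeg (+ 1) (ℤ.+≤+ (s≤s m≤n))) ⟩
  ℚᵘ.mkℚᵘ (+ 1) m   ≃⟨ ℚ.toℚᵘ-fromℚᵘ (ℚᵘ.mkℚᵘ (+ 1) m) ⟨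
  ℚ.toℚᵘ (step m)   ∎)
  where open ℚᵘ.≤-Reasoning

step-small : ∀ ε → 0ℚ ℚ.< ε → ∃[ k ] ∀ n → k ℕ.≤ n → step n ℚ.< ε
step-small (ℚ.mkℚ (+ zero) b _) ε>0 = contradiction (ℚ.drop-*<* ε>0) λ { (ℤ.+<+ ()) }
step-small (ℚ.mkℚ -[1+ a ] b _) ε>0 = contradiction (ℚ.drop-*<* ε>0) λ ()
step-small ε@(ℚ.mkℚ (+ suc a) b _) ε>0 = suc b , λ n b<n → ℚ.toℚᵘ-cancel-< (begin-strict
  ℚ.toℚᵘ (step n)       ≃⟨ ℚ.toℚᵘ-fromℚᵘ (ℚᵘ.mkℚᵘ (+ 1) n) ⟩
  ℚᵘ.mkℚᵘ (+ 1) n       <⟨ ℚᵘ.*<* (ℤ.+<+ (ℕ.<-≤-trans (s≤s (subst (ℕ._< n) (≡.sym (ℕ.+-identityʳ b)) b<n)) (ℕ.m≤m+n (suc n) (a ℕ.* suc n)))) ⟩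
  ℚᵘ.mkℚᵘ (+ suc a) b   ∎)
  where open ℚᵘ.≤-Reasoning

square-cancel : ∀ {p q} → 0ℚ ℚ.≤ q → p ℚ.* p ℚ.< q ℚ.* q → p ℚ.< q
square-cancel {p} {q} q≥0 p²<q² with p ℚ.<? q
... | yes p<q = p<q
... | no  p≮q = contradiction p²<q² (λ lt → ℚ.<-irrefl refl (ℚ.<-≤-trans lt (ℚ.≤-trans
        (ℚ.*-monoˡ-≤-nonNeg q {{ℚ.nonNegative q≥0}} q≤p)
        (ℚ.*-monoʳ-≤-nonNeg p {{ℚ.nonNegative (ℚ.≤-trans q≥0 q≤p)}} q≤p))))
  where q≤p = ℚ.≮⇒≥ p≮q

/-step : ∀ i n → i ℚ./ suc n ≡ i ℚ./ 1 ℚ.* step n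
/-step i n = ℚ.toℚᵘ-injective (begin
  ℚ.toℚᵘ (i ℚ./ suc n)                  ≈⟨ ℚ.toℚᵘ-fromℚᵘ (ℚᵘ.mkℚᵘ i n) ⟩
  ℚᵘ.mkℚᵘ i n                           ≈⟨ ℚᵘ.*≡* (cong₂ ℤ._*_ (≡.sym (ℤ.*-identityʳ i)) (cong +_ (ℕ.*-identityˡ (suc n)))) ⟩
  ℚᵘ.mkℚᵘ i 0 ℚᵘ.* ℚᵘ.mkℚᵘ (+ 1) n      ≈⟨ ℚᵘ.*-cong (ℚ.toℚᵘ-fromℚᵘ (ℚᵘ.mkℚᵘ i 0)) (ℚ.toℚᵘ-fromℚᵘ (ℚᵘ.mkℚᵘ (+ 1) n)) ⟨
  ℚ.toℚᵘ (i ℚ./ 1) ℚᵘ.* ℚ.toℚᵘ (step n) ≈⟨ ℚ.toℚᵘ-homo-* (i ℚ./ 1) (step n) ⟨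
  ℚ.toℚᵘ (i ℚ./ 1 ℚ.* step n)           ∎)
  where open ℚᵘ.≃-Reasoning

numer : ℕ → ℕ → ℕ
numer N n = ⌊√ N ℕ.* (suc n ℕ.* suc n) ⌋

-- ⌊(n+1)√N⌋/(n+1), a lower approximation to √N with error below 1/(n+1).
root : ℕ → ℕ → ℚ
root N n = + numer N n ℚ./ suc n

ℕ→ℚ : ℕ → ℚ
ℕ→ℚ n = + n ℚ./ 1

ℕ→ℚ-* : ∀ m n → ℕ→ℚ (m ℕ.* n) ≡ ℕ→ℚ m ℚ.* ℕ→ℚ n
ℕ→ℚ-* m n = ≡.trans (cong (ℚ._/ 1) (ℤ.pos-* m n)) (/1-* (+ m) (+ n))

square-/ : ∀ s n → (+ s ℚ./ suc n) ℚ.* (+ s ℚ./ suc n) ≡ ℕ→ℚ (s ℕ.* s) ℚ.* (step n ℚ.* step n)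
square-/ s n = begin
  (+ s ℚ./ suc n) ℚ.* (+ s ℚ./ suc n)         ≡⟨ cong₂ ℚ._*_ (/-step (+ s) n) (/-step (+ s) n) ⟩
  (ℕ→ℚ s ℚ.* step n) ℚ.* (ℕ→ℚ s ℚ.* step n)  ≡⟨ solve 2 (λ a t → (a :* t) :* (a :* t) := (a :* a) :* (t :* t)) refl (ℕ→ℚ s) (step n) ⟩
  (ℕ→ℚ s ℚ.* ℕ→ℚ s) ℚ.* (step n ℚ.* step n)  ≡⟨ cong (ℚ._* (step n ℚ.* step n)) (ℕ→ℚ-* s s) ⟨
  ℕ→ℚ (s ℕ.* s) ℚ.* (step n ℚ.* step n)      ∎
  where open ≡.≡-Reasoning

scaled : ∀ N n → ℕ→ℚ (N ℕ.* (suc n ℕ.* suc n)) ℚ.* (step n ℚ.* step n) ≡ ℕ→ℚ N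
scaled N n = begin
  ℕ→ℚ (N ℕ.* (suc n ℕ.* suc n)) ℚ.* (t ℚ.* t)   ≡⟨ cong (ℚ._* (t ℚ.* t)) (≡.trans (ℕ→ℚ-* N (suc n ℕ.* suc n)) (cong (ℕ→ℚ N ℚ.*_) (ℕ→ℚ-* (suc n) (suc n)))) ⟩
  (ℕ→ℚ N ℚ.* (d ℚ.* d)) ℚ.* (t ℚ.* t)           ≡⟨ solve 3 (λ a d t → (a :* (d :* d)) :* (t :* t) := a :* ((t :* d) :* (t :* d))) refl (ℕ→ℚ N) d t ⟩
  ℕ→ℚ N ℚ.* ((t ℚ.* d) ℚ.* (t ℚ.* d))           ≡⟨ cong (λ u → ℕ→ℚ N ℚ.* (u ℚ.* u)) (step≡ n) ⟩
  ℕ→ℚ N ℚ.* (1ℚ ℚ.* 1ℚ)                         ≡⟨ ℚ.*-identityʳ (ℕ→ℚ N) ⟩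
  ℕ→ℚ N ∎
  where
  open ≡.≡-Reasoning
  t = step n
  d = ℕ→ℚ (suc n)

step²-pos : ∀ n → ℚ.Positive (step n ℚ.* step n)
step²-pos n = ℚ.pos*pos⇒pos (step n) {{ℚ.positive (step-pos n)}} (step n) {{ℚ.positive (step-pos n)}}

root-lower : ∀ N n → root N n ℚ.* root N n ℚ.≤ ℕ→ℚ N
root-lower N n = subst₂ ℚ._≤_ (≡.sym (square-/ (numer N n) n)) (scaled N n)
  (ℚ.*-monoʳ-≤-nonNeg (step n ℚ.* step n) {{ℚ.pos⇒nonNeg (step n ℚ.* step n) {{step²-pos n}}}}
    (/1-mono-≤ (ℤ.+≤+ (⌊√⌋-lower (N ℕ.* (suc n ℕ.* suc n))))))

root+step : ∀ N n → (+ suc (numer N n)) ℚ./ suc n ≡ root N n ℚ.+ step n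
root+step N n = begin
  (+ suc s) ℚ./ suc n                 ≡⟨ /-step (+ suc s) n ⟩
  ℕ→ℚ (suc s) ℚ.* step n              ≡⟨ cong (ℚ._* step n) (/1-+ (+ 1) (+ s)) ⟩
  (1ℚ ℚ.+ ℕ→ℚ s) ℚ.* step n           ≡⟨ solve 2 (λ a t → (con 1ℚ :+ a) :* t := a :* t :+ t) refl (ℕ→ℚ s) (step n) ⟩
  ℕ→ℚ s ℚ.* step n ℚ.+ step n         ≡⟨ cong (ℚ._+ step n) (/-step (+ s) n) ⟨
  root N n ℚ.+ step n ∎
  where
  open ≡.≡-Reasoning
  s = numer N n

root-upper : ∀ N n → ℕ→ℚ N ℚ.< (root N n ℚ.+ step n) ℚ.* (root N n ℚ.+ step n)
root-upper N n = subst₂ ℚ._<_ (scaled N n)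
  (≡.trans (≡.sym (square-/ (suc (numer N n)) n)) (cong₂ ℚ._*_ (root+step N n) (root+step N n)))
  (ℚ.*-monoˡ-<-pos (step n ℚ.* step n) {{step²-pos n}} (/1-mono-< (ℤ.+<+ (⌊√⌋-upper (N ℕ.* (suc n ℕ.* suc n))))))

root-nonNeg : ∀ N n → 0ℚ ℚ.≤ root N n
root-nonNeg N n = ℚ.nonNegative⁻¹ (root N n) {{ℚ.normalize-nonNeg (numer N n) (suc n)}}

root-compare : ∀ N m n → root N m ℚ.- root N n ℚ.< step n
root-compare N m n = subst (root N m ℚ.- root N n ℚ.<_)
  (solve 2 (λ r t → (r :+ t) :- r := t) refl (root N n) (step n))
  (ℚ.+-monoˡ-< (ℚ.- root N n) (square-cancel {root N m} {root N n ℚ.+ step n}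
    (ℚ.+-mono-≤ (root-nonNeg N n) (ℚ.<⇒≤ (step-pos n)))
    (ℚ.≤-<-trans (root-lower N m) (root-upper N n))))

√_ : ℕ → ℝ
seq    (√ N) n = root N n
cauchy (√ N) ε ε>0 = let k , p = step-small ε ε>0 in k , λ m n k≤m k≤n →
  ∣-∣-bound (root N m ℚ.- root N n)
    (ℚ.<-trans (root-compare N m n) (p n k≤n))
    (subst (ℚ._< ε) (solve 2 (λ a b → b :- a := :- (a :- b)) refl (root N m) (root N n))
      (ℚ.<-trans (root-compare N n m) (p m k≤m)))

√-square : ∀ N → √ N * √ N ≈ fromℤ (+ N)
√-square N = mk≈ λ ε ε>0 →
  let K , k , r<K = bounded (√ N)
      L = ((proj₁ K ℚ.+ proj₁ K) ℚ.+ 1ℚ) , ℚ.+-mono-< (ℚ.+-mono-< (proj₂ K) (proj₂ K)) (ℚ.positive⁻¹ 1ℚ)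
      l , t<ε = step-small (ε /ᵖ L) (/ᵖ-pos L ε>0)
  in k ℕ.⊔ l , λ n a →
    let r = root N n
        t = step n
        r<K′ = ℚ.≤-<-trans (ℚ.≤-reflexive (≡.sym (ℚ.0≤p⇒∣p∣≡p (root-nonNeg N n)))) (r<K n (≤⊔₁ l a))
        t≤1 = step-antimono {0} {n} z≤n
        N-r²<ε = begin-strict
          ℕ→ℚ N ℚ.- r ℚ.* r                          <⟨ ℚ.+-monoˡ-< (ℚ.- (r ℚ.* r)) (root-upper N n) ⟩
          (r ℚ.+ t) ℚ.* (r ℚ.+ t) ℚ.- r ℚ.* r        ≡⟨ solve 2 (λ r t → (r :+ t) :* (r :+ t) :- r :* r := (r :+ r :+ t) :* t) refl r t ⟩
          (r ℚ.+ r ℚ.+ t) ℚ.* t                      <⟨ ℚ.*-monoˡ-<-pos t {{ℚ.positive (step-pos n)}} (ℚ.+-mono-<-≤ (ℚ.+-mono-< r<K′ r<K′) t≤1) ⟩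
          proj₁ L ℚ.* t                              <⟨ ℚ.*-monoʳ-<-pos (proj₁ L) {{ℚ.positive (proj₂ L)}} (t<ε n (≤⊔₂ k a)) ⟩
          proj₁ L ℚ.* (ε /ᵖ L)                       ≡⟨ K*/ᵖK ε L ⟩
          ε ∎
    in ∣-∣-bound (r ℚ.* r ℚ.- ℕ→ℚ N)
         (ℚ.≤-<-trans (subst (r ℚ.* r ℚ.- ℕ→ℚ N ℚ.≤_) (ℚ.+-inverseʳ (ℕ→ℚ N)) (ℚ.+-monoˡ-≤ (ℚ.- ℕ→ℚ N) (root-lower N n))) ε>0)
         (subst (ℚ._< ε) (solve 2 (λ a b → a :- b := :- (b :- a)) refl (ℕ→ℚ N) (r ℚ.* r)) N-r²<ε)
  where open ℚ.≤-Reasoning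

p≤∣p∣ : ∀ p → p ℚ.≤ ∣ p ∣
p≤∣p∣ p with ℚ.≤-total 0ℚ p
... | inj₁ p≥0 = ℚ.≤-reflexive (≡.sym (ℚ.0≤p⇒∣p∣≡p p≥0))
... | inj₂ p≤0 = ℚ.≤-trans p≤0 (ℚ.0≤∣p∣ p)

square-nonNeg : ∀ p → 0ℚ ℚ.≤ p ℚ.* p
square-nonNeg p with ℚ.≤-total 0ℚ p
... | inj₁ p≥0 = ℚ.nonNegative⁻¹ _ {{ℚ.nonNeg*nonNeg⇒nonNeg p {{ℚ.nonNegative p≥0}} p {{ℚ.nonNegative p≥0}}}}
... | inj₂ p≤0 = ℚ.nonNegative⁻¹ _ {{ℚ.nonPos*nonPos⇒nonPos p {{ℚ.nonPositive p≤0}} p {{ℚ.nonPositive p≤0}}}}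

<-respʳ-≈ : ∀ {x y y′} → y ≈ y′ → x < y → x < y′
<-respʳ-≈ {x} {y} {y′} (mk≈ f) (mk< (ε , ε>0 , k , p)) =
  let l , q = f (½ ℚ.* ε) (half-pos ε>0) in
  mk< (½ ℚ.* ε , half-pos ε>0 , k ℕ.⊔ l , λ n a →
    subst₂ ℚ._<_
      (≡.trans (cong (λ e → (seq x n ℚ.+ e) ℚ.+ ℚ.- (½ ℚ.* ε)) (≡.sym (half+half ε)))
        (solve 2 (λ x e → (x :+ (e :+ e)) :- e := x :+ e) refl (seq x n) (½ ℚ.* ε)))
      (solve 2 (λ y y′ → y :- (y :- y′) := y′) refl (seq y n) (seq y′ n))
      (ℚ.+-mono-< (p n (≤⊔₁ l a)) (ℚ.neg-antimono-< (ℚ.≤-<-trans (p≤∣p∣ (seq y n ℚ.- seq y′ n)) (q n (≤⊔₂ k a))))))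

*-pos : ∀ {x y} → 0ᴿ < x → 0ᴿ < y → 0ᴿ < x * y
*-pos {x} {y} (mk< (ε , ε>0 , k , p)) (mk< (δ , δ>0 , l , q)) =
  mk< (ε ℚ.* δ , ℚ.positive⁻¹ (ε ℚ.* δ) {{ℚ.pos*pos⇒pos ε {{ℚ.positive ε>0}} δ {{ℚ.positive δ>0}}}} , k ℕ.⊔ l , λ n a →
    let ε<x = subst (ℚ._< seq x n) (ℚ.+-identityˡ ε) (p n (≤⊔₁ l a))
        δ<y = subst (ℚ._< seq y n) (ℚ.+-identityˡ δ) (q n (≤⊔₂ k a))
    in begin-strict
      0ℚ ℚ.+ ε ℚ.* δ       ≡⟨ ℚ.+-identityˡ (ε ℚ.* δ) ⟩
      ε ℚ.* δ              <⟨ ℚ.*-monoˡ-<-pos δ {{ℚ.positive δ>0}} ε<x ⟩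
      seq x n ℚ.* δ        <⟨ ℚ.*-monoʳ-<-pos (seq x n) {{ℚ.positive (ℚ.<-trans ε>0 ε<x)}} δ<y ⟩
      seq x n ℚ.* seq y n  ∎)
  where open ℚ.≤-Reasoning

+-square-pos : ∀ {x} y → 0ᴿ < x → 0ᴿ < x + y * y
+-square-pos {x} y (mk< (ε , ε>0 , k , p)) = mk< (ε , ε>0 , k , λ n a →
  subst (ℚ._< seq x n ℚ.+ seq y n ℚ.* seq y n) (ℚ.+-identityʳ (0ℚ ℚ.+ ε))
    (ℚ.+-mono-<-≤ (p n a) (square-nonNeg (seq y n))))

cancel-pos : ∀ x y → 0ᴿ < x * y → (∀ n → 0ℚ ℚ.≤ seq y n) → 0ᴿ < y
cancel-pos x y (mk< (ε , ε>0 , k , p)) y≥0 =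
  let K , l , x<K = bounded x in
  mk< (ε /ᵖ K , /ᵖ-pos K ε>0 , k ℕ.⊔ l , λ n a →
    ℚ.*-cancelˡ-<-nonNeg (proj₁ K) {{ℚ.nonNegative (ℚ.<⇒≤ (proj₂ K))}} (begin-strict
      proj₁ K ℚ.* (0ℚ ℚ.+ ε /ᵖ K)  ≡⟨ cong (proj₁ K ℚ.*_) (ℚ.+-identityˡ (ε /ᵖ K)) ⟩
      proj₁ K ℚ.* (ε /ᵖ K)         ≡⟨ K*/ᵖK ε K ⟩
      ε                            ≡⟨ ℚ.+-identityˡ ε ⟨
      0ℚ ℚ.+ ε                     <⟨ p n (≤⊔₁ l a) ⟩
      seq x n ℚ.* seq y n          ≤⟨ ℚ.*-monoʳ-≤-nonNeg (seq y n) {{ℚ.nonNegative (y≥0 n)}} (ℚ.≤-trans (p≤∣p∣ (seq x n)) (ℚ.<⇒≤ (x<K n (≤⊔₂ k a)))) ⟩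
      proj₁ K ℚ.* seq y n          ∎))
  where open ℚ.≤-Reasoning

-- Only the values at q ≢ 0 matter.
recip : ℚ → ℚ
recip q with q ℚ.≟ 0ℚ
... | yes _  = 0ℚ
... | no q≢0 = (ℚ.1/ q) {{ℚ.≢-nonZero q≢0}}

recip-inverse : ∀ {q} → 0ℚ ℚ.< q → recip q ℚ.* q ≡ 1ℚ
recip-inverse {q} q>0 with q ℚ.≟ 0ℚ
... | yes q≡0 = contradiction (≡.sym q≡0) (ℚ.<⇒≢ q>0)
... | no  q≢0 = ℚ.*-inverseˡ q {{ℚ.≢-nonZero q≢0}}

recip-pos : ∀ {q} → 0ℚ ℚ.< q → 0ℚ ℚ.< recip q
recip-pos {q} q>0 with q ℚ.≟ 0ℚ
... | yes q≡0 = contradiction (≡.sym q≡0) (ℚ.<⇒≢ q>0)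
... | no  q≢0 = ℚ.positive⁻¹ _ {{ℚ.1/pos⇒pos q {{ℚ.positive q>0}}}}

recip-antimono : ∀ {p q} → 0ℚ ℚ.< p → p ℚ.< q → recip q ℚ.< recip p
recip-antimono {p} {q} p>0 p<q = begin-strict
  recip q                          ≡⟨ ℚ.*-identityˡ (recip q) ⟨
  1ℚ ℚ.* recip q                   ≡⟨ cong (ℚ._* recip q) (recip-inverse p>0) ⟨
  (recip p ℚ.* p) ℚ.* recip q      ≡⟨ solve 3 (λ i p j → (i :* p) :* j := (i :* j) :* p) refl (recip p) p (recip q) ⟩
  (recip p ℚ.* recip q) ℚ.* p      <⟨ ℚ.*-monoʳ-<-pos (recip p ℚ.* recip q) {{ℚ.pos*pos⇒pos (recip p) {{ℚ.positive (recip-pos p>0)}} (recip q) {{ℚ.positive (recip-pos q>0)}}}} p<q ⟩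
  (recip p ℚ.* recip q) ℚ.* q      ≡⟨ ℚ.*-assoc (recip p) (recip q) q ⟩
  recip p ℚ.* (recip q ℚ.* q)      ≡⟨ cong (recip p ℚ.*_) (recip-inverse q>0) ⟩
  recip p ℚ.* 1ℚ                   ≡⟨ ℚ.*-identityʳ (recip p) ⟩
  recip p                          ∎
  where
  open ℚ.≤-Reasoning
  q>0 = ℚ.<-trans p>0 p<q

recip-difference : ∀ {p q} → 0ℚ ℚ.< p → 0ℚ ℚ.< q → recip p ℚ.* (recip q ℚ.* (q ℚ.- p)) ≡ recip p ℚ.- recip q
recip-difference {p} {q} p>0 q>0 = begin
  i ℚ.* (j ℚ.* (q ℚ.- p))                ≡⟨ solve 4 (λ i j p q → i :* (j :* (q :- p)) := i :* (j :* q) :- (i :* p) :* j) refl i j p q ⟩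
  i ℚ.* (j ℚ.* q) ℚ.- (i ℚ.* p) ℚ.* j    ≡⟨ cong₂ (λ u v → i ℚ.* u ℚ.- v ℚ.* j) (recip-inverse q>0) (recip-inverse p>0) ⟩
  i ℚ.* 1ℚ ℚ.- 1ℚ ℚ.* j                  ≡⟨ cong₂ ℚ._-_ (ℚ.*-identityʳ i) (ℚ.*-identityˡ j) ⟩
  i ℚ.- j                                ∎
  where
  open ≡.≡-Reasoning
  i = recip p
  j = recip q

inv : (x : ℝ) → 0ᴿ < x → ℝ
seq    (inv x x>0) n = recip (seq x n)
cauchy (inv x (mk< (ε , ε>0 , k , p))) δ δ>0 =
  let K = recip ε , recip-pos ε>0
      l , q = cauchy x ((δ /ᵖ K) /ᵖ K) (/ᵖ-pos K (/ᵖ-pos K δ>0))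
      above = λ n (a : k ℕ.⊔ l ℕ.≤ n) → subst (ℚ._< seq x n) (ℚ.+-identityˡ ε) (p n (≤⊔₁ l a))
      pos = λ n a → ℚ.<-trans ε>0 (above n a)
      small = λ n a → subst (ℚ._< recip ε) (≡.sym (ℚ.0≤p⇒∣p∣≡p (ℚ.<⇒≤ (recip-pos (pos n a))))) (recip-antimono ε>0 (above n a))
  in k ℕ.⊔ l , λ m n a b → subst (λ r → ∣ r ∣ ℚ.< δ) (recip-difference (pos m a) (pos n b))
       (∣-∣-product K (recip (seq x m)) _ (small m a)
         (∣-∣-product K (recip (seq x n)) _ (small n b) (q n m (≤⊔₂ k b) (≤⊔₂ k a))))

inv-inverse : ∀ x (x>0 : 0ᴿ < x) → inv x x>0 * x ≈ 1ᴿ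
inv-inverse x (mk< (ε , ε>0 , k , p)) = mk≈ λ δ δ>0 → k , λ n a →
  subst (λ r → ∣ r ℚ.- 1ℚ ∣ ℚ.< δ)
    (≡.sym (recip-inverse (ℚ.<-trans ε>0 (subst (ℚ._< seq x n) (ℚ.+-identityˡ ε) (p n a)))))
    δ>0

inv-pos : ∀ x (x>0 : 0ᴿ < x) → 0ᴿ < inv x x>0
inv-pos x (mk< (ε , ε>0 , k , p)) =
  let K , l , x<K = bounded x in
  mk< (recip (proj₁ K) , recip-pos (proj₂ K) , k ℕ.⊔ l , λ n a →
    subst (ℚ._< recip (seq x n)) (≡.sym (ℚ.+-identityˡ (recip (proj₁ K))))
      (recip-antimono (ℚ.<-trans ε>0 (subst (ℚ._< seq x n) (ℚ.+-identityˡ ε) (p n (≤⊔₁ l a))))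
        (ℚ.≤-<-trans (p≤∣p∣ (seq x n)) (x<K n (≤⊔₂ k a)))))

ℤ-rawRing : RawRing 0ℓ 0ℓ
ℤ-rawRing = CommutativeRing.rawRing ℤ.+-*-commutativeRing

fromℤ-homomorphism : ℤ-rawRing -Raw-AlmostCommutative⟶ fromCommutativeRing ℝ-commutativeRing
fromℤ-homomorphism = record
  { ⟦_⟧ = fromℤ ; +-homo = fromℤ-+ ; *-homo = fromℤ-* ; -‿homo = fromℤ-neg
  ; 0-homo = ≈-refl ; 1-homo = ≈-refl }

fromℤ-≟ : ∀ i j → Maybe (fromℤ i ≈ fromℤ j)
fromℤ-≟ i j with i ℤ.≟ j
... | yes refl = just ≈-refl
... | no  _    = nothing

module ℝ-Solver = RingSolver ℤ-rawRing (fromCommutativeRing ℝ-commutativeRing) fromℤ-homomorphism fromℤ-≟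
private module R = ℝ-Solver

record ℂ : Set where
  no-eta-equality
  field
    re : ℝ
    im : ℝ

open ℂ public

infix 4 _≈ᶜ_

record _≈ᶜ_ (z w : ℂ) : Set where
  constructor mk≈ᶜ
  field
    re-≈ : re z ≈ re w
    im-≈ : im z ≈ im w

open _≈ᶜ_ public

infixl 6 _+ᶜ_
infixl 7 _*ᶜ_
infix  8 -ᶜ_

_+ᶜ_ _*ᶜ_ : ℂ → ℂ → ℂ
re (z +ᶜ w) = re z + re w
im (z +ᶜ w) = im z + im w
re (z *ᶜ w) = re z * re w - im z * im w
im (z *ᶜ w) = re z * im w + im z * re w

-ᶜ_ : ℂ → ℂ
re (-ᶜ z) = - re z
im (-ᶜ z) = - im z

fromℝ : ℝ → ℂ
re (fromℝ x) = x
im (fromℝ x) = 0ᴿ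

conj : ℂ → ℂ
re (conj z) = re z
im (conj z) = - im z

normSq : ℂ → ℝ
normSq z = re z * re z + im z * im z

infixl 7 _/ᶜ_[_]

_/ᶜ_[_] : (z w : ℂ) → 0ᴿ < normSq w → ℂ
z /ᶜ w [ w≠0 ] = (z *ᶜ conj w) *ᶜ fromℝ (inv (normSq w) w≠0)

0ᶜ 1ᶜ : ℂ
0ᶜ = fromℝ 0ᴿ
1ᶜ = fromℝ 1ᴿ

ℂ-setoid : Setoid 0ℓ 0ℓ
ℂ-setoid = record
  { Carrier = ℂ
  ; _≈_ = _≈ᶜ_
  ; isEquivalence = record
    { refl  = mk≈ᶜ ≈-refl ≈-refl
    ; sym   = λ (mk≈ᶜ p q) → mk≈ᶜ (≈-sym p) (≈-sym q)
    ; trans = λ (mk≈ᶜ p q) (mk≈ᶜ r s) → mk≈ᶜ (≈-trans p r) (≈-trans q s) } }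

+ᶜ-cong : ∀ {z z′ w w′} → z ≈ᶜ z′ → w ≈ᶜ w′ → z +ᶜ w ≈ᶜ z′ +ᶜ w′
+ᶜ-cong (mk≈ᶜ p q) (mk≈ᶜ r s) = mk≈ᶜ (+-cong p r) (+-cong q s)

*ᶜ-cong : ∀ {z z′ w w′} → z ≈ᶜ z′ → w ≈ᶜ w′ → z *ᶜ w ≈ᶜ z′ *ᶜ w′
*ᶜ-cong (mk≈ᶜ p q) (mk≈ᶜ r s) =
  mk≈ᶜ (+-cong (*-cong p r) (-‿cong (*-cong q s))) (+-cong (*-cong p s) (*-cong q r))

-ᶜ-cong : ∀ {z z′} → z ≈ᶜ z′ → -ᶜ z ≈ᶜ -ᶜ z′
-ᶜ-cong (mk≈ᶜ p q) = mk≈ᶜ (-‿cong p) (-‿cong q)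

+ᶜ-assoc : ∀ z w v → (z +ᶜ w) +ᶜ v ≈ᶜ z +ᶜ (w +ᶜ v)
+ᶜ-assoc z w v = mk≈ᶜ (+-assoc (re z) (re w) (re v)) (+-assoc (im z) (im w) (im v))

+ᶜ-comm : ∀ z w → z +ᶜ w ≈ᶜ w +ᶜ z
+ᶜ-comm z w = mk≈ᶜ (+-comm (re z) (re w)) (+-comm (im z) (im w))

+ᶜ-identityˡ : ∀ z → 0ᶜ +ᶜ z ≈ᶜ z
+ᶜ-identityˡ z = mk≈ᶜ (+-identityˡ (re z)) (+-identityˡ (im z))

+ᶜ-inverseˡ : ∀ z → -ᶜ z +ᶜ z ≈ᶜ 0ᶜ
+ᶜ-inverseˡ z = mk≈ᶜ (+-inverseˡ (re z)) (+-inverseˡ (im z))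

*ᶜ-assoc : ∀ z w v → (z *ᶜ w) *ᶜ v ≈ᶜ z *ᶜ (w *ᶜ v)
*ᶜ-assoc z w v = mk≈ᶜ
  (R.solve 6 (λ a b c d e f →
    (a R.:* c R.:- b R.:* d) R.:* e R.:- (a R.:* d R.:+ b R.:* c) R.:* f
    R.:= a R.:* (c R.:* e R.:- d R.:* f) R.:- b R.:* (c R.:* f R.:+ d R.:* e))
    ≈-refl (re z) (im z) (re w) (im w) (re v) (im v))
  (R.solve 6 (λ a b c d e f →
    (a R.:* c R.:- b R.:* d) R.:* f R.:+ (a R.:* d R.:+ b R.:* c) R.:* e
    R.:= a R.:* (c R.:* f R.:+ d R.:* e) R.:+ b R.:* (c R.:* e R.:- d R.:* f))
    ≈-refl (re z) (im z) (re w) (im w) (re v) (im v))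

*ᶜ-comm : ∀ z w → z *ᶜ w ≈ᶜ w *ᶜ z
*ᶜ-comm z w = mk≈ᶜ
  (R.solve 4 (λ a b c d → a R.:* c R.:- b R.:* d R.:= c R.:* a R.:- d R.:* b)
    ≈-refl (re z) (im z) (re w) (im w))
  (R.solve 4 (λ a b c d → a R.:* d R.:+ b R.:* c R.:= c R.:* b R.:+ d R.:* a)
    ≈-refl (re z) (im z) (re w) (im w))

*ᶜ-identityˡ : ∀ z → 1ᶜ *ᶜ z ≈ᶜ z
*ᶜ-identityˡ z = mk≈ᶜ
  (R.solve 2 (λ a b → R.con (+ 1) R.:* a R.:- R.con (+ 0) R.:* b R.:= a) ≈-refl (re z) (im z))
  (R.solve 2 (λ a b → R.con (+ 1) R.:* b R.:+ R.con (+ 0) R.:* a R.:= b) ≈-refl (re z) (im z))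

*ᶜ-distribʳ-+ᶜ : ∀ z w v → (w +ᶜ v) *ᶜ z ≈ᶜ w *ᶜ z +ᶜ v *ᶜ z
*ᶜ-distribʳ-+ᶜ z w v = mk≈ᶜ
  (R.solve 6 (λ a b c d e f →
    (c R.:+ e) R.:* a R.:- (d R.:+ f) R.:* b
    R.:= (c R.:* a R.:- d R.:* b) R.:+ (e R.:* a R.:- f R.:* b))
    ≈-refl (re z) (im z) (re w) (im w) (re v) (im v))
  (R.solve 6 (λ a b c d e f →
    (c R.:+ e) R.:* b R.:+ (d R.:+ f) R.:* a
    R.:= (c R.:* b R.:+ d R.:* a) R.:+ (e R.:* b R.:+ f R.:* a))
    ≈-refl (re z) (im z) (re w) (im w) (re v) (im v))

ℂ-commutativeRing : CommutativeRing 0ℓ 0ℓ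
ℂ-commutativeRing = record
  { Carrier = ℂ ; _≈_ = _≈ᶜ_ ; _+_ = _+ᶜ_ ; _*_ = _*ᶜ_ ; -_ = -ᶜ_ ; 0# = 0ᶜ ; 1# = 1ᶜ
  ; isCommutativeRing = record
    { isRing = record
      { +-isAbelianGroup = record
        { isGroup = record
          { isMonoid = record
            { isSemigroup = record
              { isMagma = record { isEquivalence = Setoid.isEquivalence ℂ-setoid ; ∙-cong = +ᶜ-cong }
              ; assoc = +ᶜ-assoc }
            ; identity = comm∧idˡ⇒id ℂ-setoid +ᶜ-comm +ᶜ-identityˡ }
          ; inverse = comm∧invˡ⇒inv ℂ-setoid +ᶜ-comm +ᶜ-inverseˡ
          ; ⁻¹-cong = -ᶜ-cong }
        ; comm = +ᶜ-comm }
      ; *-cong = *ᶜ-cong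
      ; *-assoc = *ᶜ-assoc
      ; *-identity = comm∧idˡ⇒id ℂ-setoid *ᶜ-comm *ᶜ-identityˡ
      ; distrib = comm∧distrʳ⇒distr ℂ-setoid +ᶜ-cong *ᶜ-comm *ᶜ-distribʳ-+ᶜ }
    ; *-comm = *ᶜ-comm } }

fromℝ-cong : ∀ {x y} → x ≈ y → fromℝ x ≈ᶜ fromℝ y
fromℝ-cong p = mk≈ᶜ p ≈-refl

fromℝ-+ : ∀ x y → fromℝ (x + y) ≈ᶜ fromℝ x +ᶜ fromℝ y
fromℝ-+ x y = mk≈ᶜ ≈-refl (R.solve 0 (R.con (+ 0) R.:= R.con (+ 0) R.:+ R.con (+ 0)) ≈-refl)

fromℝ-* : ∀ x y → fromℝ (x * y) ≈ᶜ fromℝ x *ᶜ fromℝ y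
fromℝ-* x y = mk≈ᶜ
  (R.solve 2 (λ x y → x R.:* y R.:= x R.:* y R.:- R.con (+ 0) R.:* R.con (+ 0)) ≈-refl x y)
  (R.solve 2 (λ x y → R.con (+ 0) R.:= x R.:* R.con (+ 0) R.:+ R.con (+ 0) R.:* y) ≈-refl x y)

fromℝ-neg : ∀ x → fromℝ (- x) ≈ᶜ -ᶜ fromℝ x
fromℝ-neg x = mk≈ᶜ ≈-refl (R.solve 0 (R.con (+ 0) R.:= R.:- R.con (+ 0)) ≈-refl)

fromℤᶜ-homomorphism : ℤ-rawRing -Raw-AlmostCommutative⟶ fromCommutativeRing ℂ-commutativeRing
fromℤᶜ-homomorphism = record
  { ⟦_⟧    = λ i → fromℝ (fromℤ i)
  ; +-homo = λ i j → trans (fromℝ-cong (fromℤ-+ i j)) (fromℝ-+ (fromℤ i) (fromℤ j))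
  ; *-homo = λ i j → trans (fromℝ-cong (fromℤ-* i j)) (fromℝ-* (fromℤ i) (fromℤ j))
  ; -‿homo = λ i → trans (fromℝ-cong (fromℤ-neg i)) (fromℝ-neg (fromℤ i))
  ; 0-homo = refl′ ; 1-homo = refl′ }
  where open Setoid ℂ-setoid using (trans) renaming (refl to refl′)

fromℤᶜ-≟ : ∀ i j → Maybe (fromℝ (fromℤ i) ≈ᶜ fromℝ (fromℤ j))
fromℤᶜ-≟ i j with i ℤ.≟ j
... | yes refl = just (Setoid.refl ℂ-setoid)
... | no  _    = nothing

module ℂ-Solver = RingSolver ℤ-rawRing (fromCommutativeRing ℂ-commutativeRing) fromℤᶜ-homomorphism fromℤᶜ-≟
private module C = ℂ-Solver

conj-inverse : ∀ v (v≠0 : 0ᴿ < normSq v) → (v *ᶜ conj v) *ᶜ fromℝ (inv (normSq v) v≠0) ≈ᶜ 1ᶜ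
conj-inverse v v≠0 = mk≈ᶜ
  (≈-trans
    (R.solve 3 (λ a b i →
      (a R.:* a R.:- b R.:* (R.:- b)) R.:* i R.:- (a R.:* (R.:- b) R.:+ b R.:* a) R.:* R.con (+ 0)
      R.:= i R.:* (a R.:* a R.:+ b R.:* b)) ≈-refl (re v) (im v) i)
    (inv-inverse (normSq v) v≠0))
  (R.solve 3 (λ a b i →
    (a R.:* a R.:- b R.:* (R.:- b)) R.:* R.con (+ 0) R.:+ (a R.:* (R.:- b) R.:+ b R.:* a) R.:* i
    R.:= R.con (+ 0)) ≈-refl (re v) (im v) i)
  where i = inv (normSq v) v≠0

/ᶜ-inverse : ∀ z v (v≠0 : 0ᴿ < normSq v) → z /ᶜ v [ v≠0 ] *ᶜ v ≈ᶜ z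
/ᶜ-inverse z v v≠0 = begin
  z *ᶜ conj v *ᶜ i *ᶜ v     ≈⟨ C.solve 4 (λ z c i v → z C.:* c C.:* i C.:* v C.:= z C.:* (v C.:* c C.:* i)) refl′ z (conj v) i v ⟩
  z *ᶜ (v *ᶜ conj v *ᶜ i)   ≈⟨ *ᶜ-cong refl′ (conj-inverse v v≠0) ⟩
  z *ᶜ 1ᶜ                   ≈⟨ *-identityʳ z ⟩
  z                         ∎
  where
  open SetoidReasoning ℂ-setoid
  open CommutativeRing ℂ-commutativeRing using (*-identityʳ) renaming (refl to refl′)
  i = fromℝ (inv (normSq v) v≠0)

/ᶜ-unique : ∀ {w z} v (v≠0 : 0ᴿ < normSq v) → w *ᶜ v ≈ᶜ z → z /ᶜ v [ v≠0 ] ≈ᶜ w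
/ᶜ-unique {w} {z} v v≠0 wv≈z = begin
  z *ᶜ conj v *ᶜ i          ≈⟨ *ᶜ-cong (*ᶜ-cong wv≈z refl′) refl′ ⟨
  w *ᶜ v *ᶜ conj v *ᶜ i     ≈⟨ C.solve 4 (λ w c i v → w C.:* v C.:* c C.:* i C.:= w C.:* (v C.:* c C.:* i)) refl′ w (conj v) i v ⟩
  w *ᶜ (v *ᶜ conj v *ᶜ i)   ≈⟨ *ᶜ-cong refl′ (conj-inverse v v≠0) ⟩
  w *ᶜ 1ᶜ                   ≈⟨ *-identityʳ w ⟩
  w                         ∎
  where
  open SetoidReasoning ℂ-setoid
  open CommutativeRing ℂ-commutativeRing using (*-identityʳ) renaming (refl to refl′)
  i = fromℝ (inv (normSq v) v≠0)

record SL₂ℝ : Set where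
  no-eta-equality
  field
    a b c d : ℝ
    det     : a * d - b * c ≈ 1ᴿ

open SL₂ℝ public

infix 4 _≈ᴹ_

record _≈ᴹ_ (γ δ : SL₂ℝ) : Set where
  constructor mk≈ᴹ
  field
    a-≈ : a γ ≈ a δ
    b-≈ : b γ ≈ b δ
    c-≈ : c γ ≈ c δ
    d-≈ : d γ ≈ d δ

I : SL₂ℝ
a   I = 1ᴿ
b   I = 0ᴿ
c   I = 0ᴿ
d   I = 1ᴿ
det I = R.solve 0 (R.con (+ 1) R.:* R.con (+ 1) R.:- R.con (+ 0) R.:* R.con (+ 0) R.:= R.con (+ 1)) ≈-refl

-I : SL₂ℝ
a   -I = - 1ᴿ
b   -I = 0ᴿ
c   -I = 0ᴿ
d   -I = - 1ᴿ
det -I = R.solve 0 ((R.:- R.con (+ 1)) R.:* (R.:- R.con (+ 1)) R.:- R.con (+ 0) R.:* R.con (+ 0) R.:= R.con (+ 1)) ≈-refl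

infixl 7 _∙_

_∙_ : SL₂ℝ → SL₂ℝ → SL₂ℝ
a   (γ ∙ δ) = a γ * a δ + b γ * c δ
b   (γ ∙ δ) = a γ * b δ + b γ * d δ
c   (γ ∙ δ) = c γ * a δ + d γ * c δ
d   (γ ∙ δ) = c γ * b δ + d γ * d δ
det (γ ∙ δ) = begin
  (a γ * a δ + b γ * c δ) * (c γ * b δ + d γ * d δ) - (a γ * b δ + b γ * d δ) * (c γ * a δ + d γ * c δ)
    ≈⟨ R.solve 8 (λ a b c d a′ b′ c′ d′ →
         (a R.:* a′ R.:+ b R.:* c′) R.:* (c R.:* b′ R.:+ d R.:* d′) R.:- (a R.:* b′ R.:+ b R.:* d′) R.:* (c R.:* a′ R.:+ d R.:* c′)
         R.:= (a R.:* d R.:- b R.:* c) R.:* (a′ R.:* d′ R.:- b′ R.:* c′))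
         ≈-refl (a γ) (b γ) (c γ) (d γ) (a δ) (b δ) (c δ) (d δ) ⟩
  (a γ * d γ - b γ * c γ) * (a δ * d δ - b δ * c δ)   ≈⟨ *-cong (det γ) (det δ) ⟩
  1ᴿ * 1ᴿ                                             ≈⟨ *-identityˡ 1ᴿ ⟩
  1ᴿ ∎
  where open SetoidReasoning ℝ-setoid

_⁻¹ : SL₂ℝ → SL₂ℝ
a   (γ ⁻¹) = d γ
b   (γ ⁻¹) = - b γ
c   (γ ⁻¹) = - c γ
d   (γ ⁻¹) = a γ
det (γ ⁻¹) = ≈-trans
  (R.solve 4 (λ a b c d → d R.:* a R.:- (R.:- b) R.:* (R.:- c) R.:= a R.:* d R.:- b R.:* c)
    ≈-refl (a γ) (b γ) (c γ) (d γ))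
  (det γ)

record ℍ : Set where
  no-eta-equality
  field
    point : ℂ
    im>0  : 0ᴿ < im point

open ℍ public

infix 4 _≈ᴴ_

_≈ᴴ_ : ℍ → ℍ → Set
z ≈ᴴ w = point z ≈ᶜ point w

numerator denominator : SL₂ℝ → ℂ → ℂ
numerator   γ z = fromℝ (a γ) *ᶜ z +ᶜ fromℝ (b γ)
denominator γ z = fromℝ (c γ) *ᶜ z +ᶜ fromℝ (d γ)

im-numerator*conj : ∀ γ z → im (numerator γ z *ᶜ conj (denominator γ z)) ≈ im z
im-numerator*conj γ z = begin
  im (numerator γ z *ᶜ conj (denominator γ z))
    ≈⟨ R.solve 6 (λ a b c d x y →
         let o = R.con (+ 0)
             s = a R.:* x R.:- o R.:* y R.:+ b
             t = a R.:* y R.:+ o R.:* x R.:+ o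
             u = c R.:* x R.:- o R.:* y R.:+ d
             v = c R.:* y R.:+ o R.:* x R.:+ o
         in s R.:* (R.:- v) R.:+ t R.:* u R.:= (a R.:* d R.:- b R.:* c) R.:* y)
         ≈-refl (a γ) (b γ) (c γ) (d γ) (re z) (im z) ⟩
  (a γ * d γ - b γ * c γ) * im z   ≈⟨ *-cong (det γ) ≈-refl ⟩
  1ᴿ * im z                        ≈⟨ *-identityˡ (im z) ⟩
  im z                             ∎
  where open SetoidReasoning ℝ-setoid

denominator≠0 : ∀ γ z → 0ᴿ < im z → 0ᴿ < normSq (denominator γ z)
denominator≠0 γ z y>0 = cancel-pos (normSq n) (normSq m)
  (<-respʳ-≈ eq (+-square-pos (re (n *ᶜ conj m)) (*-pos y>0 y>0)))
  λ k → ℚ.+-mono-≤ (square-nonNeg (seq (re m) k)) (square-nonNeg (seq (im m) k))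
  where
  n = numerator γ z
  m = denominator γ z
  open SetoidReasoning ℝ-setoid
  eq : im z * im z + re (n *ᶜ conj m) * re (n *ᶜ conj m) ≈ normSq n * normSq m
  eq = begin
    im z * im z + re (n *ᶜ conj m) * re (n *ᶜ conj m)
      ≈⟨ +-cong (*-cong (im-numerator*conj γ z) (im-numerator*conj γ z)) ≈-refl ⟨
    im (n *ᶜ conj m) * im (n *ᶜ conj m) + re (n *ᶜ conj m) * re (n *ᶜ conj m)
      ≈⟨ R.solve 4 (λ s t u v →
           (s R.:* (R.:- v) R.:+ t R.:* u) R.:* (s R.:* (R.:- v) R.:+ t R.:* u)
           R.:+ (s R.:* u R.:- t R.:* (R.:- v)) R.:* (s R.:* u R.:- t R.:* (R.:- v))
           R.:= (s R.:* s R.:+ t R.:* t) R.:* (u R.:* u R.:+ v R.:* v))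
           ≈-refl (re n) (im n) (re m) (im m) ⟩
    normSq n * normSq m ∎

infixr 8 _•_

_•_ : SL₂ℝ → ℍ → ℍ
point (γ • z) = numerator γ (point z) /ᶜ denominator γ (point z) [ denominator≠0 γ (point z) (im>0 z) ]
im>0  (γ • z) = <-respʳ-≈
  (R.solve 3 (λ s t i → t R.:* i R.:= s R.:* R.con (+ 0) R.:+ t R.:* i) ≈-refl (re n) (im n) i)
  (*-pos (<-respʳ-≈ (≈-sym (im-numerator*conj γ (point z))) (im>0 z)) (inv-pos r r>0))
  where
  n = numerator γ (point z) *ᶜ conj (denominator γ (point z))
  r = normSq (denominator γ (point z))
  r>0 = denominator≠0 γ (point z) (im>0 z)
  i = inv r r>0

•-image : ∀ γ z w → γ • z ≈ᴴ w → point w *ᶜ denominator γ (point z) ≈ᶜ numerator γ (point z)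
•-image γ z w e = trans (*ᶜ-cong (sym e) (refl′ {denominator γ (point z)}))
  (/ᶜ-inverse (numerator γ (point z)) (denominator γ (point z)) (denominator≠0 γ (point z) (im>0 z)))
  where open Setoid ℂ-setoid using (trans; sym) renaming (refl to refl′)

•-image⁻¹ : ∀ γ z w → point w *ᶜ denominator γ (point z) ≈ᶜ numerator γ (point z) → γ • z ≈ᴴ w
•-image⁻¹ γ z w = /ᶜ-unique (denominator γ (point z)) (denominator≠0 γ (point z) (im>0 z))

•-identity : ∀ z → I • z ≈ᴴ z
•-identity z = •-image⁻¹ I z z
  (C.solve 1 (λ z → z C.:* (C.con (+ 0) C.:* z C.:+ C.con (+ 1)) C.:= C.con (+ 1) C.:* z C.:+ C.con (+ 0))
    (Setoid.refl ℂ-setoid) (point z))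

•-inverse : ∀ γ z w → γ • z ≈ᴴ w → γ ⁻¹ • w ≈ᴴ z
•-inverse γ z w e = •-image⁻¹ (γ ⁻¹) w z (begin
  z′ *ᶜ (fromℝ (- c γ) *ᶜ w′ +ᶜ A)                 ≈⟨ *ᶜ-cong refl′ (+ᶜ-cong (*ᶜ-cong (fromℝ-neg (c γ)) refl′) refl′) ⟩
  z′ *ᶜ (-ᶜ C′ *ᶜ w′ +ᶜ A)                         ≈⟨ C.solve 5 (λ z w a b c →
                                                        z C.:* ((C.:- c) C.:* w C.:+ a) C.:= (a C.:* z C.:+ b) C.:- (w C.:* (c C.:* z) C.:+ b)) refl′ z′ w′ A B C′ ⟩
  (A *ᶜ z′ +ᶜ B) +ᶜ -ᶜ (w′ *ᶜ (C′ *ᶜ z′) +ᶜ B)     ≈⟨ +ᶜ-cong (sym (•-image γ z w e)) refl′ ⟩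
  w′ *ᶜ (C′ *ᶜ z′ +ᶜ D) +ᶜ -ᶜ (w′ *ᶜ (C′ *ᶜ z′) +ᶜ B) ≈⟨ C.solve 5 (λ z w b c d →
                                                        w C.:* (c C.:* z C.:+ d) C.:- (w C.:* (c C.:* z) C.:+ b) C.:= d C.:* w C.:+ (C.:- b)) refl′ z′ w′ B C′ D ⟩
  D *ᶜ w′ +ᶜ -ᶜ B                                  ≈⟨ +ᶜ-cong (refl′ {D *ᶜ w′}) (sym (fromℝ-neg (b γ))) ⟩
  D *ᶜ w′ +ᶜ fromℝ (- b γ)                         ∎)
  where
  open SetoidReasoning ℂ-setoid
  open Setoid ℂ-setoid using (trans; sym) renaming (refl to refl′)
  z′ = point z
  w′ = point w
  A = fromℝ (a γ)
  B = fromℝ (b γ)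
  C′ = fromℝ (c γ)
  D = fromℝ (d γ)

•-compose : ∀ γ δ z w v → γ • z ≈ᴴ w → δ • w ≈ᴴ v → (δ ∙ γ) • z ≈ᴴ v
•-compose γ δ z w v e f = •-image⁻¹ (δ ∙ γ) z v (begin
  v′ *ᶜ denominator (δ ∙ γ) z′
    ≈⟨ *ᶜ-cong refl′ (+ᶜ-cong (*ᶜ-cong (entry (c δ) (a γ) (d δ) (c γ)) refl′) (entry (c δ) (b γ) (d δ) (d γ))) ⟩
  v′ *ᶜ ((C δ *ᶜ A γ +ᶜ D δ *ᶜ C γ) *ᶜ z′ +ᶜ (C δ *ᶜ B γ +ᶜ D δ *ᶜ D γ))
    ≈⟨ rearrange v′ (C δ) (D δ) ⟩
  v′ *ᶜ (C δ *ᶜ numerator γ z′ +ᶜ D δ *ᶜ denominator γ z′)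
    ≈⟨ *ᶜ-cong refl′ (+ᶜ-cong (*ᶜ-cong refl′ (•-image γ z w e)) refl′) ⟨
  v′ *ᶜ (C δ *ᶜ (w′ *ᶜ m) +ᶜ D δ *ᶜ m)
    ≈⟨ C.solve 5 (λ v c d w m → v C.:* (c C.:* (w C.:* m) C.:+ d C.:* m) C.:= v C.:* (c C.:* w C.:+ d) C.:* m) refl′ v′ (C δ) (D δ) w′ m ⟩
  v′ *ᶜ denominator δ w′ *ᶜ m
    ≈⟨ *ᶜ-cong (•-image δ w v f) refl′ ⟩
  numerator δ w′ *ᶜ m
    ≈⟨ C.solve 4 (λ a b w m → (a C.:* w C.:+ b) C.:* m C.:= C.con (+ 1) C.:* (a C.:* (w C.:* m) C.:+ b C.:* m)) refl′ (A δ) (B δ) w′ m ⟩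
  1ᶜ *ᶜ (A δ *ᶜ (w′ *ᶜ m) +ᶜ B δ *ᶜ m)
    ≈⟨ *ᶜ-cong refl′ (+ᶜ-cong (*ᶜ-cong refl′ (•-image γ z w e)) refl′) ⟩
  1ᶜ *ᶜ (A δ *ᶜ numerator γ z′ +ᶜ B δ *ᶜ denominator γ z′)
    ≈⟨ rearrange 1ᶜ (A δ) (B δ) ⟨
  1ᶜ *ᶜ ((A δ *ᶜ A γ +ᶜ B δ *ᶜ C γ) *ᶜ z′ +ᶜ (A δ *ᶜ B γ +ᶜ B δ *ᶜ D γ))
    ≈⟨ *ᶜ-identityˡ _ ⟩
  (A δ *ᶜ A γ +ᶜ B δ *ᶜ C γ) *ᶜ z′ +ᶜ (A δ *ᶜ B γ +ᶜ B δ *ᶜ D γ)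
    ≈⟨ +ᶜ-cong (*ᶜ-cong (entry (a δ) (a γ) (b δ) (c γ)) refl′) (entry (a δ) (b γ) (b δ) (d γ)) ⟨
  numerator (δ ∙ γ) z′ ∎)
  where
  open SetoidReasoning ℂ-setoid
  open Setoid ℂ-setoid using (trans; sym) renaming (refl to refl′)
  z′ = point z
  w′ = point w
  v′ = point v
  m = denominator γ z′
  A B C D : SL₂ℝ → ℂ
  A γ = fromℝ (a γ)
  B γ = fromℝ (b γ)
  C γ = fromℝ (c γ)
  D γ = fromℝ (d γ)
  entry : ∀ s t u v → fromℝ (s * t + u * v) ≈ᶜ fromℝ s *ᶜ fromℝ t +ᶜ fromℝ u *ᶜ fromℝ v
  entry s t u v = trans (fromℝ-+ (s * t) (u * v)) (+ᶜ-cong (fromℝ-* s t) (fromℝ-* u v))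
  rearrange : ∀ v s t → v *ᶜ ((s *ᶜ A γ +ᶜ t *ᶜ C γ) *ᶜ z′ +ᶜ (s *ᶜ B γ +ᶜ t *ᶜ D γ))
                      ≈ᶜ v *ᶜ (s *ᶜ numerator γ z′ +ᶜ t *ᶜ denominator γ z′)
  rearrange v s t = C.solve 8 (λ v s t a b c d z →
    v C.:* ((s C.:* a C.:+ t C.:* c) C.:* z C.:+ (s C.:* b C.:+ t C.:* d))
    C.:= v C.:* (s C.:* (a C.:* z C.:+ b) C.:+ t C.:* (c C.:* z C.:+ d)))
    refl′ v s t (A γ) (B γ) (C γ) (D γ) z′

IsInteger : ℝ → Set
IsInteger x = ∃[ n ] x ≈ fromℤ n

IsIntegerTimes√ : ℕ → ℝ → Set
IsIntegerTimes√ N x = ∃[ n ] x ≈ fromℤ n * √ N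

record R⁺ (N : ℕ) (γ : SL₂ℝ) : Set where
  constructor mkR⁺
  field
    a-int  : IsInteger (a γ)
    b-root : IsIntegerTimes√ N (b γ)
    c-root : IsIntegerTimes√ N (c γ)
    d-int  : IsInteger (d γ)

record R⁻ (N : ℕ) (γ : SL₂ℝ) : Set where
  constructor mkR⁻
  field
    a-root : IsIntegerTimes√ N (a γ)
    b-int  : IsInteger (b γ)
    c-int  : IsInteger (c γ)
    d-root : IsIntegerTimes√ N (d γ)

-- R(N) = R(N)⁺ ∪ R(N)⁻; the group is meant for N ≥ 1, though nothing below
-- needs that hypothesis.
R[_] : ℕ → SL₂ℝ → Set
R[ N ] γ = R⁺ N γ ⊎ R⁻ N γ

int-+ : ∀ {x y} → IsInteger x → IsInteger y → IsInteger (x + y)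
int-+ (m , p) (n , q) = m ℤ.+ n , ≈-trans (+-cong p q) (≈-sym (fromℤ-+ m n))

int-neg : ∀ {x} → IsInteger x → IsInteger (- x)
int-neg (m , p) = ℤ.- m , ≈-trans (-‿cong p) (≈-sym (fromℤ-neg m))

int-* : ∀ {x y} → IsInteger x → IsInteger y → IsInteger (x * y)
int-* (m , p) (n , q) = m ℤ.* n , ≈-trans (*-cong p q) (≈-sym (fromℤ-* m n))

root-+ : ∀ {N x y} → IsIntegerTimes√ N x → IsIntegerTimes√ N y → IsIntegerTimes√ N (x + y)
root-+ {N} (m , p) (n , q) = m ℤ.+ n , ≈-trans (+-cong p q) (≈-trans
  (≈-sym (*-distribʳ-+ (√ N) (fromℤ m) (fromℤ n))) (*-cong (≈-sym (fromℤ-+ m n)) ≈-refl))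

root-neg : ∀ {N x} → IsIntegerTimes√ N x → IsIntegerTimes√ N (- x)
root-neg {N} (m , p) = ℤ.- m , ≈-trans (-‿cong p) (≈-trans
  (R.solve 2 (λ m s → R.:- (m R.:* s) R.:= (R.:- m) R.:* s) ≈-refl (fromℤ m) (√ N))
  (*-cong (≈-sym (fromℤ-neg m)) ≈-refl))

int-*-root : ∀ {N x y} → IsInteger x → IsIntegerTimes√ N y → IsIntegerTimes√ N (x * y)
int-*-root {N} (m , p) (n , q) = m ℤ.* n , ≈-trans (*-cong p q) (≈-trans
  (≈-sym (*-assoc (fromℤ m) (fromℤ n) (√ N))) (*-cong (≈-sym (fromℤ-* m n)) ≈-refl))

root-*-int : ∀ {N x y} → IsIntegerTimes√ N x → IsInteger y → IsIntegerTimes√ N (x * y)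
root-*-int {N} {x} {y} p q = let n , r = int-*-root {N} {y} {x} q p in n , ≈-trans (*-comm x y) r

root-*-root : ∀ {N x y} → IsIntegerTimes√ N x → IsIntegerTimes√ N y → IsInteger (x * y)
root-*-root {N} {x} {y} (m , p) (n , q) = m ℤ.* n ℤ.* + N , (begin
  x * y                                  ≈⟨ *-cong p q ⟩
  fromℤ m * √ N * (fromℤ n * √ N)        ≈⟨ R.solve 3 (λ m n s → m R.:* s R.:* (n R.:* s) R.:= m R.:* n R.:* (s R.:* s)) ≈-refl (fromℤ m) (fromℤ n) (√ N) ⟩
  fromℤ m * fromℤ n * (√ N * √ N)        ≈⟨ *-cong (≈-sym (fromℤ-* m n)) (√-square N) ⟩
  fromℤ (m ℤ.* n) * fromℤ (+ N)          ≈⟨ fromℤ-* (m ℤ.* n) (+ N) ⟨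
  fromℤ (m ℤ.* n ℤ.* + N)                ∎)
  where open SetoidReasoning ℝ-setoid

R-identity : ∀ N → R[ N ] I
R-identity N = inj₁ (mkR⁺ (+ 1 , ≈-refl) zero-root zero-root (+ 1 , ≈-refl))
  where
  zero-root = + 0 , R.solve 1 (λ s → R.con (+ 0) R.:= R.con (+ 0) R.:* s) ≈-refl (√ N)

R-inverse : ∀ {N γ} → R[ N ] γ → R[ N ] (γ ⁻¹)
R-inverse (inj₁ (mkR⁺ p q r s)) = inj₁ (mkR⁺ s (root-neg q) (root-neg r) p)
R-inverse (inj₂ (mkR⁻ p q r s)) = inj₂ (mkR⁻ s (int-neg q) (int-neg r) p)

R-product : ∀ {N γ δ} → R[ N ] γ → R[ N ] δ → R[ N ] (γ ∙ δ)
R-product (inj₁ (mkR⁺ p q r s)) (inj₁ (mkR⁺ p′ q′ r′ s′)) = inj₁ (mkR⁺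
  (int-+ (int-* p p′) (root-*-root q r′)) (root-+ (int-*-root p q′) (root-*-int q s′))
  (root-+ (root-*-int r p′) (int-*-root s r′)) (int-+ (root-*-root r q′) (int-* s s′)))
R-product (inj₁ (mkR⁺ p q r s)) (inj₂ (mkR⁻ p′ q′ r′ s′)) = inj₂ (mkR⁻
  (root-+ (int-*-root p p′) (root-*-int q r′)) (int-+ (int-* p q′) (root-*-root q s′))
  (int-+ (root-*-root r p′) (int-* s r′)) (root-+ (root-*-int r q′) (int-*-root s s′)))
R-product (inj₂ (mkR⁻ p q r s)) (inj₁ (mkR⁺ p′ q′ r′ s′)) = inj₂ (mkR⁻
  (root-+ (root-*-int p p′) (int-*-root q r′)) (int-+ (root-*-root p q′) (int-* q s′))
  (int-+ (int-* r p′) (root-*-root s r′)) (root-+ (int-*-root r q′) (root-*-int s s′)))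
R-product (inj₂ (mkR⁻ p q r s)) (inj₂ (mkR⁻ p′ q′ r′ s′)) = inj₁ (mkR⁺
  (int-+ (root-*-root p p′) (int-* q r′)) (root-+ (root-*-int p q′) (int-*-root q s′))
  (root-+ (int-*-root r p′) (root-*-int s r′)) (int-+ (int-* r q′) (root-*-root s s′)))

infix 4 _∼[_]_

_∼[_]_ : ℍ → ℕ → ℍ → Set
z ∼[ N ] w = ∃[ γ ] R[ N ] γ × γ • z ≈ᴴ w

orbits : ℕ → Setoid 0ℓ 0ℓ
orbits N = record
  { Carrier = ℍ
  ; _≈_ = λ z w → z ∼[ N ] w
  ; isEquivalence = record
    { refl  = λ {z} → I , R-identity N , •-identity z
    ; sym   = λ {z} {w} (γ , γ∈R , e) → γ ⁻¹ , R-inverse γ∈R , •-inverse γ z w e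
    ; trans = λ {z} {w} {v} (γ , γ∈R , e) (δ , δ∈R , f) → δ ∙ γ , R-product δ∈R γ∈R , •-compose γ δ z w v e f } }

StabilizedByElliptic : (SL₂ℝ → Set) → ℍ → Set
StabilizedByElliptic G z = ∃[ γ ] G γ × ¬ (γ ≈ᴹ I) × ¬ (γ ≈ᴹ -I) × γ • z ≈ᴴ z

IsEllipticPoint : ℕ → ℍ → Set
IsEllipticPoint N = StabilizedByElliptic R[ N ]

-- A set of R(N)-classes is a setoid of representatives.  A class lies in Ell⁻
-- when some point of it, not necessarily the given representative, is
-- stabilized by an elliptic element of R(N)⁻.
Ell⁻-class : ℕ → ℍ → Set
Ell⁻-class N z = ∃[ w ] z ∼[ N ] w × StabilizedByElliptic (R⁻ N) w

Ell⁻ Ell⁺ : ℕ → Setoid 0ℓ 0ℓ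
Ell⁻ N = On.setoid {B = Σ ℍ (StabilizedByElliptic (R⁻ N))} (orbits N) proj₁
Ell⁺ N = On.setoid {B = Σ ℍ λ z → IsEllipticPoint N z × ¬ Ell⁻-class N z} (orbits N) proj₁

HasCardinality : Setoid 0ℓ 0ℓ → ℕ → Set
HasCardinality S n = Bijection S (≡.setoid (Fin n))

record Form : Set where
  constructor form
  field
    A B C : ℤ

open Form public

value : Form → ℤ → ℤ → ℤ
value f x y = A f ℤ.* (x ℤ.* x) ℤ.+ B f ℤ.* (x ℤ.* y) ℤ.+ C f ℤ.* (y ℤ.* y)

discriminant : Form → ℤ
discriminant f = B f ℤ.* B f ℤ.- + 4 ℤ.* A f ℤ.* C f

-- For integral forms, positivity on nonzero integer vectors is the same as
-- positivity on nonzero real vectors.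
PositiveDefinite : Form → Set
PositiveDefinite f = ∀ x y → ¬ (x ≡ + 0 × y ≡ + 0) → + 0 ℤ.< value f x y

record Reduced (f : Form) : Set where
  field
    ∣B∣≤A    : + ℤ.∣ B f ∣ ℤ.≤ A f
    A≤C      : A f ℤ.≤ C f
    boundary : + ℤ.∣ B f ∣ ≡ A f ⊎ A f ≡ C f → + 0 ℤ.≤ B f

-- Forms are identified by their coefficients alone; they need not be primitive.
reducedForms : ℤ → Setoid 0ℓ 0ℓ
reducedForms D = On.setoid
  {B = Σ Form λ f → PositiveDefinite f × Reduced f × discriminant f ≡ D} (≡.setoid Form) proj₁

{-# OPTIONS --safe #-}
-- In the coordinate w = √p z the group R(p)⁺ acts through integral matrices of determinant 1
-- whose upper right entry is divisible by p, and a point fixed by an elliptic element of R(p)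
-- is the root of an integral form [A,B,C] with A > 0 and p ∣ C. The trace of the element
-- determines the discriminant: −4p for R(p)⁻, and −4 or −3 for R(p)⁺. A form is determined by its
-- root and discriminant, so equivalent points give equivalent forms.
--
-- For D = −4p the form is a multiple of a square modulo p. Its only root modulo p can be moved
-- to (0,1) by SL₂(ℤ), and every equivalence of two forms normalised in this way has upper right
-- entry divisible by p. Hence the classes in Ell⁻(p) are the proper classes of forms of
-- discriminant −4p, and each of these contains exactly one reduced form.
--
-- For D = −4 and D = −3 there is one proper class, but the form has two roots modulo p, which the
-- Fricke involution exchanges, so each discriminant contributes at most one class to Ell⁺(p). A
-- class with D = −4 (D = −3) yields a form [p,B,C] of that discriminant, so p is of the shape
-- x² + y² (x² + xy + y²) and p ≢ 3 mod 4 (p ≢ 2 mod 3). Conversely, if p ≡ 1 mod 4 (mod 3), then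
-- x² + 1 (x² + x + 1) has a zero modulo p, and this zero gives an elliptic element.
module Submission where

-- Equality and order of these reals are not decidable, so every case distinction is made on
-- integers. A root x + iy in the upper half plane satisfies 2Ax + B = 0 and (2Ay)² = -D; with the
-- injectivity of `fromℤ` these two equations carry statements about points over to coefficients.
--
-- An equivalence between two points of Ell⁻(p) may lie in R(p)⁻, where its matrix in the coordinate
-- √p z has determinant p and gives no proper equivalence of forms. Composed with an elliptic
-- element of R(p)⁻ that fixes one of the points, it becomes an element of R(p)⁺.
--
-- The discriminants -4p, -4 and -3 never meet in one R(p)-class: an element of R(p) changes the
-- discriminant by a square factor, two integral forms with a common root have discriminants in the
-- ratio of two squares, and none of the ratios 4p : 4, 4p : 3, 4 : 3 is a rational square.
--
-- The bound p ≥ 5 makes an elliptic element of R(p)⁻ traceless: if its trace is s√p, then s²p ≤ 4,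
-- so s = 0. It also keeps 2, 3 and 4 prime to p.

-- Fermat's little theorem, roots of unity modulo p, and ratios of squares.

module PrimeModulus where

  open import Algebra.Bundles using (CommutativeSemiring)
  import Algebra.Properties.CommutativeSemiring.Binomial as Binomial
  open import Data.Fin.Base using (Fin; zero; suc; toℕ; inject₁; fromℕ; fromℕ<)
  open import Data.Fin.Properties using (¬∀⟶∃¬; toℕ<n; toℕ-inject₁; toℕ-fromℕ; toℕ-fromℕ<)
  open import Data.Integer.Base using (ℤ; +_; _+_; _*_; _-_; -_; _^_; 0ℤ; 1ℤ) renaming (∣_∣ to abs)
  open import Data.Integer.Divisibility.Signed
  open import Data.Integer.Properties
  open import Data.Integer.Solver using (module +-*-Solver)
  open import Data.Nat.Base as ℕ using (ℕ; zero; suc; z≤n; s≤s; _!)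
  open import Data.Nat.Combinatorics using (_C_; nCn≡1; k![n∸k]!∣n!)
  open import Data.Nat.Combinatorics.Specification using (nCk≡n!/k![n-k]!)
  import Data.Nat.Divisibility as ℕ
  import Data.Nat.DivMod as ℕ
  import Data.Nat.Properties as ℕ
  open import Data.Nat.Primality using (Prime; ¬prime[1]; euclidsLemma; prime⇒nonZero; prime⇒nonTrivial)
  open import Data.Nat.Solver using () renaming (module +-*-Solver to ℕ-Solver)
  open import Data.Product.Base using (∃-syntax; _×_; _,_)
  open import Data.Sum.Base as Sum using (_⊎_; inj₁; inj₂)
  open import Relation.Binary.PropositionalEquality
  open import Relation.Nullary using (¬_; contradiction)
  open +-*-Solver using (solve; con; _:+_; _:*_; _:-_; :-_; _:=_)
  private
    module S = CommutativeSemiring +-*-commutativeSemiring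
  open import Algebra.Properties.Semiring.Exp S.semiring using () renaming (_^_ to _^ˢ_)
  open import Algebra.Properties.Semiring.Mult S.semiring using () renaming (_×_ to _×ˢ_)
  open import Algebra.Properties.Semiring.Sum S.semiring using (sum; sum-init-last)
  open import Algebra.Properties.Semiring.Binomial S.semiring using (binomialTerm)

  Δ : (ℤ → ℤ) → ℤ → ℤ
  Δ f x = f (x + 1ℤ) - f x

  -- The k-th forward difference is constantly `c`. This stands in for a polynomial of degree at
  -- most k whose coefficient of x^k is c / k!, so that no polynomials have to be represented.
  ConstΔ : ℕ → ℤ → (ℤ → ℤ) → Set
  ConstΔ zero    c f = ∀ x → f x ≡ c
  ConstΔ (suc k) c f = ConstΔ k c (Δ f)

  ConstΔ-ext : ∀ k {c f g} → (∀ x → f x ≡ g x) → ConstΔ k c f → ConstΔ k c g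
  ConstΔ-ext zero    e t x = trans (sym (e x)) (t x)
  ConstΔ-ext (suc k) e t   = ConstΔ-ext k (λ x → cong₂ _-_ (e (x + 1ℤ)) (e x)) t

  ConstΔ-shift : ∀ k {c f} → ConstΔ k c f → ConstΔ k c (λ x → f (x + 1ℤ))
  ConstΔ-shift zero    t x = t (x + 1ℤ)
  ConstΔ-shift (suc k) t   = ConstΔ-shift k t

  ConstΔ-+ : ∀ k {c d f g} → ConstΔ k c f → ConstΔ k d g → ConstΔ k (c + d) (λ x → f x + g x)
  ConstΔ-+ zero    s t x = cong₂ _+_ (s x) (t x)
  ConstΔ-+ (suc k) {f = f} {g} s t = ConstΔ-ext k
    (λ x → solve 4 (λ a b c d → (a :- b) :+ (c :- d) := (a :+ c) :- (b :+ d)) refl (f (x + 1ℤ)) (f x) (g (x + 1ℤ)) (g x))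
    (ConstΔ-+ k {f = Δ f} {g = Δ g} s t)

  -- The product rule reads Δ(x f) = x Δf + f(x + 1); its second term adds one more copy of `c` at
  -- each stage of the induction.
  ConstΔ-* : ∀ k {c f} → ConstΔ k c f → ConstΔ (suc k) (+ suc k * c) (λ x → x * f x)
  ConstΔ-* zero {c} {f} t x = begin
    (x + 1ℤ) * f (x + 1ℤ) - x * f x   ≡⟨ cong₂ (λ u v → (x + 1ℤ) * u - x * v) (t (x + 1ℤ)) (t x) ⟩
    (x + 1ℤ) * c - x * c              ≡⟨ solve 2 (λ x c → (x :+ con 1ℤ) :* c :- x :* c := con 1ℤ :* c) refl x c ⟩
    1ℤ * c                            ∎
    where open ≡-Reasoning
  ConstΔ-* (suc k) {c} {f} t = subst (λ e → ConstΔ (suc k) e (Δ (λ x → x * f x)))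
    (solve 2 (λ n c → n :* c :+ c := (con 1ℤ :+ n) :* c) refl (+ suc k) c)
    (ConstΔ-ext (suc k)
      (λ x → solve 3 (λ x u v → x :* (u :- v) :+ u := (x :+ con 1ℤ) :* u :- x :* v) refl x (f (x + 1ℤ)) (f x))
      (ConstΔ-+ (suc k) {f = λ x → x * Δ f x} {g = λ x → f (x + 1ℤ)} (ConstΔ-* k {f = Δ f} t) (ConstΔ-shift (suc k) {f = f} t)))

  ConstΔ-^ : ∀ k → ConstΔ k (+ (k !)) (_^ k)
  ConstΔ-^ zero    x = refl
  ConstΔ-^ (suc k)   = subst (λ e → ConstΔ (suc k) e (_^ suc k)) (sym (pos-* (suc k) (k !))) (ConstΔ-* k (ConstΔ-^ k))

  -- The k-th difference at `a` is an integral combination of f(a), ..., f(a + k).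
  ConstΔ-∣ : ∀ k {c f d} a → ConstΔ k c f → (∀ i → i ℕ.≤ k → d ∣ f (a + + i)) → d ∣ c
  ConstΔ-∣ zero    {d = d} a t h = subst (d ∣_) (t (a + + 0)) (h 0 z≤n)
  ConstΔ-∣ (suc k) {f = f} {d} a t h = ConstΔ-∣ k a t λ i i≤k → ∣m∣n⇒∣m-n
    (subst (λ x → d ∣ f x) (trans (cong (_+_ a) (trans (cong +_ (ℕ.+-comm 1 i)) (pos-+ i 1))) (sym (+-assoc a (+ i) 1ℤ))) (h (suc i) (s≤s i≤k)))
    (h i (ℕ.m≤n⇒m≤1+n i≤k))

  ∣-euclid : ∀ {p} → Prime p → ∀ a b → + p ∣ a * b → + p ∣ a ⊎ + p ∣ b
  ∣-euclid {p} pr a b h = Sum.map ∣ᵤ⇒∣ ∣ᵤ⇒∣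
    (euclidsLemma (abs a) (abs b) pr (subst (p ℕ.∣_) (abs-* a b) (∣⇒∣ᵤ h)))

  ∤-small : ∀ {p k} → 0 ℕ.< k → k ℕ.< p → ¬ (p ℕ.∣ k)
  ∤-small {k = suc k} _ k<p h = ℕ.<⇒≱ k<p (ℕ.∣⇒≤ h)

  ∤-! : ∀ {p} → Prime p → ∀ k → k ℕ.< p → ¬ (p ℕ.∣ k !)
  ∤-! pr zero    k<p h = contradiction (subst Prime (ℕ.∣1⇒≡1 h) pr) ¬prime[1]
  ∤-! pr (suc k) k<p h with euclidsLemma (suc k) (k !) pr h
  ... | inj₁ q = ∤-small (s≤s z≤n) k<p q
  ... | inj₂ q = ∤-! pr k (ℕ.<-trans (ℕ.n<1+n k) k<p) q

  -- x^k − 1 cannot vanish at k + 1 consecutive residues, its k-th difference being k!.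
  nontrivial-power : ∀ {p} → Prime p → ∀ k → 0 ℕ.< k → suc k ℕ.< p →
                     ∃[ x ] 0 ℕ.< x × x ℕ.< p × ¬ (+ p ∣ (+ x) ^ k - 1ℤ)
  nontrivial-power {p} pr (suc k) _ k<p =
    let i , ¬h = ¬∀⟶∃¬ (suc (suc k)) (λ i → + p ∣ (+ suc (toℕ i)) ^ suc k - 1ℤ)
                   (λ i → + p ∣? _) all-bad
    in suc (toℕ i) , s≤s z≤n , ℕ.≤-<-trans (toℕ<n i) k<p , ¬h
    where
    all-bad : ¬ (∀ (i : Fin (suc (suc k))) → + p ∣ (+ suc (toℕ i)) ^ suc k - 1ℤ)
    all-bad h = ∤-! pr (suc k) (ℕ.<-trans (ℕ.n<1+n (suc k)) k<p) (∣⇒∣ᵤ (ConstΔ-∣ (suc k) {f = λ x → x ^ suc k - 1ℤ} 1ℤ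
      (ConstΔ-ext k (λ x → solve 2 (λ u v → u :- v := (u :- con 1ℤ) :- (v :- con 1ℤ)) refl ((x + 1ℤ) ^ suc k) (x ^ suc k)) (ConstΔ-^ (suc k)))
      (λ i i≤k → subst (λ n → + p ∣ (+ suc n) ^ suc k - 1ℤ) (toℕ-fromℕ< (s≤s i≤k)) (h (fromℕ< (s≤s i≤k))))))

  ^ˢ≡^ : ∀ x n → x ^ˢ n ≡ x ^ n
  ^ˢ≡^ x zero    = refl
  ^ˢ≡^ x (suc n) = cong (x *_) (^ˢ≡^ x n)

  ∣-sum : ∀ {d} n (t : Fin n → ℤ) → (∀ i → d ∣ t i) → d ∣ sum t
  ∣-sum {d} zero    t h = subst (d ∣_) (*-zeroʳ d) (∣m⇒∣m*n 0ℤ ∣-refl)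
  ∣-sum (suc n) t h = ∣m∣n⇒∣m+n (h zero) (∣-sum n (λ i → t (suc i)) (λ i → h (suc i)))

  ∣-× : ∀ {d} n x → d ℕ.∣ n → + d ∣ n ×ˢ x
  ∣-× {d} n x h = subst (+ d ∣_) (sym (×≡* n)) (∣m⇒∣m*n x (∣ᵤ⇒∣ {+ d} {+ n} h))
    where
    ×≡* : ∀ n → n ×ˢ x ≡ + n * x
    ×≡* zero    = sym (*-zeroˡ x)
    ×≡* (suc n) = trans (cong (_+_ x) (×≡* n)) (solve 2 (λ x n → x :+ n :* x := (con 1ℤ :+ n) :* x) refl x (+ n))

  -- The prime divides p! = C(p,k) · k! · (p - k)!, but neither of the two factorials on the right.
  prime∣C : ∀ {p} → Prime p → ∀ k → 0 ℕ.< k → k ℕ.< p → p ℕ.∣ p C k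
  prime∣C {p} pr k 0<k k<p with euclidsLemma (p C k) (k ! ℕ.* (p ℕ.∸ k) !) pr p∣product
    where
    instance _ = k ℕ.!* (p ℕ.∸ k) !≢0
    p∣p! : ∀ n → ℕ.NonZero n → n ℕ.∣ n !
    p∣p! (suc n) _ = ℕ.m∣m*n (n !)
    p∣product : p ℕ.∣ (p C k) ℕ.* (k ! ℕ.* (p ℕ.∸ k) !)
    p∣product = subst (p ℕ.∣_)
      (sym (trans (cong (ℕ._* (k ! ℕ.* (p ℕ.∸ k) !)) (nCk≡n!/k![n-k]! (ℕ.<⇒≤ k<p))) (ℕ.m/n*n≡m (k![n∸k]!∣n! (ℕ.<⇒≤ k<p)))))
      (p∣p! p (prime⇒nonZero pr))
  ... | inj₁ q = q
  ... | inj₂ q with euclidsLemma (k !) ((p ℕ.∸ k) !) pr q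
  ...   | inj₁ r = contradiction r (∤-! pr k k<p)
  ...   | inj₂ r = contradiction r (∤-! pr (p ℕ.∸ k) (ℕ.∸-monoʳ-< 0<k (ℕ.<⇒≤ k<p)))

  -- The two end terms of the binomial sum are 1 and x^p; `prime∣C` disposes of all the others.
  freshman : ∀ {p} → Prime p → ∀ x → + p ∣ (x + 1ℤ) ^ p - (x ^ p + 1ℤ)
  freshman {zero}  pr x = contradiction refl (ℕ.≢-nonZero⁻¹ 0 {{prime⇒nonZero pr}})
  freshman {suc m} pr x = subst (+ suc m ∣_) (sym eq) (∣-sum m (λ i → t (suc (inject₁ i))) middle)
    where
    t = binomialTerm x 1ℤ (suc m)
    one : ∀ n → 1ℤ ^ˢ n ≡ 1ℤ
    one n = trans (^ˢ≡^ 1ℤ n) (^-zeroˡ n)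
    first : t zero ≡ 1ℤ
    first = cong (λ e → 1ℤ * e + 0ℤ) (one (suc m))
    last : t (suc (fromℕ m)) ≡ x ^ suc m
    last = begin
      t (suc (fromℕ m))
        ≡⟨ cong (λ k → (suc m C k) ×ˢ (x ^ˢ k * 1ℤ ^ˢ (suc m ℕ.∸ k))) (cong suc (toℕ-fromℕ m)) ⟩
      (suc m C suc m) ×ˢ (x ^ˢ suc m * 1ℤ ^ˢ (m ℕ.∸ m))
        ≡⟨ cong₂ (λ c e → c ×ˢ (x ^ˢ suc m * e)) (nCn≡1 (suc m)) (one (m ℕ.∸ m)) ⟩
      x ^ˢ suc m * 1ℤ + 0ℤ
        ≡⟨ trans (+-identityʳ (x ^ˢ suc m * 1ℤ)) (trans (*-identityʳ (x ^ˢ suc m)) (^ˢ≡^ x (suc m))) ⟩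
      x ^ suc m ∎
      where open ≡-Reasoning
    middle : ∀ i → + suc m ∣ t (suc (inject₁ i))
    middle i = ∣-× (suc m C toℕ (suc (inject₁ i))) (x ^ˢ toℕ (suc (inject₁ i)) * 1ℤ ^ˢ (suc m ℕ.∸ toℕ (suc (inject₁ i)))) (prime∣C pr (suc (toℕ (inject₁ i))) (s≤s z≤n)
      (s≤s (subst (ℕ._< m) (sym (toℕ-inject₁ i)) (toℕ<n i))))
    eq : (x + 1ℤ) ^ suc m - (x ^ suc m + 1ℤ) ≡ sum (λ i → t (suc (inject₁ i)))
    eq = begin
      (x + 1ℤ) ^ suc m - (x ^ suc m + 1ℤ)
        ≡⟨ cong (_- (x ^ suc m + 1ℤ)) (trans (sym (^ˢ≡^ (x + 1ℤ) (suc m))) (Binomial.theorem +-*-commutativeSemiring (suc m) x 1ℤ)) ⟩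
      t zero + sum (λ i → t (suc i)) - (x ^ suc m + 1ℤ)
        ≡⟨ cong₂ (λ u v → u + v - (x ^ suc m + 1ℤ)) first (trans (sum-init-last (λ i → t (suc i))) (cong (_+_ s) last)) ⟩
      1ℤ + (s + x ^ suc m) - (x ^ suc m + 1ℤ)
        ≡⟨ solve 2 (λ s y → con 1ℤ :+ (s :+ y) :- (y :+ con 1ℤ) := s) refl s (x ^ suc m) ⟩
      s ∎
      where
      open ≡-Reasoning
      s = sum (λ i → t (suc (inject₁ i)))

  fermat : ∀ {p} → Prime p → ∀ n → + p ∣ (+ n) ^ p - + n
  fermat {zero}  pr n = contradiction refl (ℕ.≢-nonZero⁻¹ 0 {{prime⇒nonZero pr}})
  fermat {suc m} pr zero = subst (+ suc m ∣_) (*-zeroʳ (+ suc m)) (∣m⇒∣m*n 0ℤ ∣-refl)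
  fermat {p} pr (suc n) = subst (λ k → + p ∣ k ^ p - k) (cong +_ (ℕ.+-comm n 1)) (subst (+ p ∣_)
    (solve 3 (λ u v w → (u :- (v :+ con 1ℤ)) :+ (v :- w) := u :- (w :+ con 1ℤ)) refl ((+ n + 1ℤ) ^ p) ((+ n) ^ p) (+ n))
    (∣m∣n⇒∣m+n (freshman pr (+ n)) (fermat pr n)))

  fermat-unit : ∀ {p} → Prime p → ∀ n → 0 ℕ.< n → n ℕ.< p → + p ∣ (+ n) ^ (p ℕ.∸ 1) - 1ℤ
  fermat-unit {zero}  pr n _ ()
  fermat-unit {suc m} pr n 0<n n<p with ∣-euclid pr (+ n) ((+ n) ^ m - 1ℤ)
    (subst (+ suc m ∣_) (solve 2 (λ n y → n :* y :- n := n :* (y :- con 1ℤ)) refl (+ n) ((+ n) ^ m)) (fermat pr n))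
  ... | inj₁ h = contradiction (∣⇒∣ᵤ h) (∤-small 0<n n<p)
  ... | inj₂ h = h

  module _ {p} (pr : Prime p) (c k : ℕ) (p≡ : p ≡ 1 ℕ.+ c ℕ.* k) (2≤c : 2 ℕ.≤ c) where

    cofactor-positive : 0 ℕ.< k
    cofactor-positive = ℕ.n≢0⇒n>0 λ k≡0 →
      ¬prime[1] (subst Prime (trans p≡ (cong suc (trans (cong (c ℕ.*_) k≡0) (ℕ.*-zeroʳ c)))) pr)

    cofactor-bound : suc k ℕ.< p
    cofactor-bound = subst (suc k ℕ.<_) (sym p≡) (s≤s (ℕ.<-≤-trans
      (ℕ.m<m+n k (subst (0 ℕ.<_) (sym (ℕ.+-identityʳ k)) cofactor-positive)) (ℕ.*-monoˡ-≤ k 2≤c)))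

    -- Since c ≥ 2, the exponent k = (p - 1)/c is small enough for `nontrivial-power`, and (x^k)^c =
    -- x^(p-1) is 1 by Fermat.
    root-of-unity : ∃[ x ] ¬ (+ p ∣ x ^ k - 1ℤ) × + p ∣ (x ^ k) ^ c - 1ℤ
    root-of-unity with nontrivial-power pr k cofactor-positive cofactor-bound
    ... | x , 0<x , x<p , ¬h = + x , ¬h ,
      subst (λ y → + p ∣ y - 1ℤ) (trans (cong ((+ x) ^_) (trans (cong (ℕ._∸ 1) p≡) (ℕ.*-comm c k))) (sym (^-*-assoc (+ x) k c)))
        (fermat-unit pr x 0<x x<p)

  cancel-root : ∀ {p} → Prime p → ∀ y e → ¬ (+ p ∣ y - 1ℤ) → + p ∣ (y - 1ℤ) * e → + p ∣ e
  cancel-root pr y e ¬h h = Sum.[ (λ h → contradiction h ¬h) , (λ h → h) ] (∣-euclid pr (y - 1ℤ) e h)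

  cube-root-of-1 : ∀ {p} → Prime p → ∀ k → p ≡ 1 ℕ.+ 3 ℕ.* k → ∃[ x ] + p ∣ x * x + x + 1ℤ
  cube-root-of-1 {p} pr k p≡ with root-of-unity pr 3 k p≡ (s≤s (s≤s z≤n))
  ... | x , ¬h , h = x ^ k , cancel-root pr (x ^ k) (x ^ k * x ^ k + x ^ k + 1ℤ) ¬h (subst (+ p ∣_)
    (solve 1 (λ y → y :* (y :* (y :* con 1ℤ)) :- con 1ℤ := (y :- con 1ℤ) :* (y :* y :+ y :+ con 1ℤ)) refl (x ^ k)) h)

  -- Taken with c = 2, `root-of-unity` gives a square root x^(2k) of 1 that is not 1, hence is -1;
  -- it is the square of x^k.
  sqrt-1 : ∀ {p} → Prime p → ∀ k → p ≡ 1 ℕ.+ 4 ℕ.* k → ∃[ x ] + p ∣ x * x + 1ℤ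
  sqrt-1 {p} pr k p≡ with root-of-unity pr 2 (k ℕ.* 2) (trans p≡ (cong suc (4k k))) (s≤s (s≤s z≤n))
    where
    4k : ∀ k → 4 ℕ.* k ≡ 2 ℕ.* (k ℕ.* 2)
    4k k = trans (ℕ.*-assoc 2 2 k) (cong (2 ℕ.*_) (ℕ.*-comm 2 k))
  ... | x , ¬h , h = y , cancel-root pr (x ^ (k ℕ.* 2)) (y * y + 1ℤ) ¬h (subst (+ p ∣_) eq h)
    where
    y = x ^ k
    y² : x ^ (k ℕ.* 2) ≡ y * (y * 1ℤ)
    y² = sym (^-*-assoc x k 2)
    eq : (x ^ (k ℕ.* 2)) ^ 2 - 1ℤ ≡ (x ^ (k ℕ.* 2) - 1ℤ) * (y * y + 1ℤ)
    eq = trans (cong (λ u → u ^ 2 - 1ℤ) y²) (trans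
      (solve 1 (λ y → (y :* (y :* con 1ℤ)) :* ((y :* (y :* con 1ℤ)) :* con 1ℤ) :- con 1ℤ := (y :* (y :* con 1ℤ) :- con 1ℤ) :* (y :* y :+ con 1ℤ)) refl y)
      (cong (λ u → (u - 1ℤ) * (y * y + 1ℤ)) (sym y²)))

  -- For nonzero `a` the exponent of q would be odd on the left and even on the right. The proof is
  -- by infinite descent from (a, b) to (a/q, b/q), with `bound` as the termination measure. It
  -- serves to separate elliptic points of different discriminants.
  square-ratio : ∀ {q} → Prime q → ∀ {m} → ¬ (q ℕ.∣ m) → ∀ a b → q ℕ.* (a ℕ.* a) ≡ m ℕ.* (b ℕ.* b) → a ≡ 0
  square-ratio {q} pr {m} q∤m a b e = descent a a b ℕ.≤-refl e
    where
    open ℕ-Solver using () renaming (solve to solveℕ; _:*_ to _:*ℕ_; _:=_ to _:=ℕ_)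
    instance _ = prime⇒nonZero pr
    ∣-root : ∀ n → q ℕ.∣ n ℕ.* n → q ℕ.∣ n
    ∣-root n h = Sum.[ (λ h → h) , (λ h → h) ] (euclidsLemma n n pr h)
    1<q : 1 ℕ.< q
    1<q = ℕ.nonTrivial⇒n>1 q {{prime⇒nonTrivial pr}}
    descent : ∀ bound a b → a ℕ.≤ bound → q ℕ.* (a ℕ.* a) ≡ m ℕ.* (b ℕ.* b) → a ≡ 0
    descent bound zero    b _   e = refl
    descent (suc bound) a@(suc _) b a≤ e with euclidsLemma m (b ℕ.* b) pr (subst (q ℕ.∣_) e (ℕ.m∣m*n (a ℕ.* a)))
    ... | inj₁ q∣m = contradiction q∣m q∤m
    ... | inj₂ q∣b² with ∣-root b q∣b²
    ...   | ℕ.divides b₁ refl with ∣-root a (ℕ.divides (m ℕ.* (b₁ ℕ.* b₁)) a²)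
      where
      a² : a ℕ.* a ≡ m ℕ.* (b₁ ℕ.* b₁) ℕ.* q
      a² = ℕ.*-cancelˡ-≡ (a ℕ.* a) (m ℕ.* (b₁ ℕ.* b₁) ℕ.* q) q (trans e
        (solveℕ 3 (λ m b q → m :*ℕ ((b :*ℕ q) :*ℕ (b :*ℕ q)) :=ℕ q :*ℕ (m :*ℕ (b :*ℕ b) :*ℕ q)) refl m b₁ q))
    ...     | ℕ.divides a₁ a≡ = trans a≡ (cong (ℕ._* q) (descent bound a₁ b₁ (smaller a₁ a≡) e₁))
      where
      e₁ : q ℕ.* (a₁ ℕ.* a₁) ≡ m ℕ.* (b₁ ℕ.* b₁)
      e₁ = ℕ.*-cancelˡ-≡ _ _ (q ℕ.* q) {{ℕ.m*n≢0 q q}} (trans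
        (solveℕ 2 (λ a q → q :*ℕ q :*ℕ (q :*ℕ (a :*ℕ a)) :=ℕ q :*ℕ ((a :*ℕ q) :*ℕ (a :*ℕ q))) refl a₁ q)
        (trans (cong (λ u → q ℕ.* (u ℕ.* u)) (sym a≡)) (trans e
        (solveℕ 3 (λ m b q → m :*ℕ ((b :*ℕ q) :*ℕ (b :*ℕ q)) :=ℕ q :*ℕ q :*ℕ (m :*ℕ (b :*ℕ b))) refl m b₁ q))))
      smaller : ∀ x → a ≡ x ℕ.* q → x ℕ.≤ bound
      smaller zero    _  = z≤n
      smaller (suc x) a≡ = ℕ.s≤s⁻¹ (ℕ.≤-trans (subst (suc x ℕ.<_) (sym a≡) (ℕ.m<m*n (suc x) q 1<q)) a≤)

-- Integral binary quadratic forms and Gauss reduction.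

module BinaryForms where

  open import Data.Integer.Base hiding (suc)
  open import Data.Integer.DivMod using (a≡a%ℕn+[a/ℕn]*n; n%ℕd<d)
  open import Data.Integer.Properties
  open import Data.Integer.Solver using (module +-*-Solver)
  open import Data.Nat.Base as ℕ using (ℕ; zero; suc; z≤n; s≤s)
  import Data.Nat.Properties as ℕ
  open import Data.Product.Base using (∃-syntax; _×_; _,_)
  open import Data.Sum.Base as Sum using (inj₁; inj₂)
  open import Relation.Binary.PropositionalEquality
  open import Relation.Binary.Definitions using (tri<; tri≈; tri>)
  open import Relation.Nullary using (yes; no; contradiction)
  open import Defs using (Form; form; A; B; C; value; discriminant; Reduced; PositiveDefinite)
  open +-*-Solver using (Polynomial; solve; con; _:+_; _:*_; _:-_; :-_; _:=_)

  record Matrix : Set where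
    constructor matrix
    field
      α β γ δ : ℤ

  open Matrix public

  det : Matrix → ℤ
  det M = α M * δ M - β M * γ M

  infixl 7 _·_
  _·_ : Matrix → Matrix → Matrix
  matrix α β γ δ · matrix α′ β′ γ′ δ′ =
    matrix (α * α′ + β * γ′) (α * β′ + β * δ′) (γ * α′ + δ * γ′) (γ * β′ + δ * δ′)

  adjugate : Matrix → Matrix
  adjugate (matrix α β γ δ) = matrix δ (- β) (- γ) α

  -- The polar form f(u + v) - f(u) - f(v), taken at the two columns of the matrix.
  polar : Form → Matrix → ℤ
  polar f (matrix α β γ δ) = + 2 * A f * (α * β) + B f * (α * δ + β * γ) + + 2 * C f * (γ * δ)

  infixl 6 _∘ᶠ_
  _∘ᶠ_ : Form → Matrix → Form
  f ∘ᶠ M = form (value f (α M) (γ M)) (polar f M) (value f (β M) (δ M))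

  form-≡ : ∀ {f g} → A f ≡ A g → B f ≡ B g → C f ≡ C g → f ≡ g
  form-≡ {form _ _ _} {form _ _ _} refl refl refl = refl

  valueᴾ : ∀ {n} (A B C x y : Polynomial n) → Polynomial n
  valueᴾ A B C x y = A :* (x :* x) :+ B :* (x :* y) :+ C :* (y :* y)

  polarᴾ : ∀ {n} (A B C α β γ δ : Polynomial n) → Polynomial n
  polarᴾ A B C α β γ δ = con (+ 2) :* A :* (α :* β) :+ B :* (α :* δ :+ β :* γ) :+ con (+ 2) :* C :* (γ :* δ)

  discriminantᴾ : ∀ {n} (A B C : Polynomial n) → Polynomial n
  discriminantᴾ A B C = B :* B :- con (+ 4) :* A :* C

  discriminant-∘ : ∀ f M → discriminant (f ∘ᶠ M) ≡ (det M * det M) * discriminant f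
  discriminant-∘ (form a b c) (matrix α β γ δ) = solve 7 (λ a b c α β γ δ →
    discriminantᴾ (valueᴾ a b c α γ) (polarᴾ a b c α β γ δ) (valueᴾ a b c β δ)
    := ((α :* δ :- β :* γ) :* (α :* δ :- β :* γ)) :* discriminantᴾ a b c) refl a b c α β γ δ

  value-∘ : ∀ f M x y → value (f ∘ᶠ M) x y ≡ value f (α M * x + β M * y) (γ M * x + δ M * y)
  value-∘ (form a b c) (matrix α β γ δ) x y = solve 9 (λ a b c α β γ δ x y →
    valueᴾ (valueᴾ a b c α γ) (polarᴾ a b c α β γ δ) (valueᴾ a b c β δ) x y
    := valueᴾ a b c (α :* x :+ β :* y) (γ :* x :+ δ :* y)) refl a b c α β γ δ x y

  polar-∘ : ∀ f M N → polar (f ∘ᶠ M) N ≡ polar f (M · N)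
  polar-∘ (form a b c) (matrix α β γ δ) (matrix α′ β′ γ′ δ′) = solve 11 (λ a b c α β γ δ α′ β′ γ′ δ′ →
    polarᴾ (valueᴾ a b c α γ) (polarᴾ a b c α β γ δ) (valueᴾ a b c β δ) α′ β′ γ′ δ′
    := polarᴾ a b c (α :* α′ :+ β :* γ′) (α :* β′ :+ β :* δ′) (γ :* α′ :+ δ :* γ′) (γ :* β′ :+ δ :* δ′))
    refl a b c α β γ δ α′ β′ γ′ δ′

  ∘-· : ∀ f M N → f ∘ᶠ M ∘ᶠ N ≡ f ∘ᶠ (M · N)
  ∘-· f M N = form-≡ (value-∘ f M (α N) (γ N)) (polar-∘ f M N) (value-∘ f M (β N) (δ N))

  det-· : ∀ M N → det (M · N) ≡ det M * det N
  det-· (matrix α β γ δ) (matrix α′ β′ γ′ δ′) = solve 8 (λ α β γ δ α′ β′ γ′ δ′ →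
    (α :* α′ :+ β :* γ′) :* (γ :* β′ :+ δ :* δ′) :- (α :* β′ :+ β :* δ′) :* (γ :* α′ :+ δ :* γ′)
    := (α :* δ :- β :* γ) :* (α′ :* δ′ :- β′ :* γ′)) refl α β γ δ α′ β′ γ′ δ′

  det-adjugate : ∀ M → det (adjugate M) ≡ det M
  det-adjugate (matrix α β γ δ) = solve 4 (λ α β γ δ → δ :* α :- (:- β) :* (:- γ) := α :* δ :- β :* γ) refl α β γ δ

  infix 4 _∼_
  record _∼_ (f g : Form) : Set where
    constructor mk∼
    field
      by        : Matrix
      unimodular : det by ≡ 1ℤ
      image     : g ≡ f ∘ᶠ by

  ∼-trans : ∀ {f g h} → f ∼ g → g ∼ h → f ∼ h
  ∼-trans {f} (mk∼ M m refl) (mk∼ N n refl) = mk∼ (M · N) (trans (det-· M N) (cong₂ _*_ m n)) (∘-· f M N)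

  ∘-adjugate : ∀ f M → det M ≡ 1ℤ → f ∘ᶠ M ∘ᶠ adjugate M ≡ f
  ∘-adjugate f@(form a b c) M@(matrix α β γ δ) m = trans (∘-· f M (adjugate M)) (form-≡
    (trans (cong₂ (value f) diag off₁) (solve 3 (λ a b c → valueᴾ a b c (con 1ℤ) (con 0ℤ) := a) refl a b c))
    (trans (polar-≡ diag off₂ off₁ diag′) (solve 3 (λ a b c → polarᴾ a b c (con 1ℤ) (con 0ℤ) (con 0ℤ) (con 1ℤ) := b) refl a b c))
    (trans (cong₂ (value f) off₂ diag′) (solve 3 (λ a b c → valueᴾ a b c (con 0ℤ) (con 1ℤ) := c) refl a b c)))
    where
    polar-≡ : ∀ {α α′ β β′ γ γ′ δ δ′} → α ≡ α′ → β ≡ β′ → γ ≡ γ′ → δ ≡ δ′ → polar f (matrix α β γ δ) ≡ polar f (matrix α′ β′ γ′ δ′)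
    polar-≡ refl refl refl refl = refl
    diag : α * δ + β * (- γ) ≡ 1ℤ
    diag = trans (cong (_+_ (α * δ)) (sym (neg-distribʳ-* β γ))) m
    diag′ : γ * (- β) + δ * α ≡ 1ℤ
    diag′ = trans (solve 4 (λ α β γ δ → γ :* (:- β) :+ δ :* α := α :* δ :- β :* γ) refl α β γ δ) m
    off₁ : γ * δ + δ * (- γ) ≡ 0ℤ
    off₁ = solve 2 (λ γ δ → γ :* δ :+ δ :* (:- γ) := con 0ℤ) refl γ δ
    off₂ : α * (- β) + β * α ≡ 0ℤ
    off₂ = solve 2 (λ α β → α :* (:- β) :+ β :* α := con 0ℤ) refl α β

  ∼-sym : ∀ {f g} → f ∼ g → g ∼ f
  ∼-sym {f} (mk∼ M m e) = mk∼ (adjugate M) (trans (det-adjugate M) m)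
    (sym (trans (cong (_∘ᶠ adjugate M) e) (∘-adjugate f M m)))

  ∼-discriminant : ∀ {f g} → f ∼ g → discriminant g ≡ discriminant f
  ∼-discriminant {f} (mk∼ M m refl) = trans (discriminant-∘ f M) (trans (cong (λ d → (d * d) * discriminant f) m) (*-identityˡ (discriminant f)))

  nonNeg-+ : ∀ {i j} → 0ℤ ≤ i → 0ℤ ≤ j → 0ℤ ≤ i + j
  nonNeg-+ = +-mono-≤

  nonNeg-* : ∀ {i j} → 0ℤ ≤ i → 0ℤ ≤ j → 0ℤ ≤ i * j
  nonNeg-* {i} {j} p q = subst (_≤ i * j) (*-zeroʳ i) (*-monoˡ-≤-nonNeg i {{nonNegative p}} q)

  pos-*-pos : ∀ {i j} → 0ℤ < i → 0ℤ < j → 0ℤ < i * j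
  pos-*-pos {i} {j} p q = subst (_< i * j) (*-zeroʳ i) (*-monoˡ-<-pos i {{positive p}} q)

  pos-cancelˡ : ∀ {i j} → 0ℤ < i → 0ℤ < i * j → 0ℤ < j
  pos-cancelˡ {i} {j} p q = *-cancelˡ-<-nonNeg i {{nonNegative (<⇒≤ p)}} (subst (_< i * j) (sym (*-zeroʳ i)) q)

  square≥0 : ∀ i → 0ℤ ≤ i * i
  square≥0 (+ n)    = subst (0ℤ ≤_) (pos-* n n) (+≤+ z≤n)
  square≥0 -[1+ n ] = +≤+ z≤n

  square-pos : ∀ {i} → i ≢ 0ℤ → 0ℤ < i * i
  square-pos {i} i≢0 = ≤∧≢⇒< (square≥0 i) λ e → i≢0 (Sum.[ (λ e → e) , (λ e → e) ] (i*j≡0⇒i≡0∨j≡0 i (sym e)))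

  pos⇒≥1 : ∀ {i} → 0ℤ < i → 0ℤ ≤ i - 1ℤ
  pos⇒≥1 p = i≤j⇒0≤j-i (i<j⇒suc[i]≤j p)

  ∣i∣²≡i² : ∀ i → + ∣ i ∣ * + ∣ i ∣ ≡ i * i
  ∣i∣²≡i² i with +∣i∣≡i⊎+∣i∣≡-i i
  ... | inj₁ e = cong₂ _*_ e e
  ... | inj₂ e = trans (cong₂ _*_ e e) (solve 1 (λ i → (:- i) :* (:- i) := i :* i) refl i)

  -∣i∣≤i : ∀ i → - (+ ∣ i ∣) ≤ i
  -∣i∣≤i (+ n)    = neg-≤-pos
  -∣i∣≤i -[1+ n ] = ≤-refl

  i≤∣i∣ : ∀ i → i ≤ + ∣ i ∣
  i≤∣i∣ (+ n)    = ≤-refl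
  i≤∣i∣ -[1+ n ] = -≤+

  -- This is the extremal case |B| = A = C of `value≥C`. According to the order of m and n, the
  -- expression is rewritten as a sum of visibly nonnegative terms.
  hexagonal≥1 : ∀ m n → 0ℤ ≤ m → 0ℤ < n → 0ℤ ≤ m * m - m * n + n * n - 1ℤ
  hexagonal≥1 m n m≥0 n>0 with n ≤? m
  ... | yes n≤m = subst (0ℤ ≤_)
    (solve 2 (λ m n → m :* (m :- n) :+ (n :* (n :- con 1ℤ) :+ (n :- con 1ℤ)) := m :* m :- m :* n :+ n :* n :- con 1ℤ) refl m n)
    (nonNeg-+ (nonNeg-* m≥0 (i≤j⇒0≤j-i n≤m)) (nonNeg-+ (nonNeg-* (<⇒≤ n>0) (pos⇒≥1 n>0)) (pos⇒≥1 n>0)))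
  ... | no  n≰m = subst (0ℤ ≤_)
    (solve 2 (λ m n → m :* m :+ (n :* ((n :- m) :- con 1ℤ) :+ (n :- con 1ℤ)) := m :* m :- m :* n :+ n :* n :- con 1ℤ) refl m n)
    (nonNeg-+ (square≥0 m) (nonNeg-+ (nonNeg-* (<⇒≤ n>0) (pos⇒≥1 n-m>0)) (pos⇒≥1 n>0)))
    where
    n-m>0 : 0ℤ < n - m
    n-m>0 = subst (_< n - m) (+-inverseʳ m) (+-monoˡ-< (- m) (≰⇒> n≰m))

  -- With m = |x| and n = |y|, f(x,y) − C is A(m² − mn + n² − 1) + (C − A)(n² − 1) plus two
  -- nonnegative corrections, for |B| ≤ A and for the sign of Bxy.
  value≥C : ∀ {f} → Reduced f → 0ℤ < A f → ∀ x y → y ≢ 0ℤ → C f ≤ value f x y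
  value≥C {form a b c} r a>0 x y y≢0 = 0≤i-j⇒j≤i (subst (0ℤ ≤_) eq
    (nonNeg-+ (nonNeg-+ (nonNeg-+
      (nonNeg-* (<⇒≤ a>0) (hexagonal≥1 m n (+≤+ z≤n) n>0))
      (nonNeg-* (i≤j⇒0≤j-i (Reduced.A≤C r)) (n²≥1)))
      (nonNeg-* (nonNeg-* (i≤j⇒0≤j-i (Reduced.∣B∣≤A r)) (+≤+ z≤n)) (+≤+ z≤n)))
      cross))
    where
    m = + ∣ x ∣
    n = + ∣ y ∣
    n>0 : 0ℤ < n
    n>0 = ≤∧≢⇒< (+≤+ z≤n) λ e → y≢0 (∣i∣≡0⇒i≡0 (+-injective (sym e)))
    n²≥1 : 0ℤ ≤ n * n - 1ℤ
    n²≥1 = pos⇒≥1 (pos-*-pos n>0 n>0)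
    cross : 0ℤ ≤ b * (x * y) + + ∣ b ∣ * m * n
    cross = subst (λ e → 0ℤ ≤ b * (x * y) + e)
      (trans (cong +_ (trans (abs-* b (x * y)) (trans (cong (∣ b ∣ ℕ.*_) (abs-* x y)) (sym (ℕ.*-assoc (∣ b ∣) (∣ x ∣) (∣ y ∣))))))
        (trans (pos-* (∣ b ∣ ℕ.* ∣ x ∣) (∣ y ∣)) (cong (_* n) (pos-* (∣ b ∣) (∣ x ∣)))))
      (subst (_≤ b * (x * y) + + ∣ b * (x * y) ∣) (+-inverseˡ (+ ∣ b * (x * y) ∣))
        (+-monoˡ-≤ (+ ∣ b * (x * y) ∣) (-∣i∣≤i (b * (x * y)))))
    eq : a * (m * m - m * n + n * n - 1ℤ) + (c - a) * (n * n - 1ℤ) + (a - + ∣ b ∣) * m * n + (b * (x * y) + + ∣ b ∣ * m * n)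
         ≡ value (form a b c) x y - c
    eq = trans
      (solve 7 (λ a c k m n z b → a :* (m :* m :- m :* n :+ n :* n :- con 1ℤ) :+ (c :- a) :* (n :* n :- con 1ℤ) :+ (a :- k) :* m :* n :+ (b :* z :+ k :* m :* n)
        := a :* (m :* m) :+ b :* z :+ c :* (n :* n) :- c) refl a c (+ ∣ b ∣) m n (x * y) b)
      (cong₂ (λ u v → a * u + b * (x * y) + c * v - c) (∣i∣²≡i² x) (∣i∣²≡i² y))

  +-injectiveˡ : ∀ k {i j} → k + i ≡ k + j → i ≡ j
  +-injectiveˡ k {i} {j} e = trans (solve 2 (λ k i → i := (k :+ i) :- k) refl k i)
    (trans (cong (_- k) e) (solve 2 (λ k i → (k :+ i) :- k := i) refl k j))

  form-determined : ∀ {f g} → 0ℤ < A f → A f ≡ A g → B f ≡ B g → discriminant f ≡ discriminant g → f ≡ g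
  form-determined {form a b c} {form _ _ c′} a>0 refl refl e = form-≡ refl refl
    (*-cancelˡ-≡ (+ 4 * a) c c′ {{>-nonZero (pos-*-pos {+ 4} {a} (+<+ (s≤s z≤n)) a>0)}} (neg-injective (+-injectiveˡ (b * b) e)))

  -- B = -A would be the boundary case |B| = A, in which a reduced form has B ≥ 0.
  -A<B : ∀ {f} → Reduced f → 0ℤ < A f → - A f < B f
  -A<B {f} r a>0 = ≤∧≢⇒< (≤-trans (neg-mono-≤ (Reduced.∣B∣≤A r)) (-∣i∣≤i (B f))) λ e →
    <-irrefl refl (<-≤-trans (neg-mono-< a>0)
      (subst (0ℤ ≤_) (sym e) (Reduced.boundary r (inj₁ (trans (cong (λ b → + ∣ b ∣) (sym e))
        (trans (cong +_ (∣-i∣≡∣i∣ (A f))) (0≤i⇒+∣i∣≡i (<⇒≤ a>0))))))))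

  B≤A : ∀ {f} → Reduced f → B f ≤ A f
  B≤A {f} r = ≤-trans (i≤∣i∣ (B f)) (Reduced.∣B∣≤A r)

  no-shift : ∀ {a b b′} k → 0ℤ < a → 0ℤ < k → - a < b → b′ ≤ a → b′ ≢ b + + 2 * a * k
  no-shift {a} {b} k a>0 k>0 l u refl = <-irrefl refl (subst (0ℤ <_)
    (solve 3 (λ a b k → a :- (b :+ con (+ 2) :* a :* k) :+ con (+ 2) :* a :* (k :- con 1ℤ) :+ (b :+ a) := con 0ℤ) refl a b k)
    (+-mono-≤-< (nonNeg-+ (i≤j⇒0≤j-i u) (nonNeg-* (nonNeg-* {+ 2} {a} (+≤+ z≤n) (<⇒≤ a>0)) (pos⇒≥1 k>0)))
      (subst (_< b + a) (+-inverseˡ a) (+-monoˡ-< a l))))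

  -- The half-open interval (-a, a] contains exactly one representative of each class modulo 2a.
  residue-unique : ∀ {a b b′} k → 0ℤ < a → - a < b → b ≤ a → - a < b′ → b′ ≤ a → b′ ≡ b + + 2 * a * k → b′ ≡ b
  residue-unique {a} {b} {b′} k a>0 l u l′ u′ e with <-cmp k 0ℤ
  ... | tri≈ _ refl _ = trans e (solve 2 (λ a b → b :+ con (+ 2) :* a :* con 0ℤ := b) refl a b)
  ... | tri> _ _ k>0  = contradiction e (no-shift k a>0 k>0 l u′)
  ... | tri< k<0 _ _  = contradiction
    (trans (solve 3 (λ a b k → b := b :+ con (+ 2) :* a :* k :+ con (+ 2) :* a :* (:- k)) refl a b k) (cong (λ c → c + + 2 * a * (- k)) (sym e)))
    (no-shift (- k) a>0 (neg-mono-< k<0) l′ u)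

  nonNeg-square-injective : ∀ {i j} → 0ℤ ≤ i → 0ℤ ≤ j → i * i ≡ j * j → i ≡ j
  nonNeg-square-injective {i} {j} i≥0 j≥0 e with <-cmp i j
  ... | tri≈ _ i≡j _ = i≡j
  ... | tri< i<j _ _ = contradiction e (<⇒≢ (≤-<-trans (*-monoˡ-≤-nonNeg i {{nonNegative i≥0}} (<⇒≤ i<j)) (*-monoʳ-<-pos j {{positive (≤-<-trans i≥0 i<j)}} i<j)))
  ... | tri> _ _ j<i = contradiction (sym e) (<⇒≢ (≤-<-trans (*-monoˡ-≤-nonNeg j {{nonNegative j≥0}} (<⇒≤ j<i)) (*-monoʳ-<-pos i {{positive (≤-<-trans j≥0 j<i)}} j<i)))

  unit-square : ∀ {i j} → i * j ≡ 1ℤ → i * i ≡ 1ℤ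
  unit-square {i} {j} e = trans (sym (∣i∣²≡i² i)) (cong (λ n → + n * + n)
    (ℕ.m*n≡1⇒m≡1 (∣ i ∣) (∣ j ∣) (trans (sym (abs-* i j)) (cong ∣_∣ e))))

  -- Let M carry f to g. If the lower left entry of M is nonzero then A g ≥ C f and, by the
  -- inverse of M, A f ≥ C g, so that all four coefficients agree; otherwise M is a translation.
  reduced-unique : ∀ {f g} → 0ℤ < A f → 0ℤ < A g → Reduced f → Reduced g → f ∼ g → f ≡ g
  reduced-unique {f@(form a b c)} {g} f>0 g>0 rf rg f∼g@(mk∼ M@(matrix α β γ δ) m g≡) with γ ≟ 0ℤ
  ... | yes refl = form-determined f>0 a≡ b≡ (sym (∼-discriminant f∼g))
    where
    αδ≡1 : α * δ ≡ 1ℤ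
    αδ≡1 = trans (solve 3 (λ α β δ → α :* δ := α :* δ :- β :* con 0ℤ) refl α β δ) m
    a≡ : a ≡ A g
    a≡ = sym (trans (cong A g≡) (trans (solve 4 (λ a b c α → valueᴾ a b c α (con 0ℤ) := a :* (α :* α)) refl a b c α)
      (trans (cong (a *_) (unit-square {α} {δ} αδ≡1)) (*-identityʳ a))))
    b≡ : b ≡ B g
    b≡ = sym (residue-unique (α * β) f>0 (-A<B rf f>0) (B≤A rf)
      (subst (λ a → - a < B g) (sym a≡) (-A<B rg g>0)) (subst (B g ≤_) (sym a≡) (B≤A rg))
      (trans (cong B g≡) (trans
        (solve 6 (λ a b c α β δ → polarᴾ a b c α β (con 0ℤ) δ := b :* (α :* δ) :+ con (+ 2) :* a :* (α :* β)) refl a b c α β δ)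
        (cong (_+ + 2 * a * (α * β)) (trans (cong (b *_) αδ≡1) (*-identityʳ b))))))
  ... | no γ≢0 = form-determined f>0 a≡ b≡ (sym (∼-discriminant f∼g))
    where
    c≤A′ : c ≤ A g
    c≤A′ = subst (c ≤_) (sym (cong A g≡)) (value≥C rf f>0 α γ γ≢0)
    C′≤a : C g ≤ a
    C′≤a = subst (C g ≤_) (sym (cong A (_∼_.image (∼-sym f∼g)))) (value≥C rg g>0 δ (- γ) λ e → γ≢0 (neg-injective e))
    a≡ : a ≡ A g
    a≡ = ≤-antisym (≤-trans (Reduced.A≤C rf) c≤A′) (≤-trans (Reduced.A≤C rg) C′≤a)
    a≡c : a ≡ c
    a≡c = ≤-antisym (Reduced.A≤C rf) (≤-trans c≤A′ (≤-reflexive (sym a≡)))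
    A′≡C′ : A g ≡ C g
    A′≡C′ = ≤-antisym (Reduced.A≤C rg) (≤-trans C′≤a (≤-reflexive a≡))
    -- As A = C on both sides, the boundary condition makes both middle coefficients nonnegative,
    -- and the equal discriminants make their squares equal.
    b≡ : b ≡ B g
    b≡ = nonNeg-square-injective (Reduced.boundary rf (inj₂ a≡c)) (Reduced.boundary rg (inj₂ A′≡C′))
      (+-injectiveˡ (- (+ 4 * a * c)) (trans (+-comm (- (+ 4 * a * c)) (b * b)) (trans (sym (∼-discriminant f∼g))
        (trans (+-comm (B g * B g) (- (+ 4 * A g * C g))) (cong₂ (λ u v → - (+ 4 * u * v) + B g * B g) (sym a≡) (trans (sym A′≡C′) (trans (sym a≡) a≡c)))))))

  value-1-0 : ∀ f → value f 1ℤ 0ℤ ≡ A f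
  value-1-0 (form a b c) = solve 3 (λ a b c → valueᴾ a b c (con 1ℤ) (con 0ℤ) := a) refl a b c

  positiveDefinite⇒A>0 : ∀ {f} → PositiveDefinite f → 0ℤ < A f
  positiveDefinite⇒A>0 {f} pd = subst (0ℤ <_) (value-1-0 f) (pd 1ℤ 0ℤ λ ())

  -- Completing the square gives 4A f(x,y) = (2Ax + By)² - D y².
  positiveDefinite : ∀ {f} → 0ℤ < A f → discriminant f < 0ℤ → PositiveDefinite f
  positiveDefinite {f@(form a b c)} a>0 d<0 x y ¬0 =
    pos-cancelˡ {+ 4 * a} (pos-*-pos {+ 4} {a} (+<+ (s≤s z≤n)) a>0) (subst (0ℤ <_) eq positive-sum)
    where
    l = + 2 * a * x + b * y
    D = discriminant f
    eq : l * l + (- D) * (y * y) ≡ + 4 * a * value f x y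
    eq = solve 5 (λ a b c x y → (con (+ 2) :* a :* x :+ b :* y) :* (con (+ 2) :* a :* x :+ b :* y) :+ (:- discriminantᴾ a b c) :* (y :* y)
      := con (+ 4) :* a :* valueᴾ a b c x y) refl a b c x y
    positive-sum : 0ℤ < l * l + (- D) * (y * y)
    positive-sum with y ≟ 0ℤ
    ... | no y≢0   = +-mono-≤-< (square≥0 l) (pos-*-pos (neg-mono-< d<0) (square-pos y≢0))
    ... | yes refl = +-mono-<-≤ (square-pos l≢0) (≤-reflexive (sym (*-zeroʳ (- D))))
      where
      l≢0 : + 2 * a * x + b * 0ℤ ≢ 0ℤ
      l≢0 e = Sum.[ (λ 2a≡0 → <⇒≢ (pos-*-pos {+ 2} {a} (+<+ (s≤s z≤n)) a>0) (sym 2a≡0)) , (λ x≡0 → ¬0 (x≡0 , refl)) ]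
        (i*j≡0⇒i≡0∨j≡0 (+ 2 * a) (trans (sym (trans (cong (_+_ (+ 2 * a * x)) (*-zeroʳ b)) (+-identityʳ (+ 2 * a * x)))) e))

  C>0 : ∀ {f} → 0ℤ < A f → discriminant f < 0ℤ → 0ℤ < C f
  C>0 {f@(form a b c)} a>0 d<0 = pos-cancelˡ {+ 4 * a} (pos-*-pos {+ 4} {a} (+<+ (s≤s z≤n)) a>0)
    (subst (0ℤ <_) (solve 3 (λ a b c → b :* b :+ (:- discriminantᴾ a b c) := con (+ 4) :* a :* c) refl a b c)
      (+-mono-≤-< (square≥0 b) (neg-mono-< d<0)))

  translation : ℤ → Matrix
  translation k = matrix 1ℤ k 0ℤ 1ℤ

  inversion : Matrix
  inversion = matrix 0ℤ -1ℤ 1ℤ 0ℤ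

  ∘-translation : ∀ f k → f ∘ᶠ translation k ≡ form (A f) (B f + + 2 * A f * k) (value f k 1ℤ)
  ∘-translation (form a b c) k = form-≡
    (value-1-0 (form a b c))
    (solve 4 (λ a b c k → polarᴾ a b c (con 1ℤ) k (con 0ℤ) (con 1ℤ) := b :+ con (+ 2) :* a :* k) refl a b c k)
    refl

  ∘-inversion : ∀ f → f ∘ᶠ inversion ≡ form (C f) (- B f) (A f)
  ∘-inversion (form a b c) = form-≡
    (solve 3 (λ a b c → valueᴾ a b c (con 0ℤ) (con 1ℤ) := c) refl a b c)
    (solve 3 (λ a b c → polarᴾ a b c (con 0ℤ) (con -1ℤ) (con 1ℤ) (con 0ℤ) := :- b) refl a b c)
    (solve 3 (λ a b c → valueᴾ a b c (con -1ℤ) (con 0ℤ) := a) refl a b c)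

  ∼-translation : ∀ f k → f ∼ form (A f) (B f + + 2 * A f * k) (value f k 1ℤ)
  ∼-translation f k = mk∼ (translation k) (cong (λ e → 1ℤ + - e) (*-zeroʳ k)) (sym (∘-translation f k))

  ∼-inversion : ∀ f → f ∼ form (C f) (- B f) (A f)
  ∼-inversion f = mk∼ inversion refl (sym (∘-inversion f))

  -- Division is applied to a - b instead of b: with remainder r modulo 2a the new middle
  -- coefficient is a - r, where 0 ≤ r < 2a, and the interval (-a, a] is closed at the right end.
  normalise : ∀ f → 0ℤ < A f → ∃[ g ] f ∼ g × A g ≡ A f × - A f < B g × B g ≤ A f
  normalise f@(form a@(+[1+ n ]) b c) _ = _ , ∼-translation f q , refl ,
    subst (- a <_) (sym b≡) (subst (_< a - + r) (solve 1 (λ a → a :- con (+ 2) :* a := :- a) refl a)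
      (+-monoʳ-< a (neg-mono-< (subst (+ r <_) (pos-* 2 (suc n)) (+<+ (n%ℕd<d (a - b) d)))))) ,
    subst (_≤ a) (sym b≡) (i-j≤i a (+ r))
    where
    d = 2 ℕ.* suc n
    r = (a - b) %ℕ d
    q = (a - b) /ℕ d
    b≡ : b + + 2 * a * q ≡ a - + r
    b≡ = begin
      b + + 2 * a * q                ≡⟨ cong (λ e → b + e * q) (sym (pos-* 2 (suc n))) ⟩
      b + + d * q                    ≡⟨ solve 4 (λ b d q r → b :+ d :* q := (b :+ (r :+ q :* d)) :- r) refl b (+ d) q (+ r) ⟩
      b + (+ r + q * + d) - + r      ≡⟨ cong (λ e → b + e - + r) (sym (a≡a%ℕn+[a/ℕn]*n (a - b) d)) ⟩
      b + (a - b) - + r              ≡⟨ solve 3 (λ a b r → b :+ (a :- b) :- r := a :- r) refl a b (+ r) ⟩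
      a - + r                        ∎
      where open ≡-Reasoning
  normalise (form (+ 0) _ _) (+<+ ())

  ∣B∣≤ : ∀ {a b} → - a < b → b ≤ a → + ∣ b ∣ ≤ a
  ∣B∣≤ {a} {b} l u with +∣i∣≡i⊎+∣i∣≡-i b
  ... | inj₁ e = subst (_≤ a) (sym e) u
  ... | inj₂ e = subst₂ _≤_ (sym e) (neg-involutive a) (neg-mono-≤ (<⇒≤ l))

  ∣B∣≡A⇒B≥0 : ∀ {a b} → - a < b → + ∣ b ∣ ≡ a → 0ℤ ≤ b
  ∣B∣≡A⇒B≥0 {a} {b} l e with +∣i∣≡i⊎+∣i∣≡-i b
  ... | inj₁ e′ = subst (0ℤ ≤_) e′ (+≤+ z≤n)
  ... | inj₂ e′ = contradiction l (<-irrefl (trans (cong -_ (trans (sym e) e′)) (neg-involutive b)))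

  -- Once B is normalised, C < A calls for an inversion, which strictly lowers the leading
  -- coefficient; the recursion runs on a bound for it. If A = C, one inversion at most is left, to
  -- make B nonnegative.
  reduce : ∀ f → 0ℤ < A f → discriminant f < 0ℤ → ∃[ g ] f ∼ g × Reduced g
  reduce f f>0 d<0 = go (∣ A f ∣) f (≤-reflexive (sym (0≤i⇒+∣i∣≡i (<⇒≤ f>0)))) f>0 d<0
    where
    go : ∀ n f → A f ≤ + n → 0ℤ < A f → discriminant f < 0ℤ → ∃[ g ] f ∼ g × Reduced g
    go zero    f A≤0 f>0 _ = contradiction A≤0 (<⇒≱ f>0)
    go (suc n) f A≤n f>0 d<0 with normalise f f>0
    ... | g@(form a b c) , f∼g , refl , l , u with <-cmp a c
    ...   | tri< a<c _ _ = g , f∼g , record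
      { ∣B∣≤A = ∣B∣≤ l u ; A≤C = <⇒≤ a<c
      ; boundary = Sum.[ ∣B∣≡A⇒B≥0 l , (λ e → contradiction e (<⇒≢ a<c)) ] }
    ...   | tri> _ _ c<a =
      let h , s , r = go n (form c (- b) a) c≤n (C>0 {g} f>0 d′<0) (subst (_< 0ℤ) (sym (∼-discriminant g∼)) d′<0)
      in h , ∼-trans f∼g (∼-trans g∼ s) , r
      where
      g∼ = ∼-inversion g
      d′<0 = subst (_< 0ℤ) (sym (∼-discriminant f∼g)) d<0
      c≤n : c ≤ + n
      c≤n = i<j⇒i≤pred[j] (<-≤-trans c<a A≤n)
    ...   | tri≈ _ refl _ with 0ℤ ≤? b
    ...     | yes b≥0 = g , f∼g , record { ∣B∣≤A = ∣B∣≤ l u ; A≤C = ≤-refl ; boundary = λ _ → b≥0 }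
    ...     | no  b≱0 = form a (- b) a , ∼-trans f∼g (∼-inversion g) , record
      { ∣B∣≤A = subst (λ n → + n ≤ a) (sym (∣-i∣≡∣i∣ b)) (∣B∣≤ l u) ; A≤C = ≤-refl
      ; boundary = λ _ → neg-mono-≤ (<⇒≤ (≰⇒> b≱0)) }

-- Passing between real and integral equations.

module RealArithmetic where

  open import Data.Integer.Base as ℤ using (ℤ; +_)
  import Data.Integer.Properties as ℤ
  open import Data.Nat.Base as ℕ using (ℕ; z≤n; s≤s)
  import Data.Nat.Properties as ℕ
  open import Data.Product.Base using (_,_)
  open import Data.Rational.Base as ℚ using (0ℚ; ½)
  import Data.Rational.Properties as ℚ
  open import Defs
  open import Relation.Binary.Definitions using (tri<; tri≈; tri>)
  open import Relation.Binary.PropositionalEquality as ≡ using (_≡_; subst)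
  import Relation.Binary.Reasoning.Setoid as SetoidReasoning
  open import Relation.Nullary using (¬_; contradiction)
  private
    module R = ℝ-Solver
  open SetoidReasoning ℝ-setoid

  ½<1 : ½ ℚ.< (+ 1 ℚ./ 1)
  ½<1 = ℚ.*<* (ℤ.+<+ (s≤s (s≤s z≤n)))

  fromℤ-pos : ∀ {i} → + 0 ℤ.< i → 0ᴿ < fromℤ i
  fromℤ-pos {i} i>0 = mk< (½ , ℚ.positive⁻¹ ½ , 0 , λ _ _ →
    ℚ.<-≤-trans (subst (ℚ._< + 1 ℚ./ 1) (≡.sym (ℚ.+-identityˡ ½)) ½<1) (/1-mono-≤ (ℤ.i<j⇒suc[i]≤j i>0)))

  0≮0 : ¬ 0ᴿ < 0ᴿ
  0≮0 (mk< (ε , ε>0 , k , q)) = ℚ.<-asym ε>0 (subst (ℚ._< 0ℚ) (ℚ.+-identityˡ ε) (q k ℕ.≤-refl))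

  <-irrefl : ∀ {x} → 0ᴿ < x → ¬ x ≈ 0ᴿ
  <-irrefl p e = 0≮0 (<-respʳ-≈ e p)

  +-pos : ∀ {x y} → 0ᴿ < x → 0ᴿ < y → 0ᴿ < x + y
  +-pos {x} {y} (mk< (ε , ε>0 , k , p)) (mk< (δ , δ>0 , l , q)) = mk< (ε , ε>0 , k ℕ.⊔ l , λ n a →
    subst (ℚ._< seq x n ℚ.+ seq y n) (ℚ.+-identityʳ (0ℚ ℚ.+ ε))
      (ℚ.+-mono-< (p n (≤⊔₁ l a)) (ℚ.<-trans δ>0 (subst (ℚ._< seq y n) (ℚ.+-identityˡ δ) (q n (≤⊔₂ k a))))))

  x-y≈0 : ∀ {x y} → x ≈ y → y - x ≈ 0ᴿ
  x-y≈0 {x} {y} e = ≈-trans (+-cong (≈-refl {y}) (-‿cong e)) (R.solve 1 (λ y → y R.:- y R.:= R.con (+ 0)) ≈-refl y)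

  fromℤ-- : ∀ i j → fromℤ (i ℤ.- j) ≈ fromℤ i - fromℤ j
  fromℤ-- i j = ≈-trans (fromℤ-+ i (ℤ.- j)) (+-cong (≈-refl {fromℤ i}) (fromℤ-neg j))

  -- Trichotomy is applied on the integers; a strict inequality there becomes a positive real
  -- difference, which cannot be 0.
  fromℤ-injective : ∀ {i j} → fromℤ i ≈ fromℤ j → i ≡ j
  fromℤ-injective {i} {j} e with ℤ.<-cmp i j
  ... | tri≈ _ i≡j _ = i≡j
  ... | tri< i<j _ _ = contradiction (≈-trans (fromℤ-- j i) (x-y≈0 e))
    (<-irrefl (fromℤ-pos (subst (ℤ._< j ℤ.- i) (ℤ.+-inverseʳ i) (ℤ.+-monoˡ-< (ℤ.- i) i<j))))
  ... | tri> _ _ j<i = contradiction (≈-trans (fromℤ-- i j) (x-y≈0 (≈-sym e)))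
    (<-irrefl (fromℤ-pos (subst (ℤ._< i ℤ.- j) (ℤ.+-inverseʳ j) (ℤ.+-monoˡ-< (ℤ.- j) j<i))))

  *-cancelˡ : ∀ {x y z} → 0ᴿ < x → x * y ≈ x * z → y ≈ z
  *-cancelˡ {x} {y} {z} x>0 e = begin
    y              ≈⟨ *-identityˡ y ⟨
    1ᴿ * y         ≈⟨ *-cong (inv-inverse x x>0) ≈-refl ⟨
    (i * x) * y    ≈⟨ *-assoc i x y ⟩
    i * (x * y)    ≈⟨ *-cong (≈-refl {i}) e ⟩
    i * (x * z)    ≈⟨ *-assoc i x z ⟨
    (i * x) * z    ≈⟨ *-cong (inv-inverse x x>0) ≈-refl ⟩
    1ᴿ * z         ≈⟨ *-identityˡ z ⟩
    z              ∎
    where i = inv x x>0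

  *-cancel-0 : ∀ {x y} → 0ᴿ < x → x * y ≈ 0ᴿ → y ≈ 0ᴿ
  *-cancel-0 {x} {y} x>0 e = *-cancelˡ x>0 (≈-trans e (R.solve 1 (λ x → R.con (+ 0) R.:= x R.:* R.con (+ 0)) ≈-refl x))

  -- In (x + y)(x - y) = 0 the factor x + y is positive and can be cancelled, so the sign of x - y
  -- need not be decided.
  square-injective : ∀ {x y} → 0ᴿ < x → 0ᴿ < y → x * x ≈ y * y → x ≈ y
  square-injective {x} {y} x>0 y>0 e = begin
    x             ≈⟨ R.solve 2 (λ x y → x R.:= (x R.:- y) R.:+ y) ≈-refl x y ⟩
    (x - y) + y   ≈⟨ +-cong (*-cancel-0 (+-pos x>0 y>0) (begin
      (x + y) * (x - y)   ≈⟨ R.solve 2 (λ x y → (x R.:+ y) R.:* (x R.:- y) R.:= x R.:* x R.:- y R.:* y) ≈-refl x y ⟩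
      x * x - y * y       ≈⟨ x-y≈0 (≈-sym e) ⟩
      0ᴿ                  ∎)) ≈-refl ⟩
    0ᴿ + y        ≈⟨ +-identityˡ y ⟩
    y             ∎

  -- For i < 0 the real number -i + x² would be both positive and zero. This is what bounds the
  -- traces of elliptic elements.
  square-nonNegative : ∀ {i x} → x * x ≈ fromℤ i → + 0 ℤ.≤ i
  square-nonNegative {i} {x} e = ℤ.≮⇒≥ λ i<0 → <-irrefl (+-square-pos x (fromℤ-pos (ℤ.neg-mono-< i<0))) (begin
    fromℤ (ℤ.- i) + x * x     ≈⟨ +-cong (fromℤ-neg i) e ⟩
    - fromℤ i + fromℤ i       ≈⟨ +-inverseˡ (fromℤ i) ⟩
    0ᴿ                        ∎)

  √-pos : ∀ {N} → 0 ℕ.< N → 0ᴿ < √ N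
  √-pos {N} N>0 = cancel-pos (√ N) (√ N)
    (<-respʳ-≈ (≈-sym (√-square N)) (fromℤ-pos (ℤ.+<+ N>0))) (root-nonNeg N)

-- Roots of forms under linear fractional transformations.

module FormRoots where

  open import Data.Integer.Base as ℤ using (ℤ; +_)
  import Data.Integer.Properties as ℤ
  open import Defs hiding (a; b; c; d; det)
  open import Relation.Binary.Bundles using (Setoid)
  open import Relation.Binary.PropositionalEquality using (refl)
  import Relation.Binary.Reasoning.Setoid as SetoidReasoning
  open BinaryForms
  private
    module C = ℂ-Solver

  open Setoid ℂ-setoid using () renaming (refl to ≈ᶜ-refl; trans to ≈ᶜ-trans)

  ι : ℤ → ℂ
  ι i = fromℝ (fromℤ i)

  ι-+ : ∀ i j → ι (i ℤ.+ j) ≈ᶜ ι i +ᶜ ι j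
  ι-+ i j = ≈ᶜ-trans (fromℝ-cong (fromℤ-+ i j)) (fromℝ-+ (fromℤ i) (fromℤ j))

  ι-* : ∀ i j → ι (i ℤ.* j) ≈ᶜ ι i *ᶜ ι j
  ι-* i j = ≈ᶜ-trans (fromℝ-cong (fromℤ-* i j)) (fromℝ-* (fromℤ i) (fromℤ j))

  ι-neg : ∀ i → ι (ℤ.- i) ≈ᶜ -ᶜ ι i
  ι-neg i = ≈ᶜ-trans (fromℝ-cong (fromℤ-neg i)) (fromℝ-neg (fromℤ i))

  quadratic : ℂ → ℂ → ℂ → ℂ → ℂ
  quadratic a b c w = a *ᶜ (w *ᶜ w) +ᶜ b *ᶜ w +ᶜ c

  quadratic-cong : ∀ {a a′ b b′ c c′} w → a ≈ᶜ a′ → b ≈ᶜ b′ → c ≈ᶜ c′ → quadratic a b c w ≈ᶜ quadratic a′ b′ c′ w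
  quadratic-cong w p q r = +ᶜ-cong (+ᶜ-cong (*ᶜ-cong p (≈ᶜ-refl {w *ᶜ w})) (*ᶜ-cong q (≈ᶜ-refl {w}))) r

  record Root (f : Form) (w : ℂ) : Set where
    constructor mkRoot
    field equation : quadratic (ι (A f)) (ι (B f)) (ι (C f)) w ≈ᶜ 0ᶜ

  open Root public

  -- w′ is the image of w under the linear fractional transformation of M, with the denominator cleared.
  record Moebius (M : Matrix) (w w′ : ℂ) : Set where
    constructor mkMoebius
    field image : w′ *ᶜ (ι (γ M) *ᶜ w +ᶜ ι (δ M)) ≈ᶜ ι (α M) *ᶜ w +ᶜ ι (β M)

  ι-value : ∀ f x y → ι (value f x y) ≈ᶜ
    ι (A f) *ᶜ (ι x *ᶜ ι x) +ᶜ ι (B f) *ᶜ (ι x *ᶜ ι y) +ᶜ ι (C f) *ᶜ (ι y *ᶜ ι y)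
  ι-value f x y = ≈ᶜ-trans (ι-+ _ (C f ℤ.* (y ℤ.* y))) (+ᶜ-cong (≈ᶜ-trans (ι-+ (A f ℤ.* (x ℤ.* x)) (B f ℤ.* (x ℤ.* y)))
    (+ᶜ-cong (term (A f) x x) (term (B f) x y))) (term (C f) y y))
    where
    term : ∀ a x y → ι (a ℤ.* (x ℤ.* y)) ≈ᶜ ι a *ᶜ (ι x *ᶜ ι y)
    term a x y = ≈ᶜ-trans (ι-* a (x ℤ.* y)) (*ᶜ-cong (≈ᶜ-refl {ι a}) (ι-* x y))

  ι-polar : ∀ f M → ι (polar f M) ≈ᶜ
    ι (+ 2) *ᶜ ι (A f) *ᶜ (ι (α M) *ᶜ ι (β M)) +ᶜ ι (B f) *ᶜ (ι (α M) *ᶜ ι (δ M) +ᶜ ι (β M) *ᶜ ι (γ M))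
    +ᶜ ι (+ 2) *ᶜ ι (C f) *ᶜ (ι (γ M) *ᶜ ι (δ M))
  ι-polar f (matrix α β γ δ) = ≈ᶜ-trans (ι-+ _ (+ 2 ℤ.* C f ℤ.* (γ ℤ.* δ))) (+ᶜ-cong
    (≈ᶜ-trans (ι-+ (+ 2 ℤ.* A f ℤ.* (α ℤ.* β)) (B f ℤ.* (α ℤ.* δ ℤ.+ β ℤ.* γ))) (+ᶜ-cong (term (A f) α β)
      (≈ᶜ-trans (ι-* (B f) (α ℤ.* δ ℤ.+ β ℤ.* γ)) (*ᶜ-cong (≈ᶜ-refl {ι (B f)})
        (≈ᶜ-trans (ι-+ (α ℤ.* δ) (β ℤ.* γ)) (+ᶜ-cong (ι-* α δ) (ι-* β γ)))))))
    (term (C f) γ δ))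
    where
    term : ∀ a x y → ι (+ 2 ℤ.* a ℤ.* (x ℤ.* y)) ≈ᶜ ι (+ 2) *ᶜ ι a *ᶜ (ι x *ᶜ ι y)
    term a x y = ≈ᶜ-trans (ι-* (+ 2 ℤ.* a) (x ℤ.* y)) (*ᶜ-cong (ι-* (+ 2) a) (ι-* x y))

  -- With m = γw + δ one has (f ∘ M)(w, 1) = m² f(w′, 1). The determinant of M is arbitrary, so the
  -- matrices of determinant p coming from R⁻ are covered.
  root-pullback : ∀ {f M w w′} → Moebius M w w′ → Root f w′ → Root (f ∘ᶠ M) w
  root-pullback {f} {M} {w} {w′} (mkMoebius e) (mkRoot r) = mkRoot (begin
    quadratic (ι (value f (α M) (γ M))) (ι (polar f M)) (ι (value f (β M) (δ M))) w
      ≈⟨ quadratic-cong w (ι-value f (α M) (γ M)) (ι-polar f M) (ι-value f (β M) (δ M)) ⟩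
    quadratic
      (a *ᶜ (α′ *ᶜ α′) +ᶜ b *ᶜ (α′ *ᶜ γ′) +ᶜ c *ᶜ (γ′ *ᶜ γ′))
      (ι (+ 2) *ᶜ a *ᶜ (α′ *ᶜ β′) +ᶜ b *ᶜ (α′ *ᶜ δ′ +ᶜ β′ *ᶜ γ′) +ᶜ ι (+ 2) *ᶜ c *ᶜ (γ′ *ᶜ δ′))
      (a *ᶜ (β′ *ᶜ β′) +ᶜ b *ᶜ (β′ *ᶜ δ′) +ᶜ c *ᶜ (δ′ *ᶜ δ′)) w
      ≈⟨ C.solve 8 (λ a b c α β γ δ w →
           (a C.:* (α C.:* α) C.:+ b C.:* (α C.:* γ) C.:+ c C.:* (γ C.:* γ)) C.:* (w C.:* w)
           C.:+ (C.con (+ 2) C.:* a C.:* (α C.:* β) C.:+ b C.:* (α C.:* δ C.:+ β C.:* γ) C.:+ C.con (+ 2) C.:* c C.:* (γ C.:* δ)) C.:* w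
           C.:+ (a C.:* (β C.:* β) C.:+ b C.:* (β C.:* δ) C.:+ c C.:* (δ C.:* δ))
           C.:= a C.:* ((α C.:* w C.:+ β) C.:* (α C.:* w C.:+ β))
                C.:+ b C.:* ((α C.:* w C.:+ β) C.:* (γ C.:* w C.:+ δ))
                C.:+ c C.:* ((γ C.:* w C.:+ δ) C.:* (γ C.:* w C.:+ δ)))
           ≈ᶜ-refl a b c α′ β′ γ′ δ′ w ⟩
    a *ᶜ (n *ᶜ n) +ᶜ b *ᶜ (n *ᶜ m) +ᶜ c *ᶜ (m *ᶜ m)
      ≈⟨ +ᶜ-cong (+ᶜ-cong (*ᶜ-cong (≈ᶜ-refl {a}) (*ᶜ-cong e e)) (*ᶜ-cong (≈ᶜ-refl {b}) (*ᶜ-cong e (≈ᶜ-refl {m})))) (≈ᶜ-refl {c *ᶜ (m *ᶜ m)}) ⟨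
    a *ᶜ ((w′ *ᶜ m) *ᶜ (w′ *ᶜ m)) +ᶜ b *ᶜ ((w′ *ᶜ m) *ᶜ m) +ᶜ c *ᶜ (m *ᶜ m)
      ≈⟨ C.solve 5 (λ a b c m w → a C.:* ((w C.:* m) C.:* (w C.:* m)) C.:+ b C.:* ((w C.:* m) C.:* m) C.:+ c C.:* (m C.:* m)
           C.:= (a C.:* (w C.:* w) C.:+ b C.:* w C.:+ c) C.:* (m C.:* m)) ≈ᶜ-refl a b c m w′ ⟩
    quadratic a b c w′ *ᶜ (m *ᶜ m)
      ≈⟨ *ᶜ-cong r (≈ᶜ-refl {m *ᶜ m}) ⟩
    0ᶜ *ᶜ (m *ᶜ m)
      ≈⟨ C.solve 1 (λ m → C.con (+ 0) C.:* m C.:= C.con (+ 0)) ≈ᶜ-refl (m *ᶜ m) ⟩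
    0ᶜ ∎)
    where
    open SetoidReasoning ℂ-setoid
    a = ι (A f)
    b = ι (B f)
    c = ι (C f)
    α′ = ι (α M)
    β′ = ι (β M)
    γ′ = ι (γ M)
    δ′ = ι (δ M)
    n = α′ *ᶜ w +ᶜ β′
    m = γ′ *ᶜ w +ᶜ δ′

  -- The fixed point equation w(γw + δ) = αw + β, collected on one side.
  fixedForm : Matrix → Form
  fixedForm M = form (γ M) (δ M ℤ.- α M) (ℤ.- β M)

  moebius-fixed : ∀ {M w} → Moebius M w w → Root (fixedForm M) w
  moebius-fixed {M} {w} (mkMoebius e) = mkRoot (begin
    quadratic (ι (γ M)) (ι (δ M ℤ.- α M)) (ι (ℤ.- β M)) w
      ≈⟨ quadratic-cong w (≈ᶜ-refl {ι (γ M)}) (≈ᶜ-trans (ι-+ (δ M) (ℤ.- α M)) (+ᶜ-cong (≈ᶜ-refl {ι (δ M)}) (ι-neg (α M)))) (ι-neg (β M)) ⟩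
    quadratic γ′ (δ′ +ᶜ -ᶜ α′) (-ᶜ β′) w
      ≈⟨ C.solve 5 (λ α β γ δ w → γ C.:* (w C.:* w) C.:+ (δ C.:- α) C.:* w C.:+ C.:- β C.:= w C.:* (γ C.:* w C.:+ δ) C.:- (α C.:* w C.:+ β)) ≈ᶜ-refl α′ β′ γ′ δ′ w ⟩
    w *ᶜ (γ′ *ᶜ w +ᶜ δ′) +ᶜ -ᶜ (α′ *ᶜ w +ᶜ β′)
      ≈⟨ +ᶜ-cong e (≈ᶜ-refl { -ᶜ (α′ *ᶜ w +ᶜ β′)}) ⟩
    (α′ *ᶜ w +ᶜ β′) +ᶜ -ᶜ (α′ *ᶜ w +ᶜ β′)
      ≈⟨ C.solve 1 (λ u → u C.:- u C.:= C.con (+ 0)) ≈ᶜ-refl (α′ *ᶜ w +ᶜ β′) ⟩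
    0ᶜ ∎)
    where
    open SetoidReasoning ℂ-setoid
    α′ = ι (α M)
    β′ = ι (β M)
    γ′ = ι (γ M)
    δ′ = ι (δ M)

  fixed-moebius : ∀ {M w} → Root (fixedForm M) w → Moebius M w w
  fixed-moebius {M} {w} (mkRoot r) = mkMoebius (begin
    w *ᶜ (γ′ *ᶜ w +ᶜ δ′)
      ≈⟨ C.solve 5 (λ α β γ δ w → w C.:* (γ C.:* w C.:+ δ) C.:= (γ C.:* (w C.:* w) C.:+ (δ C.:- α) C.:* w C.:+ C.:- β) C.:+ (α C.:* w C.:+ β)) ≈ᶜ-refl α′ β′ γ′ δ′ w ⟩
    quadratic γ′ (δ′ +ᶜ -ᶜ α′) (-ᶜ β′) w +ᶜ (α′ *ᶜ w +ᶜ β′)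
      ≈⟨ +ᶜ-cong (quadratic-cong w (≈ᶜ-refl {ι (γ M)}) (≈ᶜ-trans (ι-+ (δ M) (ℤ.- α M)) (+ᶜ-cong (≈ᶜ-refl {ι (δ M)}) (ι-neg (α M)))) (ι-neg (β M))) (≈ᶜ-refl {α′ *ᶜ w +ᶜ β′}) ⟨
    quadratic (ι (γ M)) (ι (δ M ℤ.- α M)) (ι (ℤ.- β M)) w +ᶜ (α′ *ᶜ w +ᶜ β′)
      ≈⟨ +ᶜ-cong r (≈ᶜ-refl {α′ *ᶜ w +ᶜ β′}) ⟩
    0ᶜ +ᶜ (α′ *ᶜ w +ᶜ β′)
      ≈⟨ +ᶜ-identityˡ (α′ *ᶜ w +ᶜ β′) ⟩
    α′ *ᶜ w +ᶜ β′ ∎)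
    where
    open SetoidReasoning ℂ-setoid
    α′ = ι (α M)
    β′ = ι (β M)
    γ′ = ι (γ M)
    δ′ = ι (δ M)

-- The quadratic formula in real coordinates.

module RootCoordinates where

  open import Data.Integer.Base as ℤ using (ℤ; +_; 0ℤ)
  import Data.Integer.Properties as ℤ
  open import Data.Nat.Base using (z≤n; s≤s)
  open import Defs hiding (a; b; c; d; det)
  open import Relation.Binary.PropositionalEquality using (_≡_; refl; cong)
  import Relation.Binary.Reasoning.Setoid as SetoidReasoning
  open BinaryForms
  open RealArithmetic
  open FormRoots
  private
    module R = ℝ-Solver
  open SetoidReasoning ℝ-setoid

  fromℤ-disc : ∀ f → fromℤ (ℤ.- discriminant f) ≈ fromℤ (+ 4) * fromℤ (A f) * fromℤ (C f) - fromℤ (B f) * fromℤ (B f)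
  fromℤ-disc f@(form a b c) = begin
    fromℤ (ℤ.- (b ℤ.* b ℤ.- + 4 ℤ.* a ℤ.* c))                    ≈⟨ fromℤ-neg (b ℤ.* b ℤ.- + 4 ℤ.* a ℤ.* c) ⟩
    - fromℤ (b ℤ.* b ℤ.- + 4 ℤ.* a ℤ.* c)                        ≈⟨ -‿cong (fromℤ-- (b ℤ.* b) (+ 4 ℤ.* a ℤ.* c)) ⟩
    - (fromℤ (b ℤ.* b) - fromℤ (+ 4 ℤ.* a ℤ.* c))                ≈⟨ -‿cong (+-cong (fromℤ-* b b) (-‿cong
      (≈-trans (fromℤ-* (+ 4 ℤ.* a) c) (*-cong (fromℤ-* (+ 4) a) ≈-refl)))) ⟩
    - (fromℤ b * fromℤ b - fromℤ (+ 4) * fromℤ a * fromℤ c)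
      ≈⟨ R.solve 3 (λ a b c → R.:- (b R.:* b R.:- R.con (+ 4) R.:* a R.:* c) R.:= R.con (+ 4) R.:* a R.:* c R.:- b R.:* b) ≈-refl (fromℤ a) (fromℤ b) (fromℤ c) ⟩
    fromℤ (+ 4) * fromℤ a * fromℤ c - fromℤ b * fromℤ b          ∎

  twiceA : Form → ℝ
  twiceA f = fromℤ (+ 2) * fromℤ (A f)

  -- The quadratic formula x = -B/2A, y = √(-D)/2A, freed from the division and from the square
  -- root.
  record Coordinates (f : Form) (x y : ℝ) : Set where
    constructor coordinates
    field
      vertex : twiceA f * x + fromℤ (B f) ≈ 0ᴿ
      height : (twiceA f * y) * (twiceA f * y) ≈ fromℤ (ℤ.- discriminant f)

  open Coordinates public

  -- The imaginary part of f(w, 1) is y(2Ax + B), and y > 0 can be cancelled. The height comes from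
  -- (2Ay)² = (2Ax + B)² - 4A Re f(w, 1) - D.
  root⇒coordinates : ∀ {f w} → Root f w → 0ᴿ < im w → Coordinates f (re w) (im w)
  root⇒coordinates {f@(form _ _ _)} {w} (mkRoot (mk≈ᶜ re≈0 im≈0)) y>0 = coordinates v h
    where
    a = fromℤ (A f)
    b = fromℤ (B f)
    c = fromℤ (C f)
    x = re w
    y = im w
    real : a * (x * x - y * y) + b * x + c ≈ 0ᴿ
    real = ≈-trans (R.solve 5 (λ a b c x y →
      a R.:* (x R.:* x R.:- y R.:* y) R.:+ b R.:* x R.:+ c
      R.:= (a R.:* (x R.:* x R.:- y R.:* y) R.:- R.con (+ 0) R.:* (x R.:* y R.:+ y R.:* x)) R.:+ (b R.:* x R.:- R.con (+ 0) R.:* y) R.:+ c)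
      ≈-refl a b c x y) re≈0
    v : twiceA f * x + b ≈ 0ᴿ
    v = *-cancel-0 y>0 (≈-trans (R.solve 4 (λ a b x y →
      y R.:* (R.con (+ 2) R.:* a R.:* x R.:+ b)
      R.:= (a R.:* (x R.:* y R.:+ y R.:* x) R.:+ R.con (+ 0) R.:* (x R.:* x R.:- y R.:* y)) R.:+ (b R.:* y R.:+ R.con (+ 0) R.:* x) R.:+ R.con (+ 0))
      ≈-refl a b x y) im≈0)
    h : (twiceA f * y) * (twiceA f * y) ≈ fromℤ (ℤ.- discriminant f)
    h = begin
      (twiceA f * y) * (twiceA f * y)
        ≈⟨ R.solve 5 (λ a b c x y →
             (R.con (+ 2) R.:* a R.:* y) R.:* (R.con (+ 2) R.:* a R.:* y)
             R.:= (R.con (+ 2) R.:* a R.:* x R.:+ b) R.:* (R.con (+ 2) R.:* a R.:* x R.:+ b)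
                  R.:- R.con (+ 4) R.:* a R.:* (a R.:* (x R.:* x R.:- y R.:* y) R.:+ b R.:* x R.:+ c)
                  R.:+ (R.con (+ 4) R.:* a R.:* c R.:- b R.:* b)) ≈-refl a b c x y ⟩
      (twiceA f * x + b) * (twiceA f * x + b) - fromℤ (+ 4) * a * (a * (x * x - y * y) + b * x + c) + (fromℤ (+ 4) * a * c - b * b)
        ≈⟨ +-cong (+-cong (*-cong v v) (-‿cong (*-cong (≈-refl {fromℤ (+ 4) * a}) real))) (≈-sym (fromℤ-disc f)) ⟩
      0ᴿ * 0ᴿ - fromℤ (+ 4) * a * 0ᴿ + fromℤ (ℤ.- discriminant f)
        ≈⟨ R.solve 2 (λ a d → R.con (+ 0) R.:* R.con (+ 0) R.:- R.con (+ 4) R.:* a R.:* R.con (+ 0) R.:+ d R.:= d) ≈-refl a (fromℤ (ℤ.- discriminant f)) ⟩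
      fromℤ (ℤ.- discriminant f) ∎

  twiceA-pos : ∀ {f} → 0ℤ ℤ.< A f → 0ᴿ < twiceA f
  twiceA-pos f>0 = *-pos (fromℤ-pos (ℤ.+<+ (s≤s z≤n))) (fromℤ-pos f>0)

  coordinates⇒root : ∀ {f w} → 0ℤ ℤ.< A f → Coordinates f (re w) (im w) → Root f w
  coordinates⇒root {f@(form _ _ _)} {w} f>0 (coordinates v h) = mkRoot (mk≈ᶜ
    (≈-trans (R.solve 5 (λ a b c x y →
      (a R.:* (x R.:* x R.:- y R.:* y) R.:- R.con (+ 0) R.:* (x R.:* y R.:+ y R.:* x)) R.:+ (b R.:* x R.:- R.con (+ 0) R.:* y) R.:+ c
      R.:= a R.:* (x R.:* x R.:- y R.:* y) R.:+ b R.:* x R.:+ c)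
      ≈-refl a b c x y) real)
    (≈-trans (R.solve 4 (λ a b x y →
      (a R.:* (x R.:* y R.:+ y R.:* x) R.:+ R.con (+ 0) R.:* (x R.:* x R.:- y R.:* y)) R.:+ (b R.:* y R.:+ R.con (+ 0) R.:* x) R.:+ R.con (+ 0)
      R.:= y R.:* (R.con (+ 2) R.:* a R.:* x R.:+ b))
      ≈-refl a b x y) (≈-trans (*-cong (≈-refl {y}) v) (R.solve 1 (λ y → y R.:* R.con (+ 0) R.:= R.con (+ 0)) ≈-refl y))))
    where
    a = fromℤ (A f)
    b = fromℤ (B f)
    c = fromℤ (C f)
    x = re w
    y = im w
    real : a * (x * x - y * y) + b * x + c ≈ 0ᴿ
    real = *-cancel-0 (*-pos (fromℤ-pos {+ 2} (ℤ.+<+ (s≤s z≤n))) (twiceA-pos {f} f>0)) (begin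
      fromℤ (+ 2) * twiceA f * (a * (x * x - y * y) + b * x + c)
        ≈⟨ R.solve 5 (λ a b c x y →
             R.con (+ 2) R.:* (R.con (+ 2) R.:* a) R.:* (a R.:* (x R.:* x R.:- y R.:* y) R.:+ b R.:* x R.:+ c)
             R.:= (R.con (+ 2) R.:* a R.:* x R.:+ b) R.:* (R.con (+ 2) R.:* a R.:* x R.:+ b)
                  R.:- (R.con (+ 2) R.:* a R.:* y) R.:* (R.con (+ 2) R.:* a R.:* y)
                  R.:+ (R.con (+ 4) R.:* a R.:* c R.:- b R.:* b)) ≈-refl a b c x y ⟩
      (twiceA f * x + b) * (twiceA f * x + b) - (twiceA f * y) * (twiceA f * y) + (fromℤ (+ 4) * a * c - b * b)
        ≈⟨ +-cong (+-cong (*-cong v v) (-‿cong h)) (≈-sym (fromℤ-disc f)) ⟩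
      0ᴿ * 0ᴿ - fromℤ (ℤ.- discriminant f) + fromℤ (ℤ.- discriminant f)
        ≈⟨ R.solve 1 (λ d → R.con (+ 0) R.:* R.con (+ 0) R.:- d R.:+ d R.:= R.con (+ 0)) ≈-refl (fromℤ (ℤ.- discriminant f)) ⟩
      0ᴿ ∎)

  module _ {f g w} (rf : Root f w) (rg : Root g w) (y>0 : 0ᴿ < im w) where

    private
      cf = root⇒coordinates rf y>0
      cg = root⇒coordinates rg y>0

    -- Both sides are (2 A(f) A(g) y)², where y is the imaginary part of the common root.
    root-discriminants : A g ℤ.* A g ℤ.* ℤ.- discriminant f ≡ A f ℤ.* A f ℤ.* ℤ.- discriminant g
    root-discriminants = fromℤ-injective (*-cancelˡ (*-pos (fromℤ-pos {+ 2} (ℤ.+<+ (s≤s z≤n))) (fromℤ-pos {+ 2} (ℤ.+<+ (s≤s z≤n)))) (begin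
      fromℤ (+ 2) * fromℤ (+ 2) * fromℤ (A g ℤ.* A g ℤ.* ℤ.- discriminant f)
        ≈⟨ *-cong (≈-refl {fromℤ (+ 2) * fromℤ (+ 2)}) (expand (A g) (ℤ.- discriminant f)) ⟩
      fromℤ (+ 2) * fromℤ (+ 2) * (a′ * a′ * fromℤ (ℤ.- discriminant f))
        ≈⟨ *-cong (≈-refl {fromℤ (+ 2) * fromℤ (+ 2)}) (*-cong (≈-refl {a′ * a′}) (height cf)) ⟨
      fromℤ (+ 2) * fromℤ (+ 2) * (a′ * a′ * ((twiceA f * y) * (twiceA f * y)))
        ≈⟨ R.solve 3 (λ a a′ y → R.con (+ 2) R.:* R.con (+ 2) R.:* (a′ R.:* a′ R.:* ((R.con (+ 2) R.:* a R.:* y) R.:* (R.con (+ 2) R.:* a R.:* y)))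
             R.:= R.con (+ 2) R.:* R.con (+ 2) R.:* (a R.:* a R.:* ((R.con (+ 2) R.:* a′ R.:* y) R.:* (R.con (+ 2) R.:* a′ R.:* y)))) ≈-refl a a′ y ⟩
      fromℤ (+ 2) * fromℤ (+ 2) * (a * a * ((twiceA g * y) * (twiceA g * y)))
        ≈⟨ *-cong (≈-refl {fromℤ (+ 2) * fromℤ (+ 2)}) (*-cong (≈-refl {a * a}) (height cg)) ⟩
      fromℤ (+ 2) * fromℤ (+ 2) * (a * a * fromℤ (ℤ.- discriminant g))
        ≈⟨ *-cong (≈-refl {fromℤ (+ 2) * fromℤ (+ 2)}) (expand (A f) (ℤ.- discriminant g)) ⟨
      fromℤ (+ 2) * fromℤ (+ 2) * fromℤ (A f ℤ.* A f ℤ.* ℤ.- discriminant g) ∎))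
      where
      a = fromℤ (A f)
      a′ = fromℤ (A g)
      y = im w
      expand : ∀ i j → fromℤ (i ℤ.* i ℤ.* j) ≈ fromℤ i * fromℤ i * fromℤ j
      expand i j = ≈-trans (fromℤ-* (i ℤ.* i) j) (*-cong (fromℤ-* i i) (≈-refl {fromℤ j}))

    -- The height of the common root determines A, its abscissa then B, and the discriminant C.
    form-unique : 0ℤ ℤ.< A f → 0ℤ ℤ.< A g → discriminant f ≡ discriminant g → f ≡ g
    form-unique f>0 g>0 e = form-determined f>0 A≡ B≡ e
      where
      2A≈ : twiceA f ≈ twiceA g
      2A≈ = *-cancelˡ y>0 (≈-trans (*-comm (im w) (twiceA f)) (≈-trans
        (square-injective (*-pos (twiceA-pos {f} f>0) y>0) (*-pos (twiceA-pos {g} g>0) y>0)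
          (≈-trans (height cf) (≈-trans (≡⇒≈ (cong (λ d → ℤ.- d) e)) (≈-sym (height cg)))))
        (*-comm (twiceA g) (im w))))
        where
        ≡⇒≈ : ∀ {i j} → i ≡ j → fromℤ i ≈ fromℤ j
        ≡⇒≈ refl = ≈-refl
      A≡ : A f ≡ A g
      A≡ = fromℤ-injective (*-cancelˡ (fromℤ-pos {+ 2} (ℤ.+<+ (s≤s z≤n))) 2A≈)
      B≡ : B f ≡ B g
      B≡ = fromℤ-injective (begin
        fromℤ (B f)                                                  ≈⟨ R.solve 3 (λ a x b → b R.:= (a R.:* x R.:+ b) R.:- a R.:* x) ≈-refl (twiceA f) (re w) (fromℤ (B f)) ⟩
        (twiceA f * re w + fromℤ (B f)) - twiceA f * re w            ≈⟨ +-cong (vertex cf) (-‿cong (*-cong 2A≈ (≈-refl {re w}))) ⟩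
        0ᴿ - twiceA g * re w                                         ≈⟨ +-cong (≈-sym (vertex cg)) (≈-refl { - (twiceA g * re w)}) ⟩
        (twiceA g * re w + fromℤ (B g)) - twiceA g * re w            ≈⟨ R.solve 3 (λ a x b → (a R.:* x R.:+ b) R.:- a R.:* x R.:= b) ≈-refl (twiceA g) (re w) (fromℤ (B g)) ⟩
        fromℤ (B g) ∎)

  root-unique : ∀ {f w w′} → 0ℤ ℤ.< A f → Root f w → Root f w′ → 0ᴿ < im w → 0ᴿ < im w′ → w ≈ᶜ w′
  root-unique {f} {w} {w′} f>0 r r′ y>0 y′>0 = mk≈ᶜ
    (*-cancelˡ (twiceA-pos {f} f>0) (begin
      twiceA f * re w                                       ≈⟨ R.solve 2 (λ u b → u R.:= (u R.:+ b) R.:- b) ≈-refl (twiceA f * re w) (fromℤ (B f)) ⟩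
      (twiceA f * re w + fromℤ (B f)) - fromℤ (B f)         ≈⟨ +-cong (≈-trans (vertex cw) (≈-sym (vertex cw′))) (≈-refl { - fromℤ (B f)}) ⟩
      (twiceA f * re w′ + fromℤ (B f)) - fromℤ (B f)        ≈⟨ R.solve 2 (λ u b → (u R.:+ b) R.:- b R.:= u) ≈-refl (twiceA f * re w′) (fromℤ (B f)) ⟩
      twiceA f * re w′                                      ∎))
    (*-cancelˡ (twiceA-pos {f} f>0) (square-injective (*-pos (twiceA-pos {f} f>0) y>0) (*-pos (twiceA-pos {f} f>0) y′>0)
      (≈-trans (height cw) (≈-sym (height cw′)))))
    where
    cw = root⇒coordinates r y>0
    cw′ = root⇒coordinates r′ y′>0

-- The group R(p) as integral matrices acting on √p z.

module MatrixAction where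

  open import Data.Integer.Base as ℤ using (ℤ; +_; 1ℤ)
  import Data.Integer.Properties as ℤ
  open import Data.Nat.Base as ℕ using (ℕ; z≤n; s≤s)
  open import Data.Product.Base using (_,_)
  open import Defs hiding (a; b; c; d; det; scaled)
  open import Relation.Binary.Bundles using (Setoid)
  open import Relation.Binary.PropositionalEquality using (_≡_; refl; cong)
  import Relation.Binary.Reasoning.Setoid as SetoidReasoning
  open BinaryForms
  open RealArithmetic
  open FormRoots
  private
    module R = ℝ-Solver
    module C = ℂ-Solver

  open Setoid ℂ-setoid using () renaming (refl to ≈ᶜ-refl; sym to ≈ᶜ-sym; trans to ≈ᶜ-trans)

  fromℝ-cancelˡ : ∀ {r u v} → 0ᴿ < r → fromℝ r *ᶜ u ≈ᶜ fromℝ r *ᶜ v → u ≈ᶜ v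
  fromℝ-cancelˡ {r} {u} {v} r>0 (mk≈ᶜ p q) = mk≈ᶜ
    (*-cancelˡ r>0 (≈-trans (re-part u) (≈-trans p (≈-sym (re-part v)))))
    (*-cancelˡ r>0 (≈-trans (im-part u) (≈-trans q (≈-sym (im-part v)))))
    where
    re-part : ∀ u → r * re u ≈ r * re u - 0ᴿ * im u
    re-part u = R.solve 3 (λ r x y → r R.:* x R.:= r R.:* x R.:- R.con (+ 0) R.:* y) ≈-refl r (re u) (im u)
    im-part : ∀ u → r * im u ≈ r * im u + 0ᴿ * re u
    im-part u = R.solve 3 (λ r x y → r R.:* y R.:= r R.:* y R.:+ R.con (+ 0) R.:* x) ≈-refl r (re u) (im u)

  module Scaled {p : ℕ} (p>0 : 0 ℕ.< p) where

    S : ℂ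
    S = fromℝ (√ p)

    scaled : ℍ → ℂ
    scaled z = S *ᶜ point z

    scaled-im>0 : ∀ z → 0ᴿ < im (scaled z)
    scaled-im>0 z = <-respʳ-≈
      (R.solve 3 (λ r x y → r R.:* y R.:= r R.:* y R.:+ R.con (+ 0) R.:* x) ≈-refl (√ p) (re (point z)) (im (point z)))
      (*-pos (√-pos p>0) (im>0 z))

    scaled-injective : ∀ {z v} → scaled z ≈ᶜ scaled v → z ≈ᴴ v
    scaled-injective = fromℝ-cancelˡ (√-pos p>0)

    S*S : S *ᶜ S ≈ᶜ ι (+ p)
    S*S = ≈ᶜ-trans (≈ᶜ-sym (fromℝ-* (√ p) (√ p))) (fromℝ-cong (√-square p))

    -- The matrix of γ in the coordinate √p z; in the case of R⁻ it is multiplied by √p, so that its determinant is p.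
    matrix⁺ : ∀ {γ} → R⁺ p γ → Matrix
    matrix⁺ (mkR⁺ (a , _) (b , _) (c , _) (d , _)) = matrix a (b ℤ.* + p) c d

    matrix⁻ : ∀ {γ} → R⁻ p γ → Matrix
    matrix⁻ (mkR⁻ (a , _) (b , _) (c , _) (d , _)) = matrix (a ℤ.* + p) (b ℤ.* + p) c (d ℤ.* + p)

    -- Numerator and denominator of the action become integral only after a common positive factor
    -- `unit`, which is 1 for R⁺ and √p for R⁻. The additional `S` in the numerator converts the
    -- image to the coordinate √p z.
    record Represents (γ : SL₂ℝ) (M : Matrix) (z : ℍ) : Set where
      field
        unit        : ℝ
        unit>0      : 0ᴿ < unit
        denominator≈ : fromℝ unit *ᶜ denominator γ (point z) ≈ᶜ ι (Matrix.γ M) *ᶜ scaled z +ᶜ ι (Matrix.δ M)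
        numerator≈   : fromℝ unit *ᶜ (S *ᶜ numerator γ (point z)) ≈ᶜ ι (Matrix.α M) *ᶜ scaled z +ᶜ ι (Matrix.β M)

    module _ {γ M z} (rep : Represents γ M z) where
      open Represents rep

      private
        u = fromℝ unit
        m = denominator γ (point z)
        n = numerator γ (point z)
        rearrange : ∀ v → u *ᶜ (S *ᶜ (point v *ᶜ m)) ≈ᶜ scaled v *ᶜ (u *ᶜ m)
        rearrange v = C.solve 4 (λ u s v m → u C.:* (s C.:* (v C.:* m)) C.:= (s C.:* v) C.:* (u C.:* m)) ≈ᶜ-refl u S (point v) m

      action⇒moebius : ∀ {v} → γ • z ≈ᴴ v → Moebius M (scaled z) (scaled v)
      action⇒moebius {v} e = mkMoebius (≈ᶜ-trans (*ᶜ-cong (≈ᶜ-refl {scaled v}) (≈ᶜ-sym denominator≈))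
        (≈ᶜ-trans (≈ᶜ-sym (rearrange v))
        (≈ᶜ-trans (*ᶜ-cong (≈ᶜ-refl {u}) (*ᶜ-cong (≈ᶜ-refl {S}) (•-image γ z v e))) numerator≈)))

      moebius⇒action : ∀ {v} → Moebius M (scaled z) (scaled v) → γ • z ≈ᴴ v
      moebius⇒action {v} (mkMoebius e) = •-image⁻¹ γ z v (fromℝ-cancelˡ (√-pos p>0) (fromℝ-cancelˡ unit>0
        (≈ᶜ-trans (rearrange v) (≈ᶜ-trans (*ᶜ-cong (≈ᶜ-refl {scaled v}) denominator≈) (≈ᶜ-trans e (≈ᶜ-sym numerator≈))))))

    private
      fromℝ-root : ∀ {x} n → x ≈ fromℤ n * √ p → fromℝ x ≈ᶜ ι n *ᶜ S
      fromℝ-root n e = ≈ᶜ-trans (fromℝ-cong e) (fromℝ-* (fromℤ n) (√ p))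

      ι-*p : ∀ n → ι n *ᶜ (S *ᶜ S) ≈ᶜ ι (n ℤ.* + p)
      ι-*p n = ≈ᶜ-trans (*ᶜ-cong (≈ᶜ-refl {ι n}) S*S) (≈ᶜ-sym (ι-* n (+ p)))

    represents⁺ : ∀ {γ} (r : R⁺ p γ) z → Represents γ (matrix⁺ r) z
    represents⁺ {γ} (mkR⁺ (a , a≈) (b , b≈) (c , c≈) (d , d≈)) z = record
      { unit = 1ᴿ ; unit>0 = fromℤ-pos (ℤ.+<+ (s≤s z≤n))
      ; denominator≈ = ≈ᶜ-trans (*ᶜ-identityˡ (denominator γ v)) (+ᶜ-cong
          (≈ᶜ-trans (*ᶜ-cong (fromℝ-root c c≈) (≈ᶜ-refl {v})) (*ᶜ-assoc (ι c) S v)) (fromℝ-cong d≈))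
      ; numerator≈ = ≈ᶜ-trans (*ᶜ-identityˡ (S *ᶜ numerator γ v)) (≈ᶜ-trans
          (*ᶜ-cong (≈ᶜ-refl {S}) (+ᶜ-cong (*ᶜ-cong (fromℝ-cong a≈) (≈ᶜ-refl {v})) (fromℝ-root b b≈))) (≈ᶜ-trans
          (C.solve 4 (λ a b s v → s C.:* (a C.:* v C.:+ b C.:* s) C.:= a C.:* (s C.:* v) C.:+ b C.:* (s C.:* s)) ≈ᶜ-refl (ι a) (ι b) S v)
          (+ᶜ-cong (≈ᶜ-refl {ι a *ᶜ (S *ᶜ v)}) (ι-*p b)))) }
      where v = point z

    represents⁻ : ∀ {γ} (r : R⁻ p γ) z → Represents γ (matrix⁻ r) z
    represents⁻ {γ} (mkR⁻ (a , a≈) (b , b≈) (c , c≈) (d , d≈)) z = record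
      { unit = √ p ; unit>0 = √-pos p>0
      ; denominator≈ = ≈ᶜ-trans
          (*ᶜ-cong (≈ᶜ-refl {S}) (+ᶜ-cong (*ᶜ-cong (fromℝ-cong c≈) (≈ᶜ-refl {v})) (fromℝ-root d d≈))) (≈ᶜ-trans
          (C.solve 4 (λ a b s v → s C.:* (a C.:* v C.:+ b C.:* s) C.:= a C.:* (s C.:* v) C.:+ b C.:* (s C.:* s)) ≈ᶜ-refl (ι c) (ι d) S v)
          (+ᶜ-cong (≈ᶜ-refl {ι c *ᶜ (S *ᶜ v)}) (ι-*p d)))
      ; numerator≈ = ≈ᶜ-trans
          (*ᶜ-cong (≈ᶜ-refl {S}) (*ᶜ-cong (≈ᶜ-refl {S}) (+ᶜ-cong (*ᶜ-cong (fromℝ-root a a≈) (≈ᶜ-refl {v})) (fromℝ-cong b≈)))) (≈ᶜ-trans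
          (C.solve 4 (λ a b s v → s C.:* (s C.:* (a C.:* s C.:* v C.:+ b)) C.:= a C.:* (s C.:* s) C.:* (s C.:* v) C.:+ b C.:* (s C.:* s)) ≈ᶜ-refl (ι a) (ι b) S v)
          (+ᶜ-cong (*ᶜ-cong (ι-*p a) (≈ᶜ-refl {S *ᶜ v})) (ι-*p b))) }
      where v = point z

    private
      fromℤ-det : ∀ M → fromℤ (det M) ≈ fromℤ (Matrix.α M) * fromℤ (Matrix.δ M) - fromℤ (Matrix.β M) * fromℤ (Matrix.γ M)
      fromℤ-det (matrix α β γ δ) = ≈-trans (fromℤ-- (α ℤ.* δ) (β ℤ.* γ)) (+-cong (fromℤ-* α δ) (-‿cong (fromℤ-* β γ)))

      *p : ∀ n → fromℤ (n ℤ.* + p) ≈ fromℤ n * (√ p * √ p)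
      *p n = ≈-trans (fromℤ-* n (+ p)) (*-cong (≈-refl {fromℤ n}) (≈-sym (√-square p)))

    det⁺ : ∀ {γ} (r : R⁺ p γ) → det (matrix⁺ r) ≡ 1ℤ
    det⁺ {γ} r@(mkR⁺ (a , a≈) (b , b≈) (c , c≈) (d , d≈)) = fromℤ-injective (begin
      fromℤ (det (matrix⁺ r))                                       ≈⟨ fromℤ-det (matrix⁺ r) ⟩
      fromℤ a * fromℤ d - fromℤ (b ℤ.* + p) * fromℤ c              ≈⟨ +-cong (≈-refl {fromℤ a * fromℤ d}) (-‿cong (*-cong (*p b) (≈-refl {fromℤ c}))) ⟩
      fromℤ a * fromℤ d - fromℤ b * (√ p * √ p) * fromℤ c
        ≈⟨ R.solve 5 (λ a b c d s → a R.:* d R.:- b R.:* (s R.:* s) R.:* c R.:= a R.:* d R.:- (b R.:* s) R.:* (c R.:* s)) ≈-refl (fromℤ a) (fromℤ b) (fromℤ c) (fromℤ d) (√ p) ⟩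
      fromℤ a * fromℤ d - (fromℤ b * √ p) * (fromℤ c * √ p)        ≈⟨ +-cong (*-cong a≈ d≈) (-‿cong (*-cong b≈ c≈)) ⟨
      SL₂ℝ.a γ * SL₂ℝ.d γ - SL₂ℝ.b γ * SL₂ℝ.c γ                    ≈⟨ SL₂ℝ.det γ ⟩
      1ᴿ                                                           ∎)
      where open SetoidReasoning ℝ-setoid

    det⁻ : ∀ {γ} (r : R⁻ p γ) → det (matrix⁻ r) ≡ + p
    det⁻ {γ} r@(mkR⁻ (a , a≈) (b , b≈) (c , c≈) (d , d≈)) = fromℤ-injective (begin
      fromℤ (det (matrix⁻ r))                                       ≈⟨ fromℤ-det (matrix⁻ r) ⟩
      fromℤ (a ℤ.* + p) * fromℤ (d ℤ.* + p) - fromℤ (b ℤ.* + p) * fromℤ c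
        ≈⟨ +-cong (*-cong (*p a) (*p d)) (-‿cong (*-cong (*p b) (≈-refl {fromℤ c}))) ⟩
      fromℤ a * (√ p * √ p) * (fromℤ d * (√ p * √ p)) - fromℤ b * (√ p * √ p) * fromℤ c
        ≈⟨ R.solve 5 (λ a b c d s → a R.:* (s R.:* s) R.:* (d R.:* (s R.:* s)) R.:- b R.:* (s R.:* s) R.:* c
             R.:= ((a R.:* s) R.:* (d R.:* s) R.:- b R.:* c) R.:* (s R.:* s)) ≈-refl (fromℤ a) (fromℤ b) (fromℤ c) (fromℤ d) (√ p) ⟩
      ((fromℤ a * √ p) * (fromℤ d * √ p) - fromℤ b * fromℤ c) * (√ p * √ p)
        ≈⟨ *-cong (+-cong (*-cong a≈ d≈) (-‿cong (*-cong b≈ c≈))) (≈-sym (√-square p)) ⟨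
      (SL₂ℝ.a γ * SL₂ℝ.d γ - SL₂ℝ.b γ * SL₂ℝ.c γ) * fromℤ (+ p)    ≈⟨ *-cong (SL₂ℝ.det γ) (≈-refl {fromℤ (+ p)}) ⟩
      1ᴿ * fromℤ (+ p)                                             ≈⟨ *-identityˡ (fromℤ (+ p)) ⟩
      fromℤ (+ p)                                                  ∎)
      where open SetoidReasoning ℝ-setoid

    element⁺ : ∀ a b c d → det (matrix a (b ℤ.* + p) c d) ≡ 1ℤ → SL₂ℝ
    SL₂ℝ.a (element⁺ a b c d e) = fromℤ a
    SL₂ℝ.b (element⁺ a b c d e) = fromℤ b * √ p
    SL₂ℝ.c (element⁺ a b c d e) = fromℤ c * √ p
    SL₂ℝ.d (element⁺ a b c d e) = fromℤ d
    SL₂ℝ.det (element⁺ a b c d e) = begin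
      fromℤ a * fromℤ d - (fromℤ b * √ p) * (fromℤ c * √ p)
        ≈⟨ R.solve 5 (λ a b c d s → a R.:* d R.:- (b R.:* s) R.:* (c R.:* s) R.:= a R.:* d R.:- b R.:* (s R.:* s) R.:* c) ≈-refl (fromℤ a) (fromℤ b) (fromℤ c) (fromℤ d) (√ p) ⟩
      fromℤ a * fromℤ d - fromℤ b * (√ p * √ p) * fromℤ c          ≈⟨ +-cong (≈-refl {fromℤ a * fromℤ d}) (-‿cong (*-cong (*p b) (≈-refl {fromℤ c}))) ⟨
      fromℤ a * fromℤ d - fromℤ (b ℤ.* + p) * fromℤ c              ≈⟨ fromℤ-det (matrix a (b ℤ.* + p) c d) ⟨
      fromℤ (det (matrix a (b ℤ.* + p) c d))                       ≈⟨ ≈-reflexive (cong fromℤ e) ⟩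
      1ᴿ                                                           ∎
      where
      open SetoidReasoning ℝ-setoid
      open Setoid ℝ-setoid using () renaming (reflexive to ≈-reflexive)

    element⁺∈R⁺ : ∀ a b c d e → R⁺ p (element⁺ a b c d e)
    element⁺∈R⁺ a b c d e = mkR⁺ (a , ≈-refl) (b , ≈-refl) (c , ≈-refl) (d , ≈-refl)

    element⁻ : ∀ a b c d → a ℤ.* d ℤ.* + p ℤ.- b ℤ.* c ≡ 1ℤ → SL₂ℝ
    SL₂ℝ.a (element⁻ a b c d e) = fromℤ a * √ p
    SL₂ℝ.b (element⁻ a b c d e) = fromℤ b
    SL₂ℝ.c (element⁻ a b c d e) = fromℤ c
    SL₂ℝ.d (element⁻ a b c d e) = fromℤ d * √ p
    SL₂ℝ.det (element⁻ a b c d e) = begin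
      (fromℤ a * √ p) * (fromℤ d * √ p) - fromℤ b * fromℤ c
        ≈⟨ R.solve 5 (λ a b c d s → (a R.:* s) R.:* (d R.:* s) R.:- b R.:* c R.:= (a R.:* d) R.:* (s R.:* s) R.:- b R.:* c) ≈-refl (fromℤ a) (fromℤ b) (fromℤ c) (fromℤ d) (√ p) ⟩
      fromℤ a * fromℤ d * (√ p * √ p) - fromℤ b * fromℤ c          ≈⟨ +-cong (≈-trans (*p (a ℤ.* d)) (*-cong (fromℤ-* a d) (≈-refl {√ p * √ p}))) (-‿cong (fromℤ-* b c)) ⟨
      fromℤ (a ℤ.* d ℤ.* + p) - fromℤ (b ℤ.* c)                    ≈⟨ fromℤ-- (a ℤ.* d ℤ.* + p) (b ℤ.* c) ⟨
      fromℤ (a ℤ.* d ℤ.* + p ℤ.- b ℤ.* c)                          ≈⟨ ≈-reflexive (cong fromℤ e) ⟩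
      1ᴿ                                                           ∎
      where
      open SetoidReasoning ℝ-setoid
      open Setoid ℝ-setoid using () renaming (reflexive to ≈-reflexive)

    element⁻∈R⁻ : ∀ a b c d e → R⁻ p (element⁻ a b c d e)
    element⁻∈R⁻ a b c d e = mkR⁻ (a , ≈-refl) (b , ≈-refl) (c , ≈-refl) (d , ≈-refl)

-- Discriminants -4 and -3, and the roots of a form modulo p.

module FormsModPrime where

  open import Data.Integer.Base hiding (suc; ∣_∣)
  open import Data.Integer.Base using () renaming (∣_∣ to abs)
  open import Data.Integer.DivMod using (a≡a%ℕn+[a/ℕn]*n; n%ℕd<d)
  open import Data.Integer.Divisibility.Signed
  open import Data.Integer.Properties
  open import Data.Integer.Solver using (module +-*-Solver)
  open import Data.Nat.Base as ℕ using (ℕ; zero; suc; z≤n; s≤s)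
  import Data.Nat.Divisibility as ℕ
  import Data.Nat.DivMod as ℕ
  import Data.Nat.Properties as ℕ
  open import Data.Nat.Primality using (Prime; prime⇒nonZero)
  open import Data.Product.Base using (∃-syntax; _×_; _,_)
  open import Data.Sum.Base as Sum using (_⊎_; inj₁; inj₂)
  open import Data.Empty using (⊥; ⊥-elim)
  open import Defs using (Form; form; A; B; C; value; discriminant; Reduced)
  open import Relation.Binary.PropositionalEquality
  open import Relation.Nullary using (¬_; Dec; yes; no; contradiction)
  open +-*-Solver using (solve; con; _:+_; _:*_; _:-_; :-_; _:=_)
  open PrimeModulus
  open BinaryForms

  module _ {f : Form} {n : ℕ} (f>0 : 0ℤ < A f) (r : Reduced f) (d : discriminant f ≡ - + n) (n≤4 : n ℕ.≤ 4) where
    private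
      a = A f
      b = B f
      c = C f
      a≤c = Reduced.A≤C r
      c>0 = <-≤-trans f>0 a≤c

    reduced-4AC : + 4 * (a * c) ≡ b * b + + n
    reduced-4AC = trans (solve 3 (λ a b c → con (+ 4) :* (a :* c) := b :* b :- discriminantᴾ a b c) refl a b c)
      (trans (cong (λ d → b * b - d) d) (cong (_+_ (b * b)) (neg-involutive (+ n))))

    -- From B² ≤ A² ≤ AC and 4AC - B² = n follows 3AC ≤ n. As A and C are positive integers, both
    -- have to be 1.
    reduced-3AC≤4 : + 3 * (a * c) ≤ + 4
    reduced-3AC≤4 = ≤-trans (0≤i-j⇒j≤i (subst (0ℤ ≤_) eq (nonNeg-+ (nonNeg-* (<⇒≤ f>0) (i≤j⇒0≤j-i a≤c))
        (nonNeg-* (i≤j⇒0≤j-i (Reduced.∣B∣≤A r)) (nonNeg-+ (<⇒≤ f>0) (+≤+ z≤n)))))) (+≤+ n≤4)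
      where
      eq : a * (c - a) + (a - + abs b) * (a + + abs b) ≡ + n - + 3 * (a * c)
      eq = begin
        a * (c - a) + (a - + abs b) * (a + + abs b)
          ≡⟨ solve 3 (λ a c k → a :* (c :- a) :+ (a :- k) :* (a :+ k) := con (+ 4) :* (a :* c) :- k :* k :- con (+ 3) :* (a :* c)) refl a c (+ abs b) ⟩
        + 4 * (a * c) - + abs b * + abs b - + 3 * (a * c)
          ≡⟨ cong₂ (λ u v → u - v - + 3 * (a * c)) reduced-4AC (∣i∣²≡i² b) ⟩
        b * b + + n - b * b - + 3 * (a * c)
          ≡⟨ solve 3 (λ s n t → s :+ n :- s :- t := n :- t) refl (b * b) (+ n) (+ 3 * (a * c)) ⟩
        + n - + 3 * (a * c) ∎
        where open ≡-Reasoning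

    reduced-AC≤1 : a * c ≤ 1ℤ
    reduced-AC≤1 = ≮⇒≥ λ 1<ac → contradiction (≤-trans (*-monoˡ-≤-nonNeg (+ 3) (i<j⇒suc[i]≤j 1<ac)) reduced-3AC≤4)
      (λ { (+≤+ (s≤s (s≤s (s≤s (s≤s ()))))) })

    reduced-A≡1 : a ≡ 1ℤ
    reduced-A≡1 = ≤-antisym (≤-trans (0≤i-j⇒j≤i (subst (0ℤ ≤_) (solve 2 (λ a c → a :* (c :- con 1ℤ) := a :* c :- a) refl a c)
      (nonNeg-* (<⇒≤ f>0) (pos⇒≥1 c>0)))) reduced-AC≤1) (i<j⇒suc[i]≤j f>0)

    reduced-C≡1 : c ≡ 1ℤ
    reduced-C≡1 = trans (sym (*-identityˡ c)) (trans (cong (_* c) (sym reduced-A≡1)) (≤-antisym reduced-AC≤1 (i<j⇒suc[i]≤j (pos-*-pos f>0 c>0))))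

    reduced-B² : b * b + + n ≡ + 4
    reduced-B² = trans (sym reduced-4AC) (cong (+ 4 *_) (cong₂ _*_ reduced-A≡1 reduced-C≡1))

  reduced-4 : ∀ {f} → 0ℤ < A f → Reduced f → discriminant f ≡ - + 4 → f ≡ form 1ℤ 0ℤ 1ℤ
  reduced-4 {f} f>0 r d = form-≡ (reduced-A≡1 {n = 4} f>0 r d ℕ.≤-refl) B≡0 (reduced-C≡1 {n = 4} f>0 r d ℕ.≤-refl)
    where
    B≡0 : B f ≡ 0ℤ
    B≡0 = Sum.[ (λ e → e) , (λ e → e) ] (i*j≡0⇒i≡0∨j≡0 (B f) (+-injectiveˡ (+ 4)
      (trans (+-comm (+ 4) (B f * B f)) (reduced-B² {n = 4} f>0 r d ℕ.≤-refl))))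

  -- Here B² = 1, and |B| = A is a boundary case, which selects B = 1.
  reduced-3 : ∀ {f} → 0ℤ < A f → Reduced f → discriminant f ≡ - + 3 → f ≡ form 1ℤ 1ℤ 1ℤ
  reduced-3 {f} f>0 r d = form-≡ A≡1 B≡1 (reduced-C≡1 {n = 3} f>0 r d (s≤s (s≤s (s≤s z≤n))))
    where
    A≡1 : A f ≡ 1ℤ
    A≡1 = reduced-A≡1 {n = 3} f>0 r d (s≤s (s≤s (s≤s z≤n)))
    B²≡1 : B f * B f ≡ 1ℤ
    B²≡1 = +-injectiveˡ (+ 3) (trans (+-comm (+ 3) (B f * B f)) (reduced-B² {n = 3} f>0 r d (s≤s (s≤s (s≤s z≤n)))))
    ∣B∣≡1 : abs (B f) ≡ 1
    ∣B∣≡1 = ℕ.m*n≡1⇒m≡1 (abs (B f)) (abs (B f)) (trans (sym (abs-* (B f) (B f))) (cong abs B²≡1))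
    B≡1 : B f ≡ 1ℤ
    B≡1 = trans (sym (0≤i⇒+∣i∣≡i (Reduced.boundary r (inj₁ (trans (cong +_ ∣B∣≡1) (sym A≡1)))))) (cong +_ ∣B∣≡1)

  -- The new leading coefficient is the value of a positive definite form at the first column of M,
  -- which is nonzero because det M = 1.
  ∘-A>0 : ∀ {f} M → 0ℤ < A f → discriminant f < 0ℤ → det M ≡ 1ℤ → 0ℤ < A (f ∘ᶠ M)
  ∘-A>0 {f} M f>0 d<0 m = positiveDefinite {f} f>0 d<0 (α M) (γ M) λ (α≡0 , γ≡0) →
    contradiction (trans (sym m) (trans (cong₂ (λ x y → x * δ M - β M * y) α≡0 γ≡0) (cong (λ u → 0ℤ - u) (*-zeroʳ (β M))))) λ ()

  reduce-to : ∀ {f n} → 0ℤ < A f → 0 ℕ.< n → discriminant f ≡ - + n →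
              ∃[ g ] f ∼ g × 0ℤ < A g × Reduced g × discriminant g ≡ - + n
  reduce-to {f} {n} f>0 n>0 d =
    let g , s , r = reduce f f>0 d<0
    in g , s , A-pos s , r , trans (∼-discriminant s) d
    where
    d<0 : discriminant f < 0ℤ
    d<0 = subst (_< 0ℤ) (sym d) (neg-mono-< (+<+ n>0))
    A-pos : ∀ {g} → f ∼ g → 0ℤ < A g
    A-pos (mk∼ M m refl) = ∘-A>0 {f} M f>0 d<0 m

  principal-4 : ∀ {f} → 0ℤ < A f → discriminant f ≡ - + 4 → f ∼ form 1ℤ 0ℤ 1ℤ
  principal-4 {f} f>0 d = let g , s , g>0 , r , d′ = reduce-to {f} {4} f>0 (s≤s z≤n) d in subst (f ∼_) (reduced-4 g>0 r d′) s

  principal-3 : ∀ {f} → 0ℤ < A f → discriminant f ≡ - + 3 → f ∼ form 1ℤ 1ℤ 1ℤ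
  principal-3 {f} f>0 d = let g , s , g>0 , r , d′ = reduce-to {f} {3} f>0 (s≤s z≤n) d in subst (f ∼_) (reduced-3 g>0 r d′) s

  square%4 : ∀ m → (m ℕ.* m) ℕ.% 4 ≡ 0 ⊎ (m ℕ.* m) ℕ.% 4 ≡ 1
  square%4 m = Sum.map (trans (ℕ.%-distribˡ-* m m 4)) (trans (ℕ.%-distribˡ-* m m 4)) (residues (m ℕ.% 4) (ℕ.m%n<n m 4))
    where
    residues : ∀ r → r ℕ.< 4 → (r ℕ.* r) ℕ.% 4 ≡ 0 ⊎ (r ℕ.* r) ℕ.% 4 ≡ 1
    residues 0 _ = inj₁ refl
    residues 1 _ = inj₂ refl
    residues 2 _ = inj₁ refl
    residues 3 _ = inj₂ refl
    residues (suc (suc (suc (suc _)))) (s≤s (s≤s (s≤s (s≤s ()))))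

  square%3 : ∀ m → (m ℕ.* m) ℕ.% 3 ≢ 2
  square%3 m e = residues (m ℕ.% 3) (ℕ.m%n<n m 3) (trans (sym (ℕ.%-distribˡ-* m m 3)) e)
    where
    residues : ∀ r → r ℕ.< 3 → (r ℕ.* r) ℕ.% 3 ≢ 2
    residues 0 _ ()
    residues 1 _ ()
    residues 2 _ ()
    residues (suc (suc (suc _))) (s≤s (s≤s (s≤s ())))

  abs² : ∀ i → i * i ≡ + (abs i ℕ.* abs i)
  abs² i = trans (sym (∣i∣²≡i² i)) (sym (pos-* (abs i) (abs i)))

  sum-of-squares%4 : ∀ p x y → + p ≡ x * x + y * y → p ℕ.% 4 ≢ 3
  sum-of-squares%4 p x y e h = cases (square%4 (abs x)) (square%4 (abs y))
    where
    m = abs x ℕ.* abs x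
    n = abs y ℕ.* abs y
    mod : (m ℕ.% 4 ℕ.+ n ℕ.% 4) ℕ.% 4 ≡ 3
    mod = trans (sym (ℕ.%-distribˡ-+ m n 4)) (trans (cong (ℕ._% 4) (sym (+-injective (trans e (cong₂ _+_ (abs² x) (abs² y)))))) h)
    finish : ∀ {r s} → m ℕ.% 4 ≡ r → n ℕ.% 4 ≡ s → (r ℕ.+ s) ℕ.% 4 ≡ 3
    finish u v = subst₂ (λ r s → (r ℕ.+ s) ℕ.% 4 ≡ 3) u v mod
    cases : m ℕ.% 4 ≡ 0 ⊎ m ℕ.% 4 ≡ 1 → n ℕ.% 4 ≡ 0 ⊎ n ℕ.% 4 ≡ 1 → ⊥
    cases (inj₁ u) (inj₁ v) = contradiction (finish u v) λ ()
    cases (inj₁ u) (inj₂ v) = contradiction (finish u v) λ ()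
    cases (inj₂ u) (inj₁ v) = contradiction (finish u v) λ ()
    cases (inj₂ u) (inj₂ v) = contradiction (finish u v) λ ()

  -- Since 4p = (2x + y)² + 3y², p is congruent to a square modulo 3.
  norm-form%3 : ∀ p x y → + p ≡ x * x + x * y + y * y → p ℕ.% 3 ≢ 2
  norm-form%3 p x y e h = square%3 (abs l) (begin
    (abs l ℕ.* abs l) ℕ.% 3                                       ≡⟨ ℕ.[m+kn]%n≡m%n (abs l ℕ.* abs l) (abs y ℕ.* abs y) 3 ⟨
    (abs l ℕ.* abs l ℕ.+ abs y ℕ.* abs y ℕ.* 3) ℕ.% 3             ≡⟨ cong (ℕ._% 3) (+-injective eq) ⟩
    (4 ℕ.* p) ℕ.% 3                                               ≡⟨ ℕ.%-distribˡ-* 4 p 3 ⟩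
    (1 ℕ.* (p ℕ.% 3)) ℕ.% 3                                       ≡⟨ cong (λ r → (1 ℕ.* r) ℕ.% 3) h ⟩
    2                                                             ∎)
    where
    open ≡-Reasoning
    l = + 2 * x + y
    eq : + (abs l ℕ.* abs l ℕ.+ abs y ℕ.* abs y ℕ.* 3) ≡ + (4 ℕ.* p)
    eq = begin
      + (abs l ℕ.* abs l) + + (abs y ℕ.* abs y ℕ.* 3)             ≡⟨ cong₂ _+_ (sym (abs² l)) (trans (pos-* (abs y ℕ.* abs y) 3) (cong (_* + 3) (sym (abs² y)))) ⟩
      l * l + y * y * + 3
        ≡⟨ solve 2 (λ x y → (con (+ 2) :* x :+ y) :* (con (+ 2) :* x :+ y) :+ y :* y :* con (+ 3) := con (+ 4) :* (x :* x :+ x :* y :+ y :* y)) refl x y ⟩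
      + 4 * (x * x + x * y + y * y)                                ≡⟨ cong (+ 4 *_) (sym e) ⟩
      + 4 * + p                                                    ≡⟨ pos-* 4 p ⟨
      + (4 ℕ.* p)                                                  ∎

  module _ {p : ℕ} (p>0 : 0 ℕ.< p) {f : Form} (p∣C : + p ∣ C f) where

    -- The discriminant depends on A and C only through AC, so the factor p may be moved from C to
    -- A. The new form takes the value p at (1, 0), and so does, at some vector, the principal form
    -- equivalent to it.
    representing : Form
    representing = form (+ p) (B f) (A f * _∣_.quotient p∣C)

    representing-discriminant : discriminant representing ≡ discriminant f
    representing-discriminant = trans
      (solve 4 (λ a b p q → discriminantᴾ p b (a :* q) := discriminantᴾ a b (q :* p)) refl (A f) (B f) (+ p) q)
      (cong (λ c → B f * B f - + 4 * A f * c) (sym (_∣_.equality p∣C)))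
      where q = _∣_.quotient p∣C

    discriminant-4⇒p%4≢3 : discriminant f ≡ - + 4 → p ℕ.% 4 ≢ 3
    discriminant-4⇒p%4≢3 d = represents (∼-sym (principal-4 {representing} (+<+ p>0) (trans representing-discriminant d)))
      where
      represents : form 1ℤ 0ℤ 1ℤ ∼ representing → p ℕ.% 4 ≢ 3
      represents (mk∼ M _ e) = sum-of-squares%4 p (α M) (γ M) (trans (cong A e)
        (solve 2 (λ x y → valueᴾ (con 1ℤ) (con 0ℤ) (con 1ℤ) x y := x :* x :+ y :* y) refl (α M) (γ M)))

    discriminant-3⇒p%3≢2 : discriminant f ≡ - + 3 → p ℕ.% 3 ≢ 2
    discriminant-3⇒p%3≢2 d = represents (∼-sym (principal-3 {representing} (+<+ p>0) (trans representing-discriminant d)))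
      where
      represents : form 1ℤ 1ℤ 1ℤ ∼ representing → p ℕ.% 3 ≢ 2
      represents (mk∼ M _ e) = norm-form%3 p (α M) (γ M) (trans (cong A e)
        (solve 2 (λ x y → valueᴾ (con 1ℤ) (con 1ℤ) (con 1ℤ) x y := x :* x :+ x :* y :+ y :* y) refl (α M) (γ M)))

  module _ {p : ℕ} (pr : Prime p) where

    ∣-square : ∀ {i} → + p ∣ i * i → + p ∣ i
    ∣-square {i} h = Sum.[ (λ h → h) , (λ h → h) ] (∣-euclid pr i i h)

    ∤-constant : ∀ {n} → 0 ℕ.< n → n ℕ.< p → ¬ (+ p ∣ + n)
    ∤-constant 0<n n<p h = ∤-small 0<n n<p (∣⇒∣ᵤ h)

    -- Modulo p the form f is x(Ax + By), with the roots x = 0 and Ax + By = 0. The second column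
    -- (β, δ) of M is a root too, because f(β, δ) is the last coefficient of g.
    upper-right-factor : ∀ {f g M} → g ≡ f ∘ᶠ M → + p ∣ C f → + p ∣ C g →
                         + p ∣ β M ⊎ + p ∣ A f * β M + B f * δ M
    upper-right-factor {form a b c} {M = matrix α β γ δ} refl p∣c p∣c′ = ∣-euclid pr β (a * β + b * δ)
      (∣m+n∣n⇒∣m (subst (+ p ∣_)
        (solve 5 (λ a b c β δ → valueᴾ a b c β δ := β :* (a :* β :+ b :* δ) :+ c :* (δ :* δ)) refl a b c β δ) p∣c′)
        (∣m⇒∣m*n (δ * δ) p∣c))

    -- An element of SL₂(ℤ) that permutes the two roots of f modulo p would exchange B and −B.
    upper-right-divisible : ∀ {f g M} → g ≡ f ∘ᶠ M → det M ≡ 1ℤ → + p ∣ C f → + p ∣ C g →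
                            + p ∣ B g - B f → ¬ (+ p ∣ + 2 * B f) → + p ∣ β M
    upper-right-divisible {f@(form a b c)} {g} {M@(matrix α β γ δ)} g≡ m p∣c p∣c′ p∣B-b ¬2b
      with upper-right-factor {f} {g} {M} g≡ p∣c p∣c′
    ... | inj₁ h = h
    ... | inj₂ h = contradiction (subst (+ p ∣_) eq (∣m∣n⇒∣m-n
      (∣m∣n⇒∣m+n (∣n⇒∣m*n (+ 2 * α) h) (∣n⇒∣m*n (+ 2 * (γ * δ)) p∣c)) p∣B-b)) ¬2b
      where
      eq : + 2 * α * (a * β + b * δ) + + 2 * (γ * δ) * c - (B g - b) ≡ + 2 * b
      eq = begin
        + 2 * α * (a * β + b * δ) + + 2 * (γ * δ) * c - (B g - b)
          ≡⟨ cong (λ e → + 2 * α * (a * β + b * δ) + + 2 * (γ * δ) * c - (e - b)) (cong B g≡) ⟩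
        + 2 * α * (a * β + b * δ) + + 2 * (γ * δ) * c - (polar f M - b)
          ≡⟨ solve 7 (λ a b c α β γ δ → con (+ 2) :* α :* (a :* β :+ b :* δ) :+ con (+ 2) :* (γ :* δ) :* c :- (polarᴾ a b c α β γ δ :- b)
               := b :* (α :* δ :- β :* γ) :+ b) refl a b c α β γ δ ⟩
        b * det M + b
          ≡⟨ trans (cong (λ e → b * e + b) m) (solve 1 (λ b → b :* con 1ℤ :+ b := con (+ 2) :* b) refl b) ⟩
        + 2 * b ∎
        where open ≡-Reasoning

    -- If p divided B as well as C, it would divide n. So the two roots modulo p are distinct.
    ∤-2B : ∀ {f n} → 2 ℕ.< p → 0 ℕ.< n → n ℕ.< p → discriminant f ≡ - + n → + p ∣ C f → ¬ (+ p ∣ + 2 * B f)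
    ∤-2B {f} {n} 2<p 0<n n<p d p∣C h with ∣-euclid pr (+ 2) (B f) h
    ... | inj₁ h₂ = ∤-constant (s≤s z≤n) 2<p h₂
    ... | inj₂ h₂ = ∤-constant 0<n n<p (subst (+ p ∣_) (trans (cong -_ d) (neg-involutive (+ n)))
      (∣m⇒∣-m (∣m∣n⇒∣m-n (∣m⇒∣m*n (B f) h₂) (∣n⇒∣m*n (+ 4 * A f) p∣C))))

    same-B-mod : ∀ {f g} → discriminant f ≡ discriminant g → + p ∣ C f → + p ∣ C g →
                 + p ∣ B g - B f ⊎ + p ∣ B g + B f
    same-B-mod {form a b c} {form a′ b′ c′} d p∣c p∣c′ = ∣-euclid pr (b′ - b) (b′ + b) (subst (+ p ∣_) eq
      (∣m∣n⇒∣m-n (∣n⇒∣m*n (+ 4 * a′) p∣c′) (∣n⇒∣m*n (+ 4 * a) p∣c)))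
      where
      eq : + 4 * a′ * c′ - + 4 * a * c ≡ (b′ - b) * (b′ + b)
      eq = begin
        + 4 * a′ * c′ - + 4 * a * c
          ≡⟨ solve 4 (λ u v x y → u :- v := (x :- (x :- u)) :- (y :- (y :- v))) refl (+ 4 * a′ * c′) (+ 4 * a * c) (b′ * b′) (b * b) ⟩
        (b′ * b′ - (b′ * b′ - + 4 * a′ * c′)) - (b * b - (b * b - + 4 * a * c))
          ≡⟨ cong (λ e → (b′ * b′ - (b′ * b′ - + 4 * a′ * c′)) - (b * b - e)) d ⟩
        (b′ * b′ - (b′ * b′ - + 4 * a′ * c′)) - (b * b - (b′ * b′ - + 4 * a′ * c′))
          ≡⟨ solve 3 (λ b b′ u → (b′ :* b′ :- (b′ :* b′ :- u)) :- (b :* b :- (b′ :* b′ :- u)) := (b′ :- b) :* (b′ :+ b)) refl b b′ (+ 4 * a′ * c′) ⟩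
        (b′ - b) * (b′ + b) ∎
        where open ≡-Reasoning

    -- The inverse is r^(p-2), where r is the residue of `a`. The auxiliary equation `n ≡ p` allows
    -- matching on the prime, which exposes this exponent.
    inverse-mod : ∀ a → ¬ (+ p ∣ a) → ∃[ i ] + p ∣ a * i - 1ℤ
    inverse-mod a p∤a = power p refl
      where
      instance _ = prime⇒nonZero pr
      r = a %ℕ p
      q = a /ℕ p
      a≡ : a ≡ + r + q * + p
      a≡ = a≡a%ℕn+[a/ℕn]*n a p
      0<r : 0 ℕ.< r
      0<r = ℕ.n≢0⇒n>0 λ r≡0 → p∤a (divides q (trans a≡ (trans (cong (λ r → + r + q * + p) r≡0) (+-identityˡ (q * + p)))))
      power : ∀ n → n ≡ p → ∃[ i ] + p ∣ a * i - 1ℤ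
      power zero          e = contradiction (sym e) (ℕ.≢-nonZero⁻¹ p)
      power (suc zero)    e = contradiction (ℕ.<-≤-trans (n%ℕd<d a p) (ℕ.≤-reflexive (sym e))) (ℕ.<⇒≱ (s≤s 0<r))
      power (suc (suc n)) e = (+ r) ^ n , subst (+ p ∣_)
        (trans (solve 4 (λ r q p i → (r :* i :- con 1ℤ) :+ q :* p :* i := (r :+ q :* p) :* i :- con 1ℤ) refl (+ r) q (+ p) ((+ r) ^ n))
          (cong (λ a → a * (+ r) ^ n - 1ℤ) (sym a≡)))
        (∣m∣n⇒∣m+n (subst (λ p′ → + p ∣ (+ r) ^ (p′ ℕ.∸ 1) - 1ℤ) (sym e) (fermat-unit pr r 0<r (n%ℕd<d a p)))
          (∣m⇒∣m*n ((+ r) ^ n) (∣n⇒∣m*n q ∣-refl)))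

    module _ (5≤p : 5 ℕ.≤ p) {f : Form} (d : discriminant f ≡ - (+ (4 ℕ.* p))) where

      private
        4p : + (4 ℕ.* p) ≡ + 4 * + p
        4p = pos-* 4 p
        p∣4p : + p ∣ + (4 ℕ.* p)
        p∣4p = subst (+ p ∣_) (sym 4p) (∣n⇒∣m*n (+ 4) ∣-refl)
        b²≡ : B f * B f ≡ + 4 * A f * C f - + (4 ℕ.* p)
        b²≡ = trans (solve 2 (λ u v → u := v :+ (u :- v)) refl (B f * B f) (+ 4 * A f * C f)) (cong (_+_ (+ 4 * A f * C f)) d)

      p∣B : + p ∣ C f → + p ∣ B f
      p∣B p∣C = ∣-square (subst (+ p ∣_) (sym b²≡) (∣m∣n⇒∣m-n (∣n⇒∣m*n (+ 4 * A f) p∣C) p∣4p))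

      -- Otherwise p would divide all three coefficients, and p² would divide 4p.
      p∤A : + p ∣ C f → ¬ (+ p ∣ A f)
      p∤A p∣C p∣A = ∤-constant (s≤s z≤n) 5≤p
        (divides (+ 4 * a * c - b * b) (*-cancelʳ-≡ (+ 4) ((+ 4 * a * c - b * b) * + p) (+ p) {{prime⇒nonZero pr}} (begin
          + 4 * + p                                       ≡⟨ trans (sym 4p) (sym (trans (cong -_ d) (neg-involutive (+ (4 ℕ.* p))))) ⟩
          - (B f * B f - + 4 * A f * C f)
            ≡⟨ cong₂ (λ u v → - (u * u - v)) (_∣_.equality (p∣B p∣C)) (cong₂ (λ u v → + 4 * u * v) (_∣_.equality p∣A) (_∣_.equality p∣C)) ⟩
          - (b * + p * (b * + p) - + 4 * (a * + p) * (c * + p))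
            ≡⟨ solve 4 (λ a b c p → :- (b :* p :* (b :* p) :- con (+ 4) :* (a :* p) :* (c :* p)) := (con (+ 4) :* a :* c :- b :* b) :* p :* p) refl a b c (+ p) ⟩
          (+ 4 * a * c - b * b) * + p * + p ∎)))
        where
        open ≡-Reasoning
        a = _∣_.quotient p∣A
        b = _∣_.quotient (p∣B p∣C)
        c = _∣_.quotient p∣C

      -- As p ∣ B, the second factor of `upper-right-factor` is Aβ modulo p: the two roots coincide,
      -- and either alternative gives p ∣ β.
      upper-right-divisible′ : ∀ {g M} → g ≡ f ∘ᶠ M → + p ∣ C f → + p ∣ C g → + p ∣ β M
      upper-right-divisible′ {g} {M} g≡ p∣C p∣C′ = Sum.[ (λ h → h) , from-factor ] (upper-right-factor {f} {g} {M} g≡ p∣C p∣C′)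
        where
        from-factor : + p ∣ A f * β M + B f * δ M → + p ∣ β M
        from-factor h = Sum.[ (λ p∣A → contradiction p∣A (p∤A p∣C)) , (λ h → h) ]
          (∣-euclid pr (A f) (β M) (∣m+n∣n⇒∣m h (∣m⇒∣m*n (δ M) (p∣B p∣C))))

      -- Modulo p the form is A(x + (B/2A) y)², and i is the inverse of 2A.
      translated-root : ¬ (+ p ∣ A f) → ∀ i → + p ∣ + 2 * A f * i - 1ℤ → + p ∣ value f (- (B f * i)) 1ℤ
      translated-root p∤A i h = Sum.[ (λ h → ⊥-elim (Sum.[ ∤-constant (s≤s z≤n) 5≤p , p∤A ] (∣-euclid pr (+ 4) (A f) h))) , (λ h → h) ]
        (∣-euclid pr (+ 4 * A f) (value f k 1ℤ) (subst (+ p ∣_)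
          (trans (cong (λ d → b′ * b′ + d) (trans (sym (neg-involutive (+ (4 ℕ.* p)))) (cong -_ (sym d))))
            (solve 4 (λ a b c k → (b :+ con (+ 2) :* a :* k) :* (b :+ con (+ 2) :* a :* k) :+ (:- discriminantᴾ a b c) := con (+ 4) :* a :* valueᴾ a b c k (con 1ℤ)) refl (A f) (B f) (C f) k))
          (∣m∣n⇒∣m+n (∣m⇒∣m*n b′ p∣b′) p∣4p)))
        where
        k = - (B f * i)
        b′ = B f + + 2 * A f * k
        p∣b′ : + p ∣ b′
        p∣b′ = subst (+ p ∣_) (solve 3 (λ a b i → (:- b) :* (con (+ 2) :* a :* i :- con 1ℤ) := b :+ con (+ 2) :* a :* (:- (b :* i))) refl (A f) (B f) i)
          (∣n⇒∣m*n (- B f) h)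

      -- If p ∣ A, the double root modulo p is (1, 0) and the inversion moves it to (0, 1).
      -- Otherwise a translation by -B/2A modulo p does so.
      move-root : 0ℤ < A f → ∃[ g ] f ∼ g × 0ℤ < A g × + p ∣ C g
      move-root f>0 = by-cases (+ p ∣? A f)
        where
        d<0 : discriminant f < 0ℤ
        d<0 = subst (_< 0ℤ) (sym d) (neg-mono-< (+<+ (ℕ.<-≤-trans (s≤s z≤n) (ℕ.≤-trans 5≤p (ℕ.m≤n*m p 4)))))
        p∤2A : ¬ (+ p ∣ A f) → ¬ (+ p ∣ + 2 * A f)
        p∤2A p∤A h = Sum.[ ∤-constant (s≤s z≤n) (ℕ.≤-trans (s≤s (s≤s (s≤s z≤n))) 5≤p) , p∤A ] (∣-euclid pr (+ 2) (A f) h)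
        translate : ¬ (+ p ∣ A f) → ∃[ i ] + p ∣ + 2 * A f * i - 1ℤ → ∃[ g ] f ∼ g × 0ℤ < A g × + p ∣ C g
        translate p∤A (i , h) = _ , ∼-translation f (- (B f * i)) , f>0 , translated-root p∤A i h
        by-cases : Dec (+ p ∣ A f) → ∃[ g ] f ∼ g × 0ℤ < A g × + p ∣ C g
        by-cases (yes p∣A) = form (C f) (- B f) (A f) , ∼-inversion f , C>0 {f} f>0 d<0 , p∣A
        by-cases (no  p∤A) = translate p∤A (inverse-mod (+ 2 * A f) (p∤2A p∤A))

-- Signs and traces of fixed forms, and points with a given form.

module RootConstructions where

  open import Data.Integer.Base as ℤ using (ℤ; +_; 0ℤ)
  open import Data.Integer.Divisibility.Signed using (_∣_; ∣m⇒∣-m)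
  import Data.Integer.Properties as ℤ
  open import Data.Integer.Solver using (module +-*-Solver)
  open import Data.Nat.Base as ℕ using (ℕ; suc; z≤n; s≤s)
  import Data.Nat.Properties as ℕ
  open import Data.Product.Base using (∃-syntax; _×_; _,_)
  open import Data.Sum.Base as Sum using (_⊎_; inj₁; inj₂)
  open import Defs hiding (a; b; c; d; det; scaled)
  open import Relation.Binary.Bundles using (Setoid)
  open import Relation.Binary.Definitions using (tri<; tri≈; tri>)
  open import Relation.Binary.PropositionalEquality as ≡ using (_≡_; refl; cong; subst)
  import Relation.Binary.Reasoning.Setoid as SetoidReasoning
  open import Relation.Nullary using (contradiction)
  open BinaryForms
  open RealArithmetic
  open FormRoots
  open RootCoordinates
  open MatrixAction
  open FormsModPrime
  private
    module R = ℝ-Solver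
    module C = ℂ-Solver
  open +-*-Solver using (solve; con; _:+_; _:*_; _:-_; :-_; _:=_)
  open Setoid ℂ-setoid using () renaming (refl to ≈ᶜ-refl; trans to ≈ᶜ-trans)

  opposite : Form → Form
  opposite (form a b c) = form (ℤ.- a) (ℤ.- b) (ℤ.- c)

  discriminant-opposite : ∀ f → discriminant (opposite f) ≡ discriminant f
  discriminant-opposite (form a b c) = solve 3 (λ a b c → discriminantᴾ (:- a) (:- b) (:- c) := discriminantᴾ a b c) refl a b c

  root-opposite : ∀ {f w} → Root f w → Root (opposite f) w
  root-opposite {form a b c} {w} (mkRoot r) = mkRoot (≈ᶜ-trans
    (quadratic-cong w (ι-neg a) (ι-neg b) (ι-neg c)) (≈ᶜ-trans
    (C.solve 4 (λ a b c w → (C.:- a) C.:* (w C.:* w) C.:+ (C.:- b) C.:* w C.:+ (C.:- c) C.:= C.:- (a C.:* (w C.:* w) C.:+ b C.:* w C.:+ c)) ≈ᶜ-refl (ι a) (ι b) (ι c) w) (≈ᶜ-trans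
    (-ᶜ-cong r) (C.solve 0 (C.:- C.con (+ 0) C.:= C.con (+ 0)) ≈ᶜ-refl))))

  discriminant-nonPositive : ∀ {f w} → Root f w → 0ᴿ < im w → 0ℤ ℤ.≤ ℤ.- discriminant f
  discriminant-nonPositive {f} r y>0 = square-nonNegative (height (root⇒coordinates r y>0))

  A≡0⇒discriminant≡0 : ∀ {f w} → Root f w → 0ᴿ < im w → A f ≡ 0ℤ → ℤ.- discriminant f ≡ 0ℤ
  A≡0⇒discriminant≡0 {form _ b c} {w} r y>0 refl = fromℤ-injective (≈-trans (≈-sym (height (root⇒coordinates r y>0)))
    (R.solve 1 (λ y → (R.con (+ 2) R.:* R.con (+ 0) R.:* y) R.:* (R.con (+ 2) R.:* R.con (+ 0) R.:* y) R.:= R.con (+ 0)) ≈-refl (im w)))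

  -- The height equation (2Ay)² = 0 with y > 0 forces A = 0, and B and C follow. This settles trace
  -- ±2: only ±I can then fix a point of the half plane.
  discriminant≡0⇒zero : ∀ {f w} → Root f w → 0ᴿ < im w → discriminant f ≡ 0ℤ → A f ≡ 0ℤ × B f ≡ 0ℤ × C f ≡ 0ℤ
  discriminant≡0⇒zero {f@(form a b c)} {w} r y>0 d = A≡0 , fromℤ-injective B≈0 , fromℤ-injective C≈0
    where
    x = re w
    y = im w
    co = root⇒coordinates r y>0
    open SetoidReasoning ℝ-setoid
    4A²≈0 : fromℤ (+ 4 ℤ.* (a ℤ.* a)) ≈ 0ᴿ
    4A²≈0 = *-cancel-0 (*-pos y>0 y>0) (begin
      y * y * fromℤ (+ 4 ℤ.* (a ℤ.* a))                          ≈⟨ *-cong (≈-refl {y * y}) (≈-trans (fromℤ-* (+ 4) (a ℤ.* a)) (*-cong (≈-refl {fromℤ (+ 4)}) (fromℤ-* a a))) ⟩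
      y * y * (fromℤ (+ 4) * (fromℤ a * fromℤ a))               ≈⟨ R.solve 2 (λ a y → y R.:* y R.:* (R.con (+ 4) R.:* (a R.:* a)) R.:= (R.con (+ 2) R.:* a R.:* y) R.:* (R.con (+ 2) R.:* a R.:* y)) ≈-refl (fromℤ a) y ⟩
      (twiceA f * y) * (twiceA f * y)                           ≈⟨ height co ⟩
      fromℤ (ℤ.- discriminant f)                                ≈⟨ Setoid.reflexive ℝ-setoid (cong (λ d → fromℤ (ℤ.- d)) d) ⟩
      0ᴿ                                                        ∎)
    A≡0 : a ≡ 0ℤ
    A≡0 = Sum.[ (λ ()) , (λ e → Sum.[ (λ e → e) , (λ e → e) ] (ℤ.i*j≡0⇒i≡0∨j≡0 a e)) ] (ℤ.i*j≡0⇒i≡0∨j≡0 (+ 4) (fromℤ-injective 4A²≈0))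
    B≈0 : fromℤ b ≈ 0ᴿ
    B≈0 = begin
      fromℤ b                                        ≈⟨ R.solve 2 (λ x b → b R.:= R.con (+ 2) R.:* R.con (+ 0) R.:* x R.:+ b) ≈-refl x (fromℤ b) ⟩
      fromℤ (+ 2) * fromℤ 0ℤ * x + fromℤ b           ≈⟨ Setoid.reflexive ℝ-setoid (cong (λ a → fromℤ (+ 2) * fromℤ a * x + fromℤ b) (≡.sym A≡0)) ⟩
      twiceA f * x + fromℤ b                         ≈⟨ vertex co ⟩
      0ᴿ                                             ∎
    C≈0 : fromℤ c ≈ 0ᴿ
    C≈0 = begin
      fromℤ c
        ≈⟨ R.solve 3 (λ c x y → c R.:= (R.con (+ 0) R.:* (x R.:* x R.:- y R.:* y) R.:- R.con (+ 0) R.:* (x R.:* y R.:+ y R.:* x)) R.:+ (R.con (+ 0) R.:* x R.:- R.con (+ 0) R.:* y) R.:+ c) ≈-refl (fromℤ c) x y ⟩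
      re (quadratic (ι 0ℤ) (ι 0ℤ) (ι c) w)           ≈⟨ _≈ᶜ_.re-≈ (quadratic-cong w (fromℝ-cong (Setoid.reflexive ℝ-setoid (cong fromℤ A≡0))) (fromℝ-cong B≈0) (≈ᶜ-refl {ι c})) ⟨
      re (quadratic (ι a) (ι b) (ι c) w)             ≈⟨ _≈ᶜ_.re-≈ (equation r) ⟩
      0ᴿ                                             ∎

  -- A fixed form may have a negative leading coefficient, and then all its signs are changed. The
  -- last component keeps the divisibility of C by p.
  positive-root : ∀ {f w} → Root f w → 0ᴿ < im w → discriminant f ℤ.< 0ℤ →
                  ∃[ g ] 0ℤ ℤ.< A g × Root g w × discriminant g ≡ discriminant f × (∀ {k} → k ∣ C f → k ∣ C g)
  positive-root {f@(form a b c)} {w} r y>0 d<0 = by-sign (ℤ.<-cmp a 0ℤ)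
    where
    by-sign : _ → ∃[ g ] 0ℤ ℤ.< A g × Root g w × discriminant g ≡ discriminant f × (∀ {k} → k ∣ C f → k ∣ C g)
    by-sign (tri> _ _ a>0) = f , a>0 , r , refl , λ h → h
    by-sign (tri< a<0 _ _) = opposite f , ℤ.neg-mono-< a<0 , root-opposite r , discriminant-opposite f , ∣m⇒∣-m
    by-sign (tri≈ _ a≡0 _) = contradiction (≡.sym (A≡0⇒discriminant≡0 r y>0 a≡0)) (ℤ.<⇒≢ (ℤ.neg-mono-< d<0))

  discriminant-fixedForm : ∀ M → discriminant (fixedForm M) ≡ (α M ℤ.+ δ M) ℤ.* (α M ℤ.+ δ M) ℤ.- + 4 ℤ.* det M
  discriminant-fixedForm (matrix α β γ δ) = solve 4 (λ α β γ δ →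
    discriminantᴾ γ (δ :- α) (:- β) := (α :+ δ) :* (α :+ δ) :- con (+ 4) :* (α :* δ :- β :* γ)) refl α β γ δ

  trace-cases : ∀ t → 0ℤ ℤ.≤ ℤ.- (t ℤ.* t ℤ.- + 4) → t ℤ.* t ≡ + 0 ⊎ t ℤ.* t ≡ + 1 ⊎ t ℤ.* t ≡ + 4
  trace-cases t h = by-size ℤ.∣ t ∣ refl
    where
    t²≤4 : ℤ.∣ t ∣ ℕ.* ℤ.∣ t ∣ ℕ.≤ 4
    t²≤4 = ℤ.drop‿+≤+ (subst (ℤ._≤ + 4) (abs² t) (ℤ.0≤i-j⇒j≤i (subst (0ℤ ℤ.≤_) (solve 1 (λ u → :- (u :- con (+ 4)) := con (+ 4) :- u) refl (t ℤ.* t)) h)))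
    square : ∀ {m} → ℤ.∣ t ∣ ≡ m → t ℤ.* t ≡ + (m ℕ.* m)
    square e = ≡.trans (abs² t) (cong (λ m → + (m ℕ.* m)) e)
    by-size : ∀ m → ℤ.∣ t ∣ ≡ m → t ℤ.* t ≡ + 0 ⊎ t ℤ.* t ≡ + 1 ⊎ t ℤ.* t ≡ + 4
    by-size 0 e = inj₁ (square e)
    by-size 1 e = inj₂ (inj₁ (square e))
    by-size 2 e = inj₂ (inj₂ (square e))
    by-size (suc (suc (suc m))) e = contradiction
      (ℕ.≤-trans (ℕ.*-mono-≤ 3≤ 3≤) t²≤4) λ { (s≤s (s≤s (s≤s (s≤s ())))) }
      where
      3≤ : 3 ℕ.≤ ℤ.∣ t ∣
      3≤ = subst (3 ℕ.≤_) (≡.sym e) (s≤s (s≤s (s≤s z≤n)))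

  module _ {p : ℕ} (p>0 : 0 ℕ.< p) where
    open Scaled p>0

    point-over : ∀ {f n} → 0ℤ ℤ.< A f → discriminant f ≡ ℤ.- + n → 0 ℕ.< n → ∃[ z ] Root f (scaled z)
    point-over {f@(form _ b _)} {n} f>0 d n>0 = z , coordinates⇒root f>0 (coordinates v h)
      where
      k = twiceA f * √ p
      k>0 = *-pos (twiceA-pos {f} f>0) (√-pos p>0)
      i = inv k k>0
      -- The quadratic formula √p z = (-B + √(-n)) / 2A, divided by √p; `i` is the inverse of 2A√p.
      z : ℍ
      re (point z) = - (fromℤ b * i)
      im (point z) = √ n * i
      im>0 z = *-pos (√-pos n>0) (inv-pos k k>0)
      x = re (point z)
      y = im (point z)
      open SetoidReasoning ℝ-setoid
      v : twiceA f * (√ p * x - 0ᴿ * y) + fromℤ b ≈ 0ᴿ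
      v = begin
        twiceA f * (√ p * x - 0ᴿ * y) + fromℤ b
          ≈⟨ R.solve 5 (λ a s b i y → a R.:* (s R.:* (R.:- (b R.:* i)) R.:- R.con (+ 0) R.:* y) R.:+ b R.:= R.:- (b R.:* (i R.:* (a R.:* s))) R.:+ b) ≈-refl (twiceA f) (√ p) (fromℤ b) i y ⟩
        - (fromℤ b * (i * k)) + fromℤ b    ≈⟨ +-cong (-‿cong (*-cong (≈-refl {fromℤ b}) (inv-inverse k k>0))) (≈-refl {fromℤ b}) ⟩
        - (fromℤ b * 1ᴿ) + fromℤ b         ≈⟨ R.solve 1 (λ b → R.:- (b R.:* R.con (+ 1)) R.:+ b R.:= R.con (+ 0)) ≈-refl (fromℤ b) ⟩
        0ᴿ ∎
      h : (twiceA f * (√ p * y + 0ᴿ * x)) * (twiceA f * (√ p * y + 0ᴿ * x)) ≈ fromℤ (ℤ.- discriminant f)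
      h = begin
        (twiceA f * (√ p * y + 0ᴿ * x)) * (twiceA f * (√ p * y + 0ᴿ * x))
          ≈⟨ R.solve 5 (λ a s r i x →
               (a R.:* (s R.:* (r R.:* i) R.:+ R.con (+ 0) R.:* x)) R.:* (a R.:* (s R.:* (r R.:* i) R.:+ R.con (+ 0) R.:* x))
               R.:= (r R.:* r) R.:* ((i R.:* (a R.:* s)) R.:* (i R.:* (a R.:* s)))) ≈-refl (twiceA f) (√ p) (√ n) i x ⟩
        √ n * √ n * ((i * k) * (i * k))    ≈⟨ *-cong (√-square n) (*-cong (inv-inverse k k>0) (inv-inverse k k>0)) ⟩
        fromℤ (+ n) * (1ᴿ * 1ᴿ)            ≈⟨ R.solve 1 (λ n → n R.:* (R.con (+ 1) R.:* R.con (+ 1)) R.:= n) ≈-refl (fromℤ (+ n)) ⟩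
        fromℤ (+ n)                        ≈⟨ Setoid.reflexive ℝ-setoid (cong fromℤ (≡.sym (≡.trans (cong ℤ.-_ d) (ℤ.neg-involutive (+ n))))) ⟩
        fromℤ (ℤ.- discriminant f)         ∎

-- Points of the half plane together with their forms.

module MarkedPoints where

  open import Data.Integer.Base as ℤ using (ℤ; +_; 0ℤ; 1ℤ)
  open import Data.Integer.Divisibility.Signed using (_∣_; divides)
  import Data.Integer.Properties as ℤ
  open import Data.Integer.Solver using (module +-*-Solver)
  open import Data.Nat.Base as ℕ using (ℕ)
  import Data.Nat.Properties as ℕ
  import Data.Nat.Divisibility as ℕ
  open import Data.Product.Base using (∃-syntax; _×_; _,_)
  open import Data.Sum.Base as Sum using (inj₁; inj₂)
  open import Defs hiding (a; b; c; d; det; scaled; root)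
  open import Relation.Binary.Bundles using (Setoid)
  open import Relation.Binary.PropositionalEquality as ≡ using (_≡_; _≢_; refl; cong; subst)
  open import Relation.Nullary using (contradiction)
  open BinaryForms
  open FormRoots
  open RootCoordinates
  open MatrixAction
  open FormsModPrime
  open +-*-Solver using (solve; con; _:+_; _:*_; _:-_; :-_; _:=_)
  open Setoid ℂ-setoid using () renaming (refl to ≈ᶜ-refl)

  -- `N` is kept apart from `adjugate M` because the matrix of an inverse has the entry (-b)p, which
  -- is only propositionally equal to -(bp).
  root-∘-adjugate : ∀ {f M N w} → det M ≡ 1ℤ → N ≡ adjugate M → Root (f ∘ᶠ M ∘ᶠ N) w → Root f w
  root-∘-adjugate {f} {M} {w = w} m refl = subst (λ g → Root g w) (∘-adjugate f M m)

  module Equivalence {p : ℕ} (p>0 : 0 ℕ.< p) where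
    open Scaled p>0

    -- The integral data attached to an elliptic point: n is 4p for elements of R⁻, and 4 or 3 for
    -- elements of R⁺. The divisibility of C reflects the upper right entries, which are multiples
    -- of p.
    record Marked (n : ℕ) (z : ℍ) : Set where
      field
        {markedForm}  : Form
        positive      : 0ℤ ℤ.< A markedForm
        hasDiscriminant : discriminant markedForm ≡ ℤ.- + n
        p∣C           : + p ∣ C markedForm
        root          : Root markedForm (scaled z)

    open Marked public

    inverse⁺ : ∀ {γ} → R⁺ p γ → R⁺ p (γ ⁻¹)
    inverse⁺ (mkR⁺ a b c d) = mkR⁺ d (root-neg b) (root-neg c) a

    matrix⁺-inverse : ∀ {γ} (r : R⁺ p γ) → matrix⁺ (inverse⁺ r) ≡ adjugate (matrix⁺ r)
    matrix⁺-inverse (mkR⁺ (a , _) (b , _) (c , _) (d , _)) = cong (λ β → matrix d β (ℤ.- c) a) (≡.sym (ℤ.neg-distribˡ-* b (+ p)))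

    product⁻⁻ : ∀ {γ δ} → R⁻ p γ → R⁻ p δ → R⁺ p (γ ∙ δ)
    product⁻⁻ (mkR⁻ a b c d) (mkR⁻ a′ b′ c′ d′) = mkR⁺
      (int-+ (root-*-root a a′) (int-* b c′)) (root-+ (root-*-int a b′) (int-*-root b d′))
      (root-+ (int-*-root c a′) (root-*-int d c′)) (int-+ (int-* c b′) (root-*-root d d′))

    pullback⁺ : ∀ {γ} (r : R⁺ p γ) {f z v} → γ • z ≈ᴴ v → Root f (scaled v) → Root (f ∘ᶠ matrix⁺ r) (scaled z)
    pullback⁺ r {z = z} {v} e = root-pullback (action⇒moebius (represents⁺ r z) {v} e)

    pullback⁻ : ∀ {γ} (r : R⁻ p γ) {f z v} → γ • z ≈ᴴ v → Root f (scaled v) → Root (f ∘ᶠ matrix⁻ r) (scaled z)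
    pullback⁻ r {z = z} {v} e = root-pullback (action⇒moebius (represents⁻ r z) {v} e)

    -- The form at v, pulled back to z, has the same root and discriminant as the form at z, so
    -- `form-unique` identifies the two. Pullback reverses the direction of the equivalence.
    equivalent⇒∼ : ∀ {n γ z v} → 0 ℕ.< n → R⁺ p γ → γ • z ≈ᴴ v → (m : Marked n z) (m′ : Marked n v) →
                   markedForm m′ ∼ markedForm m
    equivalent⇒∼ {n} {γ} {z} {v} n>0 r e m m′ = mk∼ M (det⁺ r)
      (form-unique (root m) (pullback⁺ r {z = z} {v} e (root m′)) (scaled-im>0 z) (positive m) (∘-A>0 {markedForm m′} M (positive m′) d<0 (det⁺ r))
        (≡.trans (hasDiscriminant m) (≡.trans (≡.sym (hasDiscriminant m′)) (≡.sym (∼-discriminant {markedForm m′} (mk∼ M (det⁺ r) refl))))))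
      where
      M = matrix⁺ r
      d<0 : discriminant (markedForm m′) ℤ.< 0ℤ
      d<0 = subst (ℤ._< 0ℤ) (≡.sym (hasDiscriminant m′)) (ℤ.neg-mono-< (ℤ.+<+ n>0))

    pushforward⁺ : ∀ {ε} (r : R⁺ p ε) {f z} → Root (f ∘ᶠ matrix⁺ r) (scaled z) → Root f (scaled (ε • z))
    pushforward⁺ {ε} r {f} {z} rg = root-∘-adjugate {f} {matrix⁺ r} {matrix⁺ (inverse⁺ r)} (det⁺ r) (matrix⁺-inverse r)
      (pullback⁺ (inverse⁺ r) {f ∘ᶠ matrix⁺ r} {ε • z} {z} (•-inverse ε z (ε • z) (≈ᶜ-refl {point (ε • z)})) rg)

    -- The condition p ∣ β is what makes M the matrix of an element of R⁺. That element moves z to a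
    -- root of f in the half plane, and there is only one.
    ∼⇒equivalent : ∀ {f g z v} M → det M ≡ 1ℤ → g ≡ f ∘ᶠ M → + p ∣ β M → 0ℤ ℤ.< A f →
                   Root g (scaled z) → Root f (scaled v) → z ∼[ p ] v
    ∼⇒equivalent {f} {z = z} {v} (matrix α _ γ δ) m refl (divides q refl) f>0 rg rf =
      ε , inj₁ ε∈R⁺ , scaled-injective {ε • z} {v}
        (root-unique {f} {scaled (ε • z)} {scaled v} f>0 (pushforward⁺ ε∈R⁺ {f} {z} rg) rf (scaled-im>0 (ε • z)) (scaled-im>0 v))
      where
      ε = element⁺ α q γ δ m
      ε∈R⁺ : R⁺ p ε
      ε∈R⁺ = element⁺∈R⁺ α q γ δ m

    -- Pulling the form back from v to z multiplies its discriminant by det², and two forms with a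
    -- common root have discriminants in the ratio of the squares of their leading coefficients.
    discriminant-ratio : ∀ {n n′ z v} → z ∼[ p ] v → Marked n z → Marked n′ v →
                         ∃[ a ] ∃[ b ] a ≢ 0 × n′ ℕ.* (a ℕ.* a) ≡ n ℕ.* (b ℕ.* b)
    discriminant-ratio {n} {n′} {z} {v} (γ , γ∈R , e) m m′ = from γ∈R
      where
      f = markedForm m
      f′ = markedForm m′
      ratio : ∀ M → det M ≢ 0ℤ → Root (f′ ∘ᶠ M) (scaled z) → ∃[ a ] ∃[ b ] a ≢ 0 × n′ ℕ.* (a ℕ.* a) ≡ n ℕ.* (b ℕ.* b)
      ratio M m≢0 r = ℤ.∣ A f ℤ.* det M ∣ , ℤ.∣ A g ∣ , a≢0 , ℤ.+-injective (≡.trans (lift n′ (A f ℤ.* det M)) (≡.trans eq (≡.sym (lift n (A g)))))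
        where
        g = f′ ∘ᶠ M
        a≢0 : ℤ.∣ A f ℤ.* det M ∣ ≢ 0
        a≢0 h = Sum.[ (λ e → ℤ.<⇒≢ (positive m) (≡.sym e)) , m≢0 ] (ℤ.i*j≡0⇒i≡0∨j≡0 (A f) (ℤ.∣i∣≡0⇒i≡0 h))
        lift : ∀ k i → + (k ℕ.* (ℤ.∣ i ∣ ℕ.* ℤ.∣ i ∣)) ≡ + k ℤ.* (i ℤ.* i)
        lift k i = ≡.trans (ℤ.pos-* k (ℤ.∣ i ∣ ℕ.* ℤ.∣ i ∣)) (cong (+ k ℤ.*_) (≡.sym (abs² i)))
        -d : ∀ {h k} → discriminant h ≡ ℤ.- + k → ℤ.- discriminant h ≡ + k
        -d {k = k} d = ≡.trans (cong ℤ.-_ d) (ℤ.neg-involutive (+ k))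
        eq : + n′ ℤ.* ((A f ℤ.* det M) ℤ.* (A f ℤ.* det M)) ≡ + n ℤ.* (A g ℤ.* A g)
        eq = begin
          + n′ ℤ.* ((A f ℤ.* det M) ℤ.* (A f ℤ.* det M))
            ≡⟨ solve 3 (λ n a m → n :* ((a :* m) :* (a :* m)) := a :* a :* (:- (m :* m :* (:- n)))) refl (+ n′) (A f) (det M) ⟩
          A f ℤ.* A f ℤ.* ℤ.- (det M ℤ.* det M ℤ.* ℤ.- + n′)
            ≡⟨ cong (λ d → A f ℤ.* A f ℤ.* ℤ.- d) (≡.sym (≡.trans (discriminant-∘ f′ M) (cong (det M ℤ.* det M ℤ.*_) (hasDiscriminant m′)))) ⟩
          A f ℤ.* A f ℤ.* ℤ.- discriminant g
            ≡⟨ root-discriminants (root m) r (scaled-im>0 z) ⟨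
          A g ℤ.* A g ℤ.* ℤ.- discriminant f
            ≡⟨ cong (A g ℤ.* A g ℤ.*_) (-d {f} (hasDiscriminant m)) ⟩
          A g ℤ.* A g ℤ.* + n
            ≡⟨ ℤ.*-comm (A g ℤ.* A g) (+ n) ⟩
          + n ℤ.* (A g ℤ.* A g) ∎
          where open ≡.≡-Reasoning
      from : R[ p ] γ → ∃[ a ] ∃[ b ] a ≢ 0 × n′ ℕ.* (a ℕ.* a) ≡ n ℕ.* (b ℕ.* b)
      from (inj₁ r) = ratio (matrix⁺ r) (λ h → contradiction (≡.trans (≡.sym (det⁺ r)) h) λ ()) (pullback⁺ r {z = z} {v} e (root m′))
      from (inj₂ r) = ratio (matrix⁻ r) (λ h → ℕ.<⇒≢ p>0 (≡.sym (ℤ.+-injective (≡.trans (≡.sym (det⁻ r)) h)))) (pullback⁻ r {z = z} {v} e (root m′))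

-- Elliptic elements and the discriminants they produce.

module EllipticElements where

  open import Data.Integer.Base as ℤ using (ℤ; +_; 0ℤ; 1ℤ; -1ℤ)
  open import Data.Integer.Divisibility.Signed using (_∣_; divides; ∣-refl; ∣n⇒∣m*n; ∣m⇒∣-m; ∣⇒∣ᵤ)
  import Data.Integer.Properties as ℤ
  open import Data.Integer.Solver using (module +-*-Solver)
  open import Data.Nat.Base as ℕ using (ℕ; z≤n; s≤s)
  import Data.Nat.Properties as ℕ
  import Data.Nat.Divisibility as ℕ
  open import Data.Nat.Primality using (Prime; prime[2]; prime⇒irreducible; prime⇒nonZero)
  open import Data.Product.Base using (∃-syntax; _×_; _,_)
  open import Data.Sum.Base as Sum using (_⊎_; inj₁; inj₂)
  open import Defs hiding (a; b; c; d; det; scaled; root)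
  open import Relation.Binary.Bundles using (Setoid)
  open import Relation.Binary.PropositionalEquality as ≡ using (_≡_; refl; cong; cong₂; subst)
  open import Relation.Nullary using (¬_; Dec; yes; no; contradiction)
  open PrimeModulus
  open BinaryForms
  open RealArithmetic
  open FormRoots
  open MatrixAction
  open FormsModPrime
  open RootConstructions
  open MarkedPoints
  private
    module C = ℂ-Solver
  open +-*-Solver using (solve; con; _:+_; _:*_; _:-_; :-_; _:=_)
  open Setoid ℂ-setoid using () renaming (refl to ≈ᶜ-refl; sym to ≈ᶜ-sym; trans to ≈ᶜ-trans)

  scale : ℤ → Form → Form
  scale k (form a b c) = form (k ℤ.* a) (k ℤ.* b) (k ℤ.* c)

  root-unscale : ∀ {k f w} → 0ℤ ℤ.< k → Root (scale k f) w → Root f w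
  root-unscale {k} {form a b c} {w} k>0 (mkRoot r) = mkRoot (fromℝ-cancelˡ (fromℤ-pos k>0) (≈ᶜ-trans
    (C.solve 5 (λ k a b c w → k C.:* (a C.:* (w C.:* w) C.:+ b C.:* w C.:+ c) C.:= (k C.:* a) C.:* (w C.:* w) C.:+ (k C.:* b) C.:* w C.:+ k C.:* c)
      ≈ᶜ-refl (ι k) (ι a) (ι b) (ι c) w) (≈ᶜ-trans
    (quadratic-cong w (≈ᶜ-sym (ι-* k a)) (≈ᶜ-sym (ι-* k b)) (≈ᶜ-sym (ι-* k c))) (≈ᶜ-trans r
    (C.solve 1 (λ k → C.con (+ 0) C.:= k C.:* C.con (+ 0)) ≈ᶜ-refl (ι k))))))

  n<0 : ∀ {d n} → 0 ℕ.< n → d ≡ ℤ.- + n → d ℤ.< 0ℤ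
  n<0 n>0 refl = ℤ.neg-mono-< (ℤ.+<+ n>0)

  module Fixed {p : ℕ} (pr : Prime p) (5≤p : 5 ℕ.≤ p) where

    p>0 : 0 ℕ.< p
    p>0 = ℕ.≤-trans (s≤s z≤n) 5≤p

    open Scaled p>0 public
    open Equivalence p>0 public

    4p>0 : 0 ℕ.< 4 ℕ.* p
    4p>0 = ℕ.<-≤-trans p>0 (ℕ.m≤n*m p 4)

    -- For s ≠ 0 one has (sp)² ≥ p² ≥ 5p > 4p.
    trace⁻≡0 : ∀ s → 0ℤ ℤ.≤ ℤ.- ((s ℤ.* + p) ℤ.* (s ℤ.* + p) ℤ.- + 4 ℤ.* + p) → s ≡ 0ℤ
    trace⁻≡0 s h = by-dec (s ℤ.≟ 0ℤ)
      where
      P = + p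
      by-dec : Dec (s ≡ 0ℤ) → s ≡ 0ℤ
      by-dec (yes e)   = e
      by-dec (no s≢0) = contradiction refl (ℤ.<⇒≢ (subst (0ℤ ℤ.<_)
        (solve 2 (λ s p → :- ((s :* p) :* (s :* p) :- con (+ 4) :* p) :+ (p :* p :* (s :* s :- con 1ℤ) :+ p :* (p :- con (+ 5))) :+ p := con 0ℤ) refl s P)
        (ℤ.+-mono-≤-< (nonNeg-+ h (nonNeg-+ (nonNeg-* (square≥0 P) (pos⇒≥1 (square-pos s≢0)))
          (nonNeg-* {P} (ℤ.+≤+ z≤n) (ℤ.i≤j⇒0≤j-i (ℤ.+≤+ 5≤p))))) (ℤ.+<+ p>0))))

    marked⁻ : ∀ {γ z} → R⁻ p γ → γ • z ≈ᴴ z → Marked (4 ℕ.* p) z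
    marked⁻ {γ} {z} r@(mkR⁻ (a , _) (b , _) (c , _) (d , _)) e = mark (positive-root rf (scaled-im>0 z) (n<0 4p>0 disc))
      where
      M = matrix⁻ r
      f = fixedForm M
      rf : Root f (scaled z)
      rf = moebius-fixed {M} (action⇒moebius (represents⁻ r z) {z} e)
      disc′ : discriminant f ≡ ((a ℤ.+ d) ℤ.* + p) ℤ.* ((a ℤ.+ d) ℤ.* + p) ℤ.- + 4 ℤ.* + p
      disc′ = ≡.trans (discriminant-fixedForm M) (cong₂ (λ t m → t ℤ.* t ℤ.- + 4 ℤ.* m) (≡.sym (ℤ.*-distribʳ-+ (+ p) a d)) (det⁻ r))
      disc : discriminant f ≡ ℤ.- + (4 ℕ.* p)
      disc = ≡.trans disc′ (≡.trans
        (cong (λ s → (s ℤ.* + p) ℤ.* (s ℤ.* + p) ℤ.- + 4 ℤ.* + p)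
          (trace⁻≡0 (a ℤ.+ d) (subst (λ d → 0ℤ ℤ.≤ ℤ.- d) disc′ (discriminant-nonPositive rf (scaled-im>0 z)))))
        (≡.trans (ℤ.+-identityˡ (ℤ.- (+ 4 ℤ.* + p))) (cong ℤ.-_ (≡.sym (ℤ.pos-* 4 p)))))
      mark : ∃[ g ] 0ℤ ℤ.< A g × Root g (scaled z) × discriminant g ≡ discriminant f × (∀ {k} → k ∣ C f → k ∣ C g) → Marked (4 ℕ.* p) z
      mark (g , g>0 , rg , d≡ , ∣C) = record
        { positive = g>0 ; hasDiscriminant = ≡.trans d≡ disc ; p∣C = ∣C (∣m⇒∣-m (∣n⇒∣m*n b ∣-refl)) ; root = rg }

    module _ {a b c : ℤ} (disc : discriminant (form a b (c ℤ.* + p)) ≡ ℤ.- + (4 ℕ.* p)) where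

      -- The discriminant equation divided by p. As p is odd, t has to be even; its half u supplies
      -- the diagonal entries ∓u√p of an element of R⁻.
      half-quotient : ∀ t → b ≡ t ℤ.* + p → t ℤ.* t ℤ.* + p ≡ + 4 ℤ.* (a ℤ.* c ℤ.- 1ℤ)
      half-quotient t refl = ℤ.*-cancelʳ-≡ (t ℤ.* t ℤ.* + p) (+ 4 ℤ.* (a ℤ.* c ℤ.- 1ℤ)) (+ p) {{prime⇒nonZero pr}} (begin
        t ℤ.* t ℤ.* + p ℤ.* + p
          ≡⟨ solve 4 (λ t p a c → t :* t :* p :* p := discriminantᴾ a (t :* p) (c :* p) :+ con (+ 4) :* a :* (c :* p)) refl t (+ p) a c ⟩
        discriminant (form a b (c ℤ.* + p)) ℤ.+ + 4 ℤ.* a ℤ.* (c ℤ.* + p)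
          ≡⟨ cong (ℤ._+ + 4 ℤ.* a ℤ.* (c ℤ.* + p)) (≡.trans disc (cong ℤ.-_ (ℤ.pos-* 4 p))) ⟩
        ℤ.- (+ 4 ℤ.* + p) ℤ.+ + 4 ℤ.* a ℤ.* (c ℤ.* + p)
          ≡⟨ solve 3 (λ p a c → :- (con (+ 4) :* p) :+ con (+ 4) :* a :* (c :* p) := con (+ 4) :* (a :* c :- con 1ℤ) :* p) refl (+ p) a c ⟩
        + 4 ℤ.* (a ℤ.* c ℤ.- 1ℤ) ℤ.* + p ∎)
        where open ≡.≡-Reasoning

      quotient-even : ∀ t → b ≡ t ℤ.* + p → + 2 ∣ t
      quotient-even t b≡ = Sum.[ ∣-square prime[2] {t} , (λ h → contradiction h 2∤p) ] (∣-euclid prime[2] (t ℤ.* t) (+ p)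
        (divides (+ 2 ℤ.* (a ℤ.* c ℤ.- 1ℤ)) (≡.trans (half-quotient t b≡) (solve 2 (λ a c → con (+ 4) :* (a :* c :- con 1ℤ) := con (+ 2) :* (a :* c :- con 1ℤ) :* con (+ 2)) refl a c))))
        where
        2∤p : ¬ (+ 2 ∣ + p)
        2∤p h = small (prime⇒irreducible pr (∣⇒∣ᵤ {+ 2} {+ p} h))
          where
          small : ¬ (2 ≡ 1 ⊎ 2 ≡ p)
          small (inj₂ 2≡p) = ℕ.<⇒≢ (ℕ.<-≤-trans (s≤s (s≤s (s≤s z≤n))) 5≤p) 2≡p

      stabilizer-determinant : ∀ u → b ≡ u ℤ.* + 2 ℤ.* + p → (ℤ.- u) ℤ.* u ℤ.* + p ℤ.- (ℤ.- c) ℤ.* a ≡ 1ℤ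
      stabilizer-determinant u b≡ = ℤ.*-cancelˡ-≡ (+ 4) ((ℤ.- u) ℤ.* u ℤ.* + p ℤ.- (ℤ.- c) ℤ.* a) 1ℤ (begin
        + 4 ℤ.* ((ℤ.- u) ℤ.* u ℤ.* + p ℤ.- (ℤ.- c) ℤ.* a)
          ≡⟨ solve 4 (λ u p a c → con (+ 4) :* ((:- u) :* u :* p :- (:- c) :* a) := con (+ 4) :* (a :* c :- con 1ℤ) :+ con (+ 4) :- (u :* con (+ 2)) :* (u :* con (+ 2)) :* p) refl u (+ p) a c ⟩
        + 4 ℤ.* (a ℤ.* c ℤ.- 1ℤ) ℤ.+ + 4 ℤ.- (u ℤ.* + 2) ℤ.* (u ℤ.* + 2) ℤ.* + p
          ≡⟨ cong (λ e → e ℤ.+ + 4 ℤ.- (u ℤ.* + 2) ℤ.* (u ℤ.* + 2) ℤ.* + p) (≡.sym (half-quotient (u ℤ.* + 2) b≡)) ⟩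
        (u ℤ.* + 2) ℤ.* (u ℤ.* + 2) ℤ.* + p ℤ.+ + 4 ℤ.- (u ℤ.* + 2) ℤ.* (u ℤ.* + 2) ℤ.* + p
          ≡⟨ solve 2 (λ u p → (u :* con (+ 2)) :* (u :* con (+ 2)) :* p :+ con (+ 4) :- (u :* con (+ 2)) :* (u :* con (+ 2)) :* p := con (+ 4)) refl u (+ p) ⟩
        + 4 ℤ.* 1ℤ ∎)
        where open ≡.≡-Reasoning

    -- The element with rows (-u√p, -c) and (a, u√p) has trace 0, and its fixed form is
    -- [a, 2up, cp].
    stabilizer⁻-from : ∀ {f z} a b c u → (ℤ.- u) ℤ.* u ℤ.* + p ℤ.- (ℤ.- c) ℤ.* a ≡ 1ℤ → 0ℤ ℤ.< a →
      f ≡ form a b (c ℤ.* + p) → b ≡ u ℤ.* + 2 ℤ.* + p → Root f (scaled z) → StabilizedByElliptic (R⁻ p) z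
    stabilizer⁻-from {z = z} a b c u e a>0 refl refl rf = ε , ε∈R⁻ ,
      (λ (mk≈ᴹ _ _ c≈0 _) → a≉0 c≈0) , (λ (mk≈ᴹ _ _ c≈0 _) → a≉0 c≈0) ,
      moebius⇒action (represents⁻ ε∈R⁻ z) {z} (fixed-moebius {matrix⁻ ε∈R⁻} (subst (λ g → Root g (scaled z)) f≡ rf))
      where
      ε = element⁻ (ℤ.- u) (ℤ.- c) a u e
      ε∈R⁻ : R⁻ p ε
      ε∈R⁻ = element⁻∈R⁻ (ℤ.- u) (ℤ.- c) a u e
      a≉0 : ¬ (fromℤ a ≈ 0ᴿ)
      a≉0 = <-irrefl (fromℤ-pos a>0)
      f≡ : form a b (c ℤ.* + p) ≡ fixedForm (matrix⁻ ε∈R⁻)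
      f≡ = form-≡ refl
        (solve 2 (λ u p → u :* con (+ 2) :* p := u :* p :- (:- u) :* p) refl u (+ p))
        (solve 2 (λ c p → c :* p := :- ((:- c) :* p)) refl c (+ p))

    stabilizer⁻ : ∀ {z} → Marked (4 ℕ.* p) z → StabilizedByElliptic (R⁻ p) z
    stabilizer⁻ {z} m = from (p∣C m) (p∣B pr 5≤p {markedForm m} (hasDiscriminant m) (p∣C m))
      where
      f = markedForm m
      from : + p ∣ C f → + p ∣ B f → StabilizedByElliptic (R⁻ p) z
      from (divides c c≡) (divides t t≡) = even (quotient-even {A f} {B f} {c} disc t t≡)
        where
        f≡ : f ≡ form (A f) (B f) (c ℤ.* + p)
        f≡ = form-≡ refl refl c≡
        disc : discriminant (form (A f) (B f) (c ℤ.* + p)) ≡ ℤ.- + (4 ℕ.* p)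
        disc = ≡.trans (cong discriminant (≡.sym f≡)) (hasDiscriminant m)
        even : + 2 ∣ t → StabilizedByElliptic (R⁻ p) z
        even (divides u u≡) = stabilizer⁻-from {f} {z} (A f) (B f) c u (stabilizer-determinant {A f} {B f} {c} disc u b≡) (positive m) f≡ b≡ (root m)
          where
          b≡ : B f ≡ u ℤ.* + 2 ℤ.* + p
          b≡ = ≡.trans t≡ (cong (ℤ._* + p) u≡)

    zero-form⇒±I : ∀ {γ} (r : R⁺ p γ) → let f = fixedForm (matrix⁺ r) in
                   A f ≡ 0ℤ × B f ≡ 0ℤ × C f ≡ 0ℤ → γ ≈ᴹ I ⊎ γ ≈ᴹ -I
    zero-form⇒±I {γ} r@(mkR⁺ (a , a≈) (b , b≈) (c , c≈) (d , d≈)) (c≡0 , d-a≡0 , -bp≡0) =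
      signs (unit-cases a (≡.trans (≡.sym (ad≡a² c≡0 d≡a)) (det⁺ r)))
      where
      d≡a : d ≡ a
      d≡a = ℤ.i-j≡0⇒i≡j d a d-a≡0
      b≡0 : b ≡ 0ℤ
      b≡0 = Sum.[ (λ e → e) , (λ e → contradiction (≡.sym (ℤ.+-injective e)) (ℕ.<⇒≢ p>0)) ] (ℤ.i*j≡0⇒i≡0∨j≡0 b (ℤ.neg-injective -bp≡0))
      ad≡a² : c ≡ 0ℤ → d ≡ a → det (matrix⁺ r) ≡ a ℤ.* a
      ad≡a² refl refl = solve 2 (λ a bp → a :* a :- bp :* con 0ℤ := a :* a) refl a (b ℤ.* + p)
      unit-cases : ∀ a → a ℤ.* a ≡ 1ℤ → a ≡ 1ℤ ⊎ a ≡ -1ℤ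
      unit-cases a e = Sum.map (λ h → ≡.trans (≡.sym h) (cong +_ ∣a∣≡1)) (λ h → ≡.trans (≡.sym (ℤ.neg-involutive a)) (cong ℤ.-_ (≡.trans (≡.sym h) (cong +_ ∣a∣≡1))))
        (ℤ.+∣i∣≡i⊎+∣i∣≡-i a)
        where
        ∣a∣≡1 : ℤ.∣ a ∣ ≡ 1
        ∣a∣≡1 = ℕ.m*n≡1⇒m≡1 ℤ.∣ a ∣ ℤ.∣ a ∣ (≡.trans (≡.sym (ℤ.abs-* a a)) (cong ℤ.∣_∣ e))
      as : ∀ {x i j} → x ≈ fromℤ i → i ≡ j → x ≈ fromℤ j
      as e refl = e
      as-root : ∀ {x i} → x ≈ fromℤ i * √ p → i ≡ 0ℤ → x ≈ 0ᴿ
      as-root e refl = ≈-trans e (ℝ-Solver.solve 1 (λ s → ℝ-Solver.con (+ 0) ℝ-Solver.:* s ℝ-Solver.:= ℝ-Solver.con (+ 0)) ≈-refl (√ p))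
      signs : a ≡ 1ℤ ⊎ a ≡ -1ℤ → γ ≈ᴹ I ⊎ γ ≈ᴹ -I
      signs (inj₁ e) = inj₁ (mk≈ᴹ (as a≈ e) (as-root b≈ b≡0) (as-root c≈ c≡0) (as d≈ (≡.trans d≡a e)))
      signs (inj₂ e) = inj₂ (mk≈ᴹ (≈-trans (as a≈ e) (fromℤ-neg 1ℤ)) (as-root b≈ b≡0) (as-root c≈ c≡0) (≈-trans (as d≈ (≡.trans d≡a e)) (fromℤ-neg 1ℤ)))

    -- The squared trace is 0, 1 or 4. The value 4 gives a fixed form of discriminant 0, which
    -- vanishes identically, so that γ = ±I.
    marked⁺ : ∀ {γ z} → R⁺ p γ → ¬ (γ ≈ᴹ I) → ¬ (γ ≈ᴹ -I) → γ • z ≈ᴴ z → Marked 4 z ⊎ Marked 3 z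
    marked⁺ {γ} {z} r@(mkR⁺ (a , _) (b , _) (c , _) (d , _)) ≉I ≉-I e = by-trace
      (trace-cases (a ℤ.+ d) (subst (λ d → 0ℤ ℤ.≤ ℤ.- d) disc (discriminant-nonPositive rf (scaled-im>0 z))))
      where
      M = matrix⁺ r
      f = fixedForm M
      rf : Root f (scaled z)
      rf = moebius-fixed {M} (action⇒moebius (represents⁺ r z) {z} e)
      disc : discriminant f ≡ (a ℤ.+ d) ℤ.* (a ℤ.+ d) ℤ.- + 4
      disc = ≡.trans (discriminant-fixedForm M) (cong (λ m → (a ℤ.+ d) ℤ.* (a ℤ.+ d) ℤ.- + 4 ℤ.* m) (det⁺ r))
      from-trace : ∀ {i} → (a ℤ.+ d) ℤ.* (a ℤ.+ d) ≡ i → discriminant f ≡ i ℤ.- + 4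
      from-trace t = ≡.trans disc (cong (ℤ._- + 4) t)
      mark : ∀ {n} → discriminant f ≡ ℤ.- + n →
             ∃[ g ] 0ℤ ℤ.< A g × Root g (scaled z) × discriminant g ≡ discriminant f × (∀ {k} → k ∣ C f → k ∣ C g) → Marked n z
      mark d (g , g>0 , rg , d≡ , ∣C) = record
        { positive = g>0 ; hasDiscriminant = ≡.trans d≡ d ; p∣C = ∣C (∣m⇒∣-m (∣n⇒∣m*n b ∣-refl)) ; root = rg }
      by-trace : _ → Marked 4 z ⊎ Marked 3 z
      by-trace (inj₁ t)        = inj₁ (mark (from-trace t) (positive-root rf (scaled-im>0 z) (n<0 {n = 4} (s≤s z≤n) (from-trace t))))
      by-trace (inj₂ (inj₁ t)) = inj₂ (mark (from-trace t) (positive-root rf (scaled-im>0 z) (n<0 {n = 3} (s≤s z≤n) (from-trace t))))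
      by-trace (inj₂ (inj₂ t)) = contradiction (zero-form⇒±I r (discriminant≡0⇒zero rf (scaled-im>0 z) (from-trace t))) Sum.[ ≉I , ≉-I ]

    -- The elliptic element has rows (−x, −√p) and (k√p, x + e), hence trace e.
    elliptic-point⁺ : ∀ x e k n → k ℤ.* + p ≡ x ℤ.* (x ℤ.+ e) ℤ.+ 1ℤ → e ℤ.* e ℤ.- + 4 ≡ ℤ.- + n → 0 ℕ.< n → 0ℤ ℤ.< k →
                      ∃[ z ] Marked n z × StabilizedByElliptic (R⁺ p) z
    elliptic-point⁺ x e k n k≡ n≡ n>0 k>0 = from (point-over p>0 {f} k>0 disc n>0)
      where
      det≡ : det (matrix (ℤ.- x) (-1ℤ ℤ.* + p) k (x ℤ.+ e)) ≡ 1ℤ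
      det≡ = ≡.trans (solve 4 (λ x e k p → (:- x) :* (x :+ e) :- con -1ℤ :* p :* k := k :* p :- x :* (x :+ e)) refl x e k (+ p))
        (≡.trans (cong (ℤ._- x ℤ.* (x ℤ.+ e)) k≡) (solve 1 (λ u → u :+ con 1ℤ :- u := con 1ℤ) refl (x ℤ.* (x ℤ.+ e))))
      ε = element⁺ (ℤ.- x) -1ℤ k (x ℤ.+ e) det≡
      ε∈R⁺ : R⁺ p ε
      ε∈R⁺ = element⁺∈R⁺ (ℤ.- x) -1ℤ k (x ℤ.+ e) det≡
      f = fixedForm (matrix⁺ ε∈R⁺)
      disc : discriminant f ≡ ℤ.- + n
      disc = ≡.trans (discriminant-fixedForm (matrix⁺ ε∈R⁺)) (≡.trans (cong₂ (λ t m → t ℤ.* t ℤ.- + 4 ℤ.* m)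
        (solve 2 (λ x e → :- x :+ (x :+ e) := e) refl x e) det≡) n≡)
      k√p≉0 : ¬ (fromℤ k * √ p ≈ 0ᴿ)
      k√p≉0 = <-irrefl (*-pos (fromℤ-pos k>0) (√-pos p>0))
      from : ∃[ z ] Root f (scaled z) → ∃[ z ] Marked n z × StabilizedByElliptic (R⁺ p) z
      from (z , rz) = z ,
        record { positive = k>0 ; hasDiscriminant = disc ; p∣C = ∣m⇒∣-m (∣n⇒∣m*n -1ℤ ∣-refl) ; root = rz } ,
        ε , ε∈R⁺ , (λ (mk≈ᴹ _ _ c≈0 _) → k√p≉0 c≈0) , (λ (mk≈ᴹ _ _ c≈0 _) → k√p≉0 c≈0) ,
        moebius⇒action (represents⁺ ε∈R⁺ z) {z} (fixed-moebius {matrix⁺ ε∈R⁺} rz)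

-- The classes in Ell⁺(p) and Ell⁻(p).

module EllipticClasses where

  open import Data.Fin.Base using (Fin; zero; suc)
  open import Data.Integer.Base as ℤ using (ℤ; +_; 0ℤ; 1ℤ; -1ℤ)
  open import Data.Integer.Divisibility.Signed using (_∣_; divides; ∣-refl; ∣n⇒∣m*n)
  import Data.Integer.Properties as ℤ
  open import Data.Integer.Solver using (module +-*-Solver)
  open import Data.Nat.Base as ℕ using (ℕ; zero; suc; z≤n; s≤s)
  import Data.Nat.Divisibility as ℕ
  import Data.Nat.DivMod as ℕ
  import Data.Nat.Properties as ℕ
  open import Data.Nat.Primality using (Prime; prime?)
  open import Data.Nat.Solver using () renaming (module +-*-Solver to ℕ-Solver)
  open import Data.Product.Base using (Σ; ∃-syntax; _×_; _,_; proj₁; proj₂)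
  open import Data.Sum.Base as Sum using (_⊎_; inj₁; inj₂)
  open import Data.Empty using (⊥-elim)
  open import Defs hiding (a; b; c; d; det; scaled; root)
  open import Function.Bundles using (Bijection)
  open import Level using (0ℓ)
  import Relation.Binary.Construct.On as On
  open import Relation.Binary.Bundles using (Setoid)
  open import Relation.Binary.PropositionalEquality as ≡ using (_≡_; _≢_; refl; cong; cong₂; subst)
  open import Relation.Nullary using (¬_; contradiction)
  open import Relation.Nullary.Decidable using (toWitness; toWitnessFalse)
  open PrimeModulus
  open BinaryForms
  open FormRoots
  open MatrixAction
  open FormsModPrime
  open RootConstructions
  open MarkedPoints
  open EllipticElements
  open +-*-Solver using (solve; con; _:+_; _:*_; _:-_; :-_; _:=_)
  open Setoid ℂ-setoid using () renaming (refl to ≈ᶜ-refl)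

  -- The matrix on the left is √p times the inverse of the Fricke involution, in the coordinate √p z.
  fricke-form : ∀ a b c p → form a b (c ℤ.* p) ∘ᶠ matrix (0ℤ ℤ.* p) (1ℤ ℤ.* p) -1ℤ (0ℤ ℤ.* p) ≡ scale p (form c (ℤ.- b) (a ℤ.* p))
  fricke-form a b c p = form-≡
    (solve 4 (λ a b c p → valueᴾ a b (c :* p) (con 0ℤ :* p) (con -1ℤ) := p :* c) refl a b c p)
    (solve 4 (λ a b c p → polarᴾ a b (c :* p) (con 0ℤ :* p) (con 1ℤ :* p) (con -1ℤ) (con 0ℤ :* p) := p :* (:- b)) refl a b c p)
    (solve 4 (λ a b c p → valueᴾ a b (c :* p) (con 1ℤ :* p) (con 0ℤ :* p) := p :* (a :* p)) refl a b c p)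

  -- The two types are convertible, but at the setoids of this theorem Agda would compare them by unfolding the action on ℍ.
  on-intro : (S : Setoid 0ℓ 0ℓ) {X : Set} (f : X → Setoid.Carrier S) {x y : X} →
             Setoid._≈_ S (f x) (f y) → Setoid._≈_ (On.setoid S f) x y
  on-intro S f e = e

  on-elim : (S : Setoid 0ℓ 0ℓ) {X : Set} (f : X → Setoid.Carrier S) {x y : X} →
            Setoid._≈_ (On.setoid S f) x y → Setoid._≈_ S (f x) (f y)
  on-elim S f e = e

  module Orbits {p : ℕ} (pr : Prime p) (5≤p : 5 ℕ.≤ p) where
    open Fixed pr 5≤p
    open Setoid (orbits p) using () renaming (refl to ∼-orbit-refl; sym to ∼-orbit-sym; trans to ∼-orbit-trans)

    inverse⁻ : ∀ {γ} → R⁻ p γ → R⁻ p (γ ⁻¹)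
    inverse⁻ (mkR⁻ a b c d) = mkR⁻ d (int-neg b) (int-neg c) a

    pushforward⁻ : ∀ {ε} (r : R⁻ p ε) {f z} → Root f (scaled z) → Root (f ∘ᶠ matrix⁻ (inverse⁻ r)) (scaled (ε • z))
    pushforward⁻ {ε} r {f} {z} = pullback⁻ (inverse⁻ r) {f} {ε • z} {z} (•-inverse ε z (ε • z) (≈ᶜ-refl {point (ε • z)}))

    fricke : SL₂ℝ
    fricke = element⁻ 0ℤ -1ℤ 1ℤ 0ℤ refl

    fricke∈R⁻ : R⁻ p fricke
    fricke∈R⁻ = element⁻∈R⁻ 0ℤ -1ℤ 1ℤ 0ℤ refl

    fricke-root : ∀ {a b c z} → Root (form a b (c ℤ.* + p)) (scaled z) → Root (form c (ℤ.- b) (a ℤ.* + p)) (scaled (fricke • z))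
    fricke-root {a} {b} {c} {z} r = root-unscale (ℤ.+<+ p>0)
      (subst (λ g → Root g (scaled (fricke • z))) (fricke-form a b c (+ p)) (pushforward⁻ fricke∈R⁻ {form a b (c ℤ.* + p)} {z} r))

    -- The form [A, B, cp] becomes [c, -B, Ap]. The sign of B modulo p tells the two roots modulo p
    -- apart, so this is their exchange.
    fricke-marked : ∀ {n z} → 0 ℕ.< n → (m : Marked n z) → Σ (Marked n (fricke • z)) λ m′ → B (markedForm m′) ≡ ℤ.- B (markedForm m)
    fricke-marked {n} {z} n>0 m = from (p∣C m)
      where
      f = markedForm m
      from : + p ∣ C f → Σ (Marked n (fricke • z)) λ m′ → B (markedForm m′) ≡ ℤ.- B f
      from (divides c c≡) = record
        { markedForm = form c (ℤ.- B f) (A f ℤ.* + p)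
        ; positive = pos-cancelˡ {+ p} {c} (ℤ.+<+ p>0) (subst (0ℤ ℤ.<_) (≡.trans c≡ (ℤ.*-comm c (+ p))) (C>0 {f} (positive m) (n<0 n>0 (hasDiscriminant m))))
        ; hasDiscriminant = ≡.trans (solve 4 (λ a b c p → discriminantᴾ c (:- b) (a :* p) := discriminantᴾ a b (c :* p)) refl (A f) (B f) c (+ p))
            (≡.trans (cong discriminant (≡.sym f≡)) (hasDiscriminant m))
        ; p∣C = ∣n⇒∣m*n (A f) ∣-refl
        ; root = fricke-root {A f} {B f} {c} {z} (subst (λ g → Root g (scaled z)) f≡ (root m)) } , refl
        where
        f≡ : f ≡ form (A f) (B f) (c ℤ.* + p)
        f≡ = form-≡ refl refl c≡

    module _ {n h} (n>0 : 0 ℕ.< n) (n<p : n ℕ.< p) (principal : ∀ {f} → 0ℤ ℤ.< A f → discriminant f ≡ ℤ.- + n → f ∼ h) where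

      aligned⇒equivalent : ∀ {z v} (m : Marked n z) (m′ : Marked n v) → + p ∣ B (markedForm m) ℤ.- B (markedForm m′) → z ∼[ p ] v
      aligned⇒equivalent {z} {v} m m′ p∣ΔB = from (∼-trans (principal {f} (positive m′) (hasDiscriminant m′)) (∼-sym (principal {g} (positive m) (hasDiscriminant m))))
        where
        g = markedForm m
        f = markedForm m′
        from : f ∼ g → z ∼[ p ] v
        from (mk∼ M unimodular g≡) = ∼⇒equivalent {f} {g} {z} {v} M unimodular g≡
          (upper-right-divisible pr {f} {g} {M} g≡ unimodular (p∣C m′) (p∣C m) p∣ΔB
            (∤-2B pr {f} {n} (ℕ.≤-trans (s≤s (s≤s (s≤s z≤n))) 5≤p) n>0 n<p (hasDiscriminant m′) (p∣C m′)))
          (positive m′) (root m) (root m′)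

      -- As B² ≡ -n modulo p for both forms, their middle coefficients agree up to sign. If the
      -- signs differ, v is first moved by `fricke`.
      marked⇒equivalent : ∀ {z v} → Marked n z → Marked n v → z ∼[ p ] v
      marked⇒equivalent {z} {v} m m′ = Sum.[ aligned⇒equivalent m m′ , opposed (fricke-marked n>0 m′) ]
        (same-B-mod pr {markedForm m′} {markedForm m} (≡.trans (hasDiscriminant m′) (≡.sym (hasDiscriminant m))) (p∣C m′) (p∣C m))
        where
        opposed : (Σ (Marked n (fricke • v)) λ m″ → B (markedForm m″) ≡ ℤ.- B (markedForm m′)) →
                  + p ∣ B (markedForm m) ℤ.+ B (markedForm m′) → z ∼[ p ] v
        opposed (m″ , B≡) h = ∼-orbit-trans {z} {fricke • v} {v}
          (aligned⇒equivalent m m″ (subst (+ p ∣_) (cong (λ b → B (markedForm m) ℤ.+ b) (≡.trans (≡.sym (ℤ.neg-involutive (B (markedForm m′)))) (cong ℤ.-_ (≡.sym B≡)))) h))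
          (∼-orbit-sym {v} {fricke • v} (fricke , inj₂ fricke∈R⁻ , ≈ᶜ-refl {point (fricke • v)}))

    4<p : 4 ℕ.< p
    4<p = 5≤p

    3<p : 3 ℕ.< p
    3<p = ℕ.<-trans (s≤s (s≤s (s≤s (s≤s z≤n)))) 5≤p

    4∼ : ∀ {z v} → Marked 4 z → Marked 4 v → z ∼[ p ] v
    4∼ {z} {v} = marked⇒equivalent {4} (s≤s z≤n) 4<p (λ {f} → principal-4 {f}) {z} {v}

    3∼ : ∀ {z v} → Marked 3 z → Marked 3 v → z ∼[ p ] v
    3∼ {z} {v} = marked⇒equivalent {3} (s≤s z≤n) 3<p (λ {f} → principal-3 {f}) {z} {v}

    prime[3] : Prime 3
    prime[3] = toWitness {a? = prime? 3} _

    -- 3a² = 4b² is impossible for a ≠ 0, by the exponent of 3.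
    4≁3 : ∀ {z v} → z ∼[ p ] v → Marked 4 z → ¬ Marked 3 v
    4≁3 {z} {v} z∼v m m′ = from (discriminant-ratio {4} {3} {z} {v} z∼v m m′)
      where
      from : ¬ (∃[ a ] ∃[ b ] a ≢ 0 × 3 ℕ.* (a ℕ.* a) ≡ 4 ℕ.* (b ℕ.* b))
      from (a , b , a≢0 , e) = a≢0 (square-ratio prime[3] {4} (toWitnessFalse {a? = 3 ℕ.∣? 4} _) a b e)

    -- A point of the class fixed by an element of R⁻ would give p(2a)² = nb² with a ≠ 0, which the
    -- exponent of p excludes.
    ∉Ell⁻ : ∀ {n z} → 0 ℕ.< n → n ℕ.< p → Marked n z → ¬ Ell⁻-class p z
    ∉Ell⁻ {n} {z} n>0 n<p m (w , z∼w , γ , r , _ , _ , e) = from (discriminant-ratio {n} {4 ℕ.* p} {z} {w} z∼w m (marked⁻ {γ} {w} r e))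
      where
      from : ¬ (∃[ a ] ∃[ b ] a ≢ 0 × 4 ℕ.* p ℕ.* (a ℕ.* a) ≡ n ℕ.* (b ℕ.* b))
      from (a , b , a≢0 , eq) = Sum.[ (λ ()) , a≢0 ] (ℕ.m*n≡0⇒m≡0∨n≡0 2 (square-ratio pr {n} (∤-small n>0 n<p) (2 ℕ.* a) b (≡.trans (double p a) eq)))
        where
        double : ∀ p a → p ℕ.* (2 ℕ.* a ℕ.* (2 ℕ.* a)) ≡ 4 ℕ.* p ℕ.* (a ℕ.* a)
        double = ℕ-Solver.solve 2 (λ p a → p ℕ-Solver.:* (ℕ-Solver.con 2 ℕ-Solver.:* a ℕ-Solver.:* (ℕ-Solver.con 2 ℕ-Solver.:* a))
          ℕ-Solver.:= ℕ-Solver.con 4 ℕ-Solver.:* p ℕ-Solver.:* (a ℕ-Solver.:* a)) refl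

    Ell⁺-point : Set
    Ell⁺-point = Σ ℍ λ z → IsEllipticPoint p z × ¬ Ell⁻-class p z

    ell⁺-intro : ∀ {x y : Ell⁺-point} → proj₁ x ∼[ p ] proj₁ y → Setoid._≈_ (Ell⁺ p) x y
    ell⁺-intro {x} {y} = on-intro (orbits p) {Σ ℍ λ z → IsEllipticPoint p z × ¬ Ell⁻-class p z} proj₁ {x} {y}

    ell⁺-elim : ∀ {x y : Ell⁺-point} → Setoid._≈_ (Ell⁺ p) x y → proj₁ x ∼[ p ] proj₁ y
    ell⁺-elim {x} {y} = on-elim (orbits p) {Σ ℍ λ z → IsEllipticPoint p z × ¬ Ell⁻-class p z} proj₁ {x} {y}

    kind : (x : Ell⁺-point) → Marked 4 (proj₁ x) ⊎ Marked 3 (proj₁ x)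
    kind (z , (γ , inj₁ r , ≉I , ≉-I , e) , _)   = marked⁺ {γ} {z} r ≉I ≉-I e
    kind (z , (γ , inj₂ r , ≉I , ≉-I , e) , ∉⁻) = contradiction (z , ∼-orbit-refl {z} , γ , r , ≉I , ≉-I , e) ∉⁻

    ell⁺-point : ∀ {n} → 0 ℕ.< n → n ℕ.< p → ∃[ z ] Marked n z × StabilizedByElliptic (R⁺ p) z → Σ Ell⁺-point λ x → Marked n (proj₁ x)
    ell⁺-point n>0 n<p (z , m , γ , r , ≉I , ≉-I , e) = (z , (γ , inj₁ r , ≉I , ≉-I , e) , ∉Ell⁻ n>0 n<p m) , m

    -- Completing the square: 4pk = (2x + e)² + (4 - e²).
    positive-quotient : ∀ {x e k} → + 4 ℤ.- e ℤ.* e ℤ.> 0ℤ → k ℤ.* + p ≡ x ℤ.* (x ℤ.+ e) ℤ.+ 1ℤ → 0ℤ ℤ.< k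
    positive-quotient {x} {e} {k} h k≡ = pos-cancelˡ {+ 4 ℤ.* + p} (pos-*-pos {+ 4} {+ p} (ℤ.+<+ (s≤s z≤n)) (ℤ.+<+ p>0)) (subst (0ℤ ℤ.<_)
      (≡.trans (solve 2 (λ x e → (con (+ 2) :* x :+ e) :* (con (+ 2) :* x :+ e) :+ (con (+ 4) :- e :* e) := con (+ 4) :* (x :* (x :+ e) :+ con 1ℤ)) refl x e)
        (≡.trans (cong (+ 4 ℤ.*_) (≡.sym k≡)) (solve 2 (λ k p → con (+ 4) :* (k :* p) := con (+ 4) :* p :* k) refl k (+ p))))
      (ℤ.+-mono-≤-< (square≥0 (+ 2 ℤ.* x ℤ.+ e)) h))

    point-4 : ∀ k → p ≡ 1 ℕ.+ 4 ℕ.* k → Σ Ell⁺-point λ x → Marked 4 (proj₁ x)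
    point-4 k p≡ = from (sqrt-1 pr k p≡)
      where
      from : ∃[ x ] + p ∣ x ℤ.* x ℤ.+ 1ℤ → Σ Ell⁺-point λ x → Marked 4 (proj₁ x)
      from (x , divides k k≡) = ell⁺-point (s≤s z≤n) 4<p (elliptic-point⁺ x 0ℤ k 4 k≡′ refl (s≤s z≤n) (positive-quotient {x} {0ℤ} {k} (ℤ.+<+ (s≤s z≤n)) k≡′))
        where
        k≡′ : k ℤ.* + p ≡ x ℤ.* (x ℤ.+ 0ℤ) ℤ.+ 1ℤ
        k≡′ = ≡.trans (≡.sym k≡) (solve 1 (λ x → x :* x :+ con 1ℤ := x :* (x :+ con 0ℤ) :+ con 1ℤ) refl x)

    point-3 : ∀ k → p ≡ 1 ℕ.+ 3 ℕ.* k → Σ Ell⁺-point λ x → Marked 3 (proj₁ x)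
    point-3 k p≡ = from (cube-root-of-1 pr k p≡)
      where
      from : ∃[ x ] + p ∣ x ℤ.* x ℤ.+ x ℤ.+ 1ℤ → Σ Ell⁺-point λ x → Marked 3 (proj₁ x)
      from (x , divides k k≡) = ell⁺-point (s≤s z≤n) 3<p (elliptic-point⁺ x 1ℤ k 3 k≡′ refl (s≤s z≤n) (positive-quotient {x} {1ℤ} {k} (ℤ.+<+ (s≤s z≤n)) k≡′))
        where
        k≡′ : k ℤ.* + p ≡ x ℤ.* (x ℤ.+ 1ℤ) ℤ.+ 1ℤ
        k≡′ = ≡.trans (≡.sym k≡) (solve 1 (λ x → x :* x :+ x :+ con 1ℤ := x :* (x :+ con 1ℤ) :+ con 1ℤ) refl x)

    no-4 : ∀ {z} → p ℕ.% 4 ≡ 3 → ¬ Marked 4 z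
    no-4 p%4 m = discriminant-4⇒p%4≢3 p>0 {markedForm m} (p∣C m) (hasDiscriminant m) p%4

    no-3 : ∀ {z} → p ℕ.% 3 ≡ 2 → ¬ Marked 3 z
    no-3 p%3 m = discriminant-3⇒p%3≢2 p>0 {markedForm m} (p∣C m) (hasDiscriminant m) p%3

    index : ∀ {z} → Marked 4 z ⊎ Marked 3 z → Fin 2
    index (inj₁ _) = zero
    index (inj₂ _) = suc zero

    index-cong : ∀ {z v} → z ∼[ p ] v → (k : Marked 4 z ⊎ Marked 3 z) (l : Marked 4 v ⊎ Marked 3 v) → index k ≡ index l
    index-cong         z∼v (inj₁ _) (inj₁ _) = refl
    index-cong {z} {v} z∼v (inj₁ m) (inj₂ n) = contradiction n (4≁3 {z} {v} z∼v m)
    index-cong {z} {v} z∼v (inj₂ m) (inj₁ n) = contradiction m (4≁3 {v} {z} (∼-orbit-sym {z} {v} z∼v) n)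
    index-cong         z∼v (inj₂ _) (inj₂ _) = refl

    index-injective : ∀ {z v} (k : Marked 4 z ⊎ Marked 3 z) (l : Marked 4 v ⊎ Marked 3 v) → index k ≡ index l → z ∼[ p ] v
    index-injective {z} {v} (inj₁ m) (inj₁ n) _ = 4∼ {z} {v} m n
    index-injective {z} {v} (inj₂ m) (inj₂ n) _ = 3∼ {z} {v} m n

    index-surjective : (x₄ : Σ Ell⁺-point λ x → Marked 4 (proj₁ x)) (x₃ : Σ Ell⁺-point λ x → Marked 3 (proj₁ x)) →
      ∀ i → Σ Ell⁺-point λ x → ∀ {y : Ell⁺-point} → Setoid._≈_ (Ell⁺ p) y x → index (kind y) ≡ i
    index-surjective (x , m) _ zero       = x , λ {y} y≈x → index-cong {proj₁ y} {proj₁ x} (ell⁺-elim {y} {x} y≈x) (kind y) (inj₁ m)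
    index-surjective _ (x , m) (suc zero) = x , λ {y} y≈x → index-cong {proj₁ y} {proj₁ x} (ell⁺-elim {y} {x} y≈x) (kind y) (inj₂ m)

    two-classes : (Σ Ell⁺-point λ x → Marked 4 (proj₁ x)) → (Σ Ell⁺-point λ x → Marked 3 (proj₁ x)) → HasCardinality (Ell⁺ p) 2
    two-classes x₄ x₃ = record
      { to = λ x → index (kind x)
      ; cong = λ {x} {y} x≈y → index-cong {proj₁ x} {proj₁ y} (ell⁺-elim {x} {y} x≈y) (kind x) (kind y)
      ; bijective = (λ {x} {y} e → ell⁺-intro {x} {y} (index-injective {proj₁ x} {proj₁ y} (kind x) (kind y) e)) , index-surjective x₄ x₃ }

    one-class : Ell⁺-point → (∀ (x y : Ell⁺-point) → proj₁ x ∼[ p ] proj₁ y) → HasCardinality (Ell⁺ p) 1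
    one-class x all = record
      { to = λ _ → zero ; cong = λ _ → refl
      ; bijective = (λ {x} {y} _ → ell⁺-intro {x} {y} (all x y)) , λ { zero → x , λ _ → refl } }

    no-class : ¬ Ell⁺-point → HasCardinality (Ell⁺ p) 0
    no-class none = record
      { to = λ x → ⊥-elim (none x) ; cong = λ {x} _ → ⊥-elim (none x)
      ; bijective = (λ {x} _ → ⊥-elim (none x)) , λ () }

    only : ∀ {m n} → (∀ {z} → ¬ Marked n z) → (∀ {z} → Marked 4 z ⊎ Marked 3 z → Marked m z ⊎ Marked n z) →
           (∀ {z v} → Marked m z → Marked m v → z ∼[ p ] v) → ∀ (x y : Ell⁺-point) → proj₁ x ∼[ p ] proj₁ y
    only none sort same x y = same {proj₁ x} {proj₁ y} (pick x) (pick y)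
      where
      pick : (x : Ell⁺-point) → _
      pick x = Sum.[ (λ m → m) , (λ n → contradiction n none) ] (sort (kind x))

    module _ {r} (p%12 : p ℕ.% 12 ≡ r) where
      private
        q = p ℕ./ 12

      p≡r+12q : p ≡ r ℕ.+ q ℕ.* 12
      p≡r+12q = ≡.trans (ℕ.m≡m%n+[m/n]*n p 12) (cong (ℕ._+ q ℕ.* 12) p%12)

      p%4≡r%4 : p ℕ.% 4 ≡ r ℕ.% 4
      p%4≡r%4 = ≡.trans (cong (ℕ._% 4) (≡.trans p≡r+12q (cong (r ℕ.+_) (≡.sym (ℕ.*-assoc q 3 4))))) (ℕ.[m+kn]%n≡m%n r (q ℕ.* 3) 4)

      p%3≡r%3 : p ℕ.% 3 ≡ r ℕ.% 3
      p%3≡r%3 = ≡.trans (cong (ℕ._% 3) (≡.trans p≡r+12q (cong (r ℕ.+_) (≡.sym (ℕ.*-assoc q 4 3))))) (ℕ.[m+kn]%n≡m%n r (q ℕ.* 4) 3)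

    1+4k : p ℕ.% 4 ≡ 1 → p ≡ 1 ℕ.+ 4 ℕ.* (p ℕ./ 4)
    1+4k e = ≡.trans (ℕ.m≡m%n+[m/n]*n p 4) (cong₂ ℕ._+_ e (ℕ.*-comm (p ℕ./ 4) 4))

    1+3k : p ℕ.% 3 ≡ 1 → p ≡ 1 ℕ.+ 3 ℕ.* (p ℕ./ 3)
    1+3k e = ≡.trans (ℕ.m≡m%n+[m/n]*n p 3) (cong₂ ℕ._+_ e (ℕ.*-comm (p ℕ./ 3) 3))

    ell⁺-1 : p ℕ.% 12 ≡ 1 → HasCardinality (Ell⁺ p) 2
    ell⁺-1 e = two-classes (point-4 (p ℕ./ 4) (1+4k (p%4≡r%4 e))) (point-3 (p ℕ./ 3) (1+3k (p%3≡r%3 e)))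

    ell⁺-5-7 : p ℕ.% 12 ≡ 5 ⊎ p ℕ.% 12 ≡ 7 → HasCardinality (Ell⁺ p) 1
    -- 5 is 1 modulo 4 and 2 modulo 3, so only discriminant -4 occurs; for 7 the roles of 4 and 3
    -- are exchanged.
    ell⁺-5-7 (inj₁ e) = one-class (proj₁ (point-4 (p ℕ./ 4) (1+4k (p%4≡r%4 e)))) (only {4} {3} (no-3 (p%3≡r%3 e)) (λ k → k) (λ {z} {v} → 4∼ {z} {v}))
    ell⁺-5-7 (inj₂ e) = one-class (proj₁ (point-3 (p ℕ./ 3) (1+3k (p%3≡r%3 e)))) (only {3} {4} (no-4 (p%4≡r%4 e)) Sum.swap (λ {z} {v} → 3∼ {z} {v}))

    ell⁺-11 : p ℕ.% 12 ≡ 11 → HasCardinality (Ell⁺ p) 0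
    ell⁺-11 e = no-class λ x → Sum.[ no-4 (p%4≡r%4 e) , no-3 (p%3≡r%3 e) ] (kind x)

    Target : Set
    Target = Σ Form λ f → PositiveDefinite f × Reduced f × discriminant f ≡ ℤ.- + (4 ℕ.* p)

    Reduction : Form → Set
    Reduction f = ∃[ g ] f ∼ g × 0ℤ ℤ.< A g × Reduced g × discriminant g ≡ ℤ.- + (4 ℕ.* p)

    reduction : ∀ {z} (m : Marked (4 ℕ.* p) z) → Reduction (markedForm m)
    reduction m = reduce-to {markedForm m} (positive m) 4p>0 (hasDiscriminant m)

    target : ∀ {f} → Reduction f → Target
    target (g , _ , g>0 , r , d) = g , positiveDefinite {g} g>0 (n<0 4p>0 d) , r , d

    -- Arbitrary reductions are allowed, so that in the proof of surjectivity the given reduced form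
    -- can take the place of a computed one.
    target-cong : ∀ {f f′} → f ∼ f′ → (s : Reduction f) (s′ : Reduction f′) → proj₁ s ≡ proj₁ s′
    target-cong f∼f′ (g , s , g>0 , r , _) (g′ , s′ , g′>0 , r′ , _) =
      reduced-unique {g} {g′} g>0 g′>0 r r′ (∼-trans (∼-sym s) (∼-trans f∼f′ s′))

    -- An equivalence by an element of R⁻ is turned into one by an element of R⁺ by composing it with the stabilizer in R⁻.
    equivalent-marked : ∀ {z v} → z ∼[ p ] v → StabilizedByElliptic (R⁻ p) z → (m : Marked (4 ℕ.* p) z) (m′ : Marked (4 ℕ.* p) v) →
                        markedForm m ∼ markedForm m′
    equivalent-marked {z} {v} (δ , inj₁ r , e) _ m m′ = ∼-sym (equivalent⇒∼ {γ = δ} {z} {v} 4p>0 r e m m′)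
    equivalent-marked {z} {v} (δ , inj₂ r , e) (γ , s , _ , _ , e′) m m′ =
      ∼-sym (equivalent⇒∼ {γ = δ ∙ γ} {z} {v} 4p>0 (product⁻⁻ r s) (•-compose γ δ z z v e′ e) m m′)

    Ell⁻-point : Set
    Ell⁻-point = Σ ℍ (StabilizedByElliptic (R⁻ p))

    ell⁻-intro : ∀ {x y : Ell⁻-point} → proj₁ x ∼[ p ] proj₁ y → Setoid._≈_ (Ell⁻ p) x y
    ell⁻-intro {x} {y} = on-intro (orbits p) {Σ ℍ (StabilizedByElliptic (R⁻ p))} proj₁ {x} {y}

    ell⁻-elim : ∀ {x y : Ell⁻-point} → Setoid._≈_ (Ell⁻ p) x y → proj₁ x ∼[ p ] proj₁ y
    ell⁻-elim {x} {y} = on-elim (orbits p) {Σ ℍ (StabilizedByElliptic (R⁻ p))} proj₁ {x} {y}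

    mark : (x : Ell⁻-point) → Marked (4 ℕ.* p) (proj₁ x)
    mark (z , γ , r , _ , _ , e) = marked⁻ {γ} {z} r e

    ell⁻-cong : ∀ {x y : Ell⁻-point} → proj₁ x ∼[ p ] proj₁ y → proj₁ (reduction (mark x)) ≡ proj₁ (reduction (mark y))
    ell⁻-cong {x} {y} x∼y = target-cong (equivalent-marked {proj₁ x} {proj₁ y} x∼y (proj₂ x) (mark x) (mark y)) (reduction (mark x)) (reduction (mark y))

    ell⁻-injective : ∀ {z v} (m : Marked (4 ℕ.* p) z) (m′ : Marked (4 ℕ.* p) v) →
                     (s : Reduction (markedForm m)) (s′ : Reduction (markedForm m′)) → proj₁ s ≡ proj₁ s′ → z ∼[ p ] v
    ell⁻-injective {z} {v} m m′ (g , s , _) (_ , s′ , _) refl = from (∼-trans s′ (∼-sym s))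
      where
      from : markedForm m′ ∼ markedForm m → z ∼[ p ] v
      from (mk∼ M unimodular g≡) = ∼⇒equivalent {markedForm m′} {markedForm m} {z} {v} M unimodular g≡
        (upper-right-divisible′ pr 5≤p {markedForm m′} (hasDiscriminant m′) {markedForm m} {M} g≡ (p∣C m′) (p∣C m))
        (positive m′) (root m) (root m′)

    ell⁻-surjective : (y : Target) → Σ Ell⁻-point λ x → ∀ {x′} → proj₁ x′ ∼[ p ] proj₁ x → proj₁ (reduction (mark x′)) ≡ proj₁ y
    ell⁻-surjective (h , pd , r , d) = from (move-root pr 5≤p {h} d h>0)
      where
      h>0 = positiveDefinite⇒A>0 {h} pd
      Goal : Set
      Goal = Σ Ell⁻-point λ x → ∀ {x′} → proj₁ x′ ∼[ p ] proj₁ x → proj₁ (reduction (mark x′)) ≡ h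
      from : ∃[ g ] h ∼ g × 0ℤ ℤ.< A g × + p ∣ C g → Goal
      from (g , h∼g , g>0 , p∣Cg) = over (point-over p>0 {g} g>0 dg 4p>0)
        where
        dg : discriminant g ≡ ℤ.- + (4 ℕ.* p)
        dg = ≡.trans (∼-discriminant h∼g) d
        over : ∃[ z ] Root g (scaled z) → Goal
        -- `h` itself serves as the reduction of `g`, being reduced and equivalent to it.
        over (z , rz) = (z , stabilizer⁻ m) , λ {x′} x′∼z → target-cong {markedForm (mark x′)} {g}
          (equivalent-marked {proj₁ x′} {z} x′∼z (proj₂ x′) (mark x′) m) (reduction (mark x′)) (h , ∼-sym h∼g , h>0 , r , d)
          where
          m : Marked (4 ℕ.* p) z
          m = record { markedForm = g ; positive = g>0 ; hasDiscriminant = dg ; p∣C = p∣Cg ; root = rz }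

    ell⁻-bijection : Bijection (Ell⁻ p) (reducedForms (ℤ.- + (4 ℕ.* p)))
    ell⁻-bijection = record
      { to = λ x → target (reduction (mark x))
      ; cong = λ {x} {y} x≈y → ell⁻-cong {x} {y} (ell⁻-elim {x} {y} x≈y)
      ; bijective = (λ {x} {y} e → ell⁻-intro {x} {y} (ell⁻-injective {proj₁ x} {proj₁ y} (mark x) (mark y) (reduction (mark x)) (reduction (mark y)) e))
                  , λ y → proj₁ (ell⁻-surjective y) , λ {x} x≈ → proj₂ (ell⁻-surjective y) {x} (ell⁻-elim {x} {proj₁ (ell⁻-surjective y)} x≈) }

open import Defs using (HasCardinality; Ell⁺; Ell⁻; reducedForms)
open import Data.Nat using (ℕ; _≤_; _*_; _%_)
open import Data.Nat.Primality using (Prime)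
open import Data.Integer using (+_; -_)
open import Data.Product using (_×_; _,_)
open import Data.Sum using (_⊎_)
open import Function.Bundles using (Bijection)
open import Relation.Binary.PropositionalEquality using (_≡_)

theorem1p1 : (p : ℕ) → Prime p → 5 ≤ p →
    ((p % 12 ≡ 1 → HasCardinality (Ell⁺ p) 2) ×
    (p % 12 ≡ 5 ⊎ p % 12 ≡ 7 → HasCardinality (Ell⁺ p) 1) ×
    (p % 12 ≡ 11 → HasCardinality (Ell⁺ p) 0)) ×
    Bijection (Ell⁻ p) (reducedForms (- (+ (4 * p))))
theorem1p1 p pr 5≤p = (ell⁺-1 , ell⁺-5-7 , ell⁺-11) , ell⁻-bijection
  where open EllipticClasses.Orbits pr 5≤p
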